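{- There is an absolute constant $c>0$ such that for all positive integers $n,p$, $$\beta(n,p,\infty)=O\left(\frac{p^2}{2^{c\log^* p}}+n\right).$$
   Context: A path system is a pair $(V,\Pi)$ with $V$ a finite node set and $\Pi$ a finite multiset of paths, each a finite sequence of pairwise distinct nodes; the size is $\sum_{\pi\in\Pi}|\pi|$ where $|\pi|$ is the number of nodes. A $b$-bridge consists of $b$ distinct nodes $v_1,\dots,v_b$ and $b$ distinct paths $\pi_1,\dots,\pi_b$ with $v_i$ preceding $v_{i+1}$ on $\pi_i$ for $1\le i\le b-1$ and $v_1$ preceding $v_b$ on $\pi_b$. $\beta(n,p,\infty)$ is the maximum size of a path system with $n$ nodes, $p$ paths and no bridges. $\log^*$ is the iterated logarithm. -}

module Defs where

open import Data.Nat using (ℕ; zero; suc; _+_; _*_; _<_; _≤_; _/_)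
open import Data.Nat.Logarithm using (⌊log₂_⌋)
open import Data.Fin using (Fin; toℕ; inject₁; fromℕ) renaming (zero to fzero; suc to fsuc)
open import Data.List using (List; length; lookup; map)
open import Data.Nat.ListAction using (sum)
open import Data.List.Relation.Unary.Unique.Propositional using (Unique)
open import Data.List.Relation.Unary.All using (All)
open import Data.Product using (Σ; ∃; _×_)
open import Function.Definitions using (Injective)
open import Relation.Binary.PropositionalEquality using (_≡_)
open import Relation.Nullary using (¬_)

-- Iterated logarithm (base 2): log* x = 0 if x ≤ 1, else 1 + log* ⌊log₂ x⌋.
-- Implemented with fuel; fuel x suffices since ⌊log₂ x⌋ < x for x ≥ 2.
log*-fuel : ℕ → ℕ → ℕ
log*-fuel zero x = 0
log*-fuel (suc f) zero = 0
log*-fuel (suc f) (suc zero) = 0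
log*-fuel (suc f) (suc (suc x)) = suc (log*-fuel f ⌊log₂ suc (suc x) ⌋)

log* : ℕ → ℕ
log* x = log*-fuel x x

record PathSystem (n : ℕ) : Set where
  field
    paths    : List (List (Fin n))
    distinct : All Unique paths

open PathSystem public

numPaths : ∀ {n} → PathSystem n → ℕ
numPaths S = length (paths S)

size : ∀ {n} → PathSystem n → ℕ
size S = sum (map length (paths S))

path : ∀ {n} (S : PathSystem n) → Fin (numPaths S) → List (Fin n)
path S k = lookup (paths S) k

Precedes : ∀ {n} → List (Fin n) → Fin n → Fin n → Set
Precedes π v w = Σ (Fin (length π)) λ i → Σ (Fin (length π)) λ j →
  (toℕ i < toℕ j) × (lookup π i ≡ v) × (lookup π j ≡ w)

-- a b-bridge with b = suc (suc m) ≥ 2: distinct nodes v, distinct paths (indices) f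
Bridge : ∀ {n} → PathSystem n → (m : ℕ) → Set
Bridge {n} S m =
  Σ (Fin (suc (suc m)) → Fin n) λ v →
  Σ (Fin (suc (suc m)) → Fin (numPaths S)) λ f →
    Injective _≡_ _≡_ v × Injective _≡_ _≡_ f ×
    ((i : Fin (suc m)) → Precedes (path S (f (inject₁ i))) (v (inject₁ i)) (v (fsuc i))) ×
    Precedes (path S (f (fromℕ (suc m)))) (v fzero) (v (fromℕ (suc m)))

BridgeFree : ∀ {n} → PathSystem n → Set
BridgeFree S = ∀ m → ¬ Bridge S m

{-# OPTIONS --safe #-}

-- At every node choose disjoint triples of paths any two of which meet only there; since a path
-- can meet at most two of its companions a second time, this loses O(1) incidences per node,
-- and it remains to bound the number N of triples by O(p² / 2^(c log* p)).  Turn the triples into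
-- edge-disjoint triangles of a tripartite graph on three copies of the set of paths.  A triangle
-- that does not come from a triple must have its three nodes in cyclic order, and 4- and 5-bridges
-- show that each path lies in only O(p) of these, so the graph has O(p²) triangles.
-- The bound on N is then Fox's form of the triangle removal lemma.  If A, B, C are parts of a
-- vertex partition spanning few triangles, then one of the three pairs is shattered: an eighth of
-- it is covered by boundedly many almost empty rectangles.  Refining the partition along these
-- rectangles increases a potential of size O(K N), K = log(p² / N), by Ω(N).  So O(K) refinements,
-- each of which costs a bounded number of exponentials, are impossible once p exceeds a tower of
-- height O(K).
module Submission where

open import Defs
open import Data.Bool.Base using (Bool; true; false; _∧_; _∨_; not; if_then_else_; T)
open import Data.Bool.Properties using (∧-zeroʳ; ∧-identityʳ; ∧-inverseʳ; ∧-comm; ∨-zeroʳ; T-≡)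
open import Data.Empty using (⊥; ⊥-elim)
open import Data.Fin.Base using (Fin; toℕ) renaming (zero to fzero; suc to fsuc)
open import Data.Fin.Properties using (toℕ-injective; any?) renaming (_≟_ to _≟ᶠ_)
open import Data.List.Base using (List; []; _∷_; _++_; length; map; concatMap; upTo; lookup; filter; allFin; cartesianProduct)
open import Data.List.Properties using (length-++; length-map; length-upTo; length-filter; length-tabulate; ∷-injective; tabulate-lookup; map-tabulate)
open import Data.List.Membership.DecPropositional using () renaming (_∈?_ to member?)
open import Data.List.Membership.Propositional using (_∈_)
open import Data.List.Membership.Propositional.Properties using (∈-++⁺ˡ; ∈-++⁺ʳ; ∈-++⁻; ∈-map⁺; ∈-map⁻; ∈-upTo⁺; ∈-concatMap⁺; ∈-lookup; ∈-filter⁻; ∈-allFin; ∈-cartesianProduct⁺)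
open import Data.List.Relation.Binary.Disjoint.Propositional using (Disjoint)
open import Data.List.Relation.Unary.All using ([]; _∷_)
import Data.List.Relation.Unary.All as All
open import Data.List.Relation.Unary.AllPairs using ([]; _∷_)
open import Data.List.Relation.Unary.Any using (here; there; index)
import Data.List.Relation.Unary.Any as Any
open import Data.List.Relation.Unary.Any.Properties using (lookup-index)
open import Data.List.Relation.Unary.Unique.Propositional using (Unique)
open import Data.List.Relation.Unary.Unique.Propositional.Properties using (filter⁺; allFin⁺; ++⁺; cartesianProduct⁺; map⁺; Unique[x∷xs]⇒x∉xs)
open import Data.Maybe.Base using (Maybe; just; nothing; is-just)
open import Data.Nat.Base
open import Data.Nat.DivMod using (m/n*n≤m; m≡m%n+[m/n]*n; m%n<n; m≥n⇒m/n>0)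
open import Data.Nat.Induction using (<-rec)
open import Data.Nat.ListAction using (sum)
open import Data.Nat.Logarithm using (⌊log₂_⌋; ⌊log₂⌊n/2⌋⌋≡⌊log₂n⌋∸1)
open import Data.Nat.Properties
open import Data.Nat.Tactic.RingSolver using (solve-∀)
open import Data.Product using (Σ; ∃; _×_; _,_; proj₁; proj₂)
open import Data.Product.Properties using (≡-dec)
open import Data.Sum using (_⊎_; inj₁; inj₂)
open import Function.Base using (_∘_; id; case_of_)
open import Function.Bundles using (Equivalence)
open import Relation.Binary.Definitions using (DecidableEquality; Decidable; tri<; tri≈; tri>)
open import Relation.Binary.PropositionalEquality
open import Relation.Nullary using (¬_; yes; no; Dec; does)
open import Relation.Nullary.Decidable using (_×-dec_; ¬?)
import Relation.Unary as U

-- Finite sums and counting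

-- The usual energy increment would need a number of refinements polynomial in p² / N and would save
-- only a power of log* p. To get by with O(K) refinements the potential imitates the entropy d log
-- d of the edge density d. It is replaced by the sum of the hinge functions max(0, d - 2^(j - K))
-- over the dyadic levels j ≤ K. Each hinge is at most d, so the potential is at most (K + 1) times
-- the number of edges. Subtraction and maxima are avoided in ℕ: every level carries a region `W j`,
-- a union of pairs of cells, as a witness for its hinge, and the two halves `Φ⁺` and `Φ⁻` are kept
-- apart. Inequalities between differences are therefore stated with all terms moved to the positive
-- side. The triangle bound is used vertex by vertex: a middle vertex b lies in few triangles, so
-- its in-neighbours and out-neighbours span few edges. Joining several such neighbourhoods produces
-- large almost empty rectangles. This is why the bridges are used to bound the triangles through
-- one path and not only their total.

-- Derives l ≤ r from L ≤ R when r - l = (R - L) + slack; the equation is a semiring identity.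
linear-≤ : ∀ {l r L R} slack → L ≤ R → l + R + slack ≡ r + L → l ≤ r
linear-≤ {l} {r} {L} {R} slack L≤R eq = +-cancelʳ-≤ R l r (begin
  l + R          ≤⟨ m≤m+n (l + R) slack ⟩
  l + R + slack  ≡⟨ eq ⟩
  r + L          ≤⟨ +-monoʳ-≤ r L≤R ⟩
  r + R          ∎)
  where open ≤-Reasoning

∑ : ∀ {A : Set} → List A → (A → ℕ) → ℕ
∑ []       f = 0
∑ (x ∷ xs) f = f x + ∑ xs f

∑-mono∈ : ∀ {A : Set} (xs : List A) {f g : A → ℕ} → (∀ x → x ∈ xs → f x ≤ g x) → ∑ xs f ≤ ∑ xs g
∑-mono∈ []       h = z≤n
∑-mono∈ (x ∷ xs) h = +-mono-≤ (h x (here refl)) (∑-mono∈ xs (λ y y∈ → h y (there y∈)))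

∑-mono : ∀ {A : Set} (xs : List A) {f g : A → ℕ} → (∀ x → f x ≤ g x) → ∑ xs f ≤ ∑ xs g
∑-mono xs h = ∑-mono∈ xs (λ x _ → h x)

∑-cong : ∀ {A : Set} (xs : List A) {f g : A → ℕ} → (∀ x → f x ≡ g x) → ∑ xs f ≡ ∑ xs g
∑-cong []       h = refl
∑-cong (x ∷ xs) h = cong₂ _+_ (h x) (∑-cong xs h)

∑-+ : ∀ {A : Set} (xs : List A) (f g : A → ℕ) → ∑ xs (λ x → f x + g x) ≡ ∑ xs f + ∑ xs g
∑-+ []       f g = refl
∑-+ (x ∷ xs) f g = trans (cong (f x + g x +_) (∑-+ xs f g)) (lem (f x) (g x) (∑ xs f) (∑ xs g))
  where
  lem : ∀ a b c d → a + b + (c + d) ≡ a + c + (b + d)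
  lem = solve-∀

∑-* : ∀ {A : Set} (xs : List A) c (f : A → ℕ) → ∑ xs (λ x → c * f x) ≡ c * ∑ xs f
∑-* []       c f = sym (*-zeroʳ c)
∑-* (x ∷ xs) c f = trans (cong (c * f x +_) (∑-* xs c f)) (sym (*-distribˡ-+ c (f x) (∑ xs f)))

∑-const : ∀ {A : Set} (xs : List A) c → ∑ xs (λ _ → c) ≡ length xs * c
∑-const []       c = refl
∑-const (x ∷ xs) c = cong (c +_) (∑-const xs c)

∑-zero : ∀ {A : Set} (xs : List A) → ∑ xs (λ _ → 0) ≡ 0
∑-zero xs = trans (∑-const xs 0) (*-zeroʳ (length xs))

∑-swap : ∀ {A B : Set} (xs : List A) (ys : List B) (f : A → B → ℕ) →
         ∑ xs (λ x → ∑ ys (f x)) ≡ ∑ ys (λ y → ∑ xs (λ x → f x y))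
∑-swap []       ys f = sym (∑-zero ys)
∑-swap (x ∷ xs) ys f = trans (cong (∑ ys (f x) +_) (∑-swap xs ys f))
                             (sym (∑-+ ys (f x) (λ y → ∑ xs (λ z → f z y))))

∑-++ : ∀ {A : Set} (xs ys : List A) (f : A → ℕ) → ∑ (xs ++ ys) f ≡ ∑ xs f + ∑ ys f
∑-++ []       ys f = refl
∑-++ (x ∷ xs) ys f = trans (cong (f x +_) (∑-++ xs ys f)) (sym (+-assoc (f x) _ _))

∑-map : ∀ {A B : Set} (xs : List A) (g : A → B) (f : B → ℕ) → ∑ (map g xs) f ≡ ∑ xs (f ∘ g)
∑-map []       g f = refl
∑-map (x ∷ xs) g f = cong (f (g x) +_) (∑-map xs g f)

term≤∑ : ∀ {A : Set} {xs : List A} {x} (f : A → ℕ) → x ∈ xs → f x ≤ ∑ xs f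
term≤∑ f (here refl) = m≤m+n _ _
term≤∑ f (there x∈)  = ≤-trans (term≤∑ f x∈) (m≤n+m _ _)

length-concatMap : ∀ {A B : Set} (xs : List A) (f : A → List B) → length (concatMap f xs) ≡ ∑ xs (length ∘ f)
length-concatMap []       f = refl
length-concatMap (x ∷ xs) f = trans (length-++ (f x)) (cong (length (f x) +_) (length-concatMap xs f))

search : ∀ {A : Set} (xs : List A) (P : A → Bool) → (∃ λ x → P x ≡ true) ⊎ (∀ x → x ∈ xs → P x ≡ false)
search []       P = inj₂ λ _ ()
search (x ∷ xs) P with P x in eq
... | true = inj₁ (x , eq)
... | false with search xs P
...   | inj₁ w = inj₁ w
...   | inj₂ h = inj₂ λ { y (here refl) → eq ; y (there y∈) → h y y∈ }

𝟙 : Bool → ℕ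
𝟙 true  = 1
𝟙 false = 0

𝟙-mono : ∀ {b c} → (b ≡ true → c ≡ true) → 𝟙 b ≤ 𝟙 c
𝟙-mono {false}         h = z≤n
𝟙-mono {true}  {true}  h = s≤s z≤n
𝟙-mono {true}  {false} h = case h refl of λ ()

𝟙≤1 : ∀ b → 𝟙 b ≤ 1
𝟙≤1 true  = ≤-refl
𝟙≤1 false = z≤n

𝟙-∧ : ∀ b c → 𝟙 (b ∧ c) ≡ 𝟙 b * 𝟙 c
𝟙-∧ true  c = sym (+-identityʳ (𝟙 c))
𝟙-∧ false c = refl

𝟙-split : ∀ b c → 𝟙 (b ∧ c) + 𝟙 (b ∧ not c) ≡ 𝟙 b
𝟙-split true  true  = refl
𝟙-split true  false = refl
𝟙-split false c     = refl

∧-true : ∀ {b c} → b ∧ c ≡ true → b ≡ true × c ≡ true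
∧-true {true} {true} _ = refl , refl

∧-intro : ∀ {b c} → b ≡ true → c ≡ true → b ∧ c ≡ true
∧-intro refl refl = refl

∨-true : ∀ {b c} → b ∨ c ≡ true → b ≡ true ⊎ c ≡ true
∨-true {true}  _ = inj₁ refl
∨-true {false} p = inj₂ p

∨-introˡ : ∀ {b c} → b ≡ true → b ∨ c ≡ true
∨-introˡ refl = refl

∨-introʳ : ∀ b {c} → c ≡ true → b ∨ c ≡ true
∨-introʳ b refl = ∨-zeroʳ b

not-true : ∀ {b} → not b ≡ true → b ≡ false
not-true {false} _ = refl

true≢false : ∀ {b} → b ≡ true → b ≡ false → ⊥
true≢false refl ()

≤ᵇ-true : ∀ {m n} → (m ≤ᵇ n) ≡ true → m ≤ n
≤ᵇ-true {m} {n} eq = ≤ᵇ⇒≤ m n (subst T (sym eq) _)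

≤ᵇ-false : ∀ {m n} → (m ≤ᵇ n) ≡ false → n < m
≤ᵇ-false {m} {n} eq = ≰⇒> λ m≤n → subst T eq (≤⇒≤ᵇ m≤n)

true-≤ᵇ : ∀ {m n} → m ≤ n → (m ≤ᵇ n) ≡ true
true-≤ᵇ {m} {n} m≤n with m ≤ᵇ n in eq
... | true  = refl
... | false = ⊥-elim (<⇒≱ (≤ᵇ-false {m} {n} eq) m≤n)

-- Sizes of vertex sets and of relations

module Counting {V : Set} (vs : List V) where

  Subset Relation₂ : Set
  Subset = V → Bool
  Relation₂ = V → V → Bool

  _⊆_ : Subset → Subset → Set
  X ⊆ Y = ∀ x → X x ≡ true → Y x ≡ true

  _∩_ _∖_ _∪_ : Subset → Subset → Subset
  (X ∩ Y) x = X x ∧ Y x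
  (X ∖ Y) x = X x ∧ not (Y x)
  (X ∪ Y) x = X x ∨ Y x

  _⊗_ : Subset → Subset → Relation₂
  (X ⊗ Y) x y = X x ∧ Y y

  count : Subset → ℕ
  count X = ∑ vs (λ x → 𝟙 (X x))

  area : Relation₂ → ℕ
  area W = ∑ vs (λ x → ∑ vs (λ y → 𝟙 (W x y)))

  count-mono : ∀ {X Y} → X ⊆ Y → count X ≤ count Y
  count-mono h = ∑-mono vs (λ x → 𝟙-mono (h x))

  count-split : ∀ X Y → count (X ∩ Y) + count (X ∖ Y) ≡ count X
  count-split X Y = trans (sym (∑-+ vs _ _)) (∑-cong vs (λ x → 𝟙-split (X x) (Y x)))

  count-∖ : ∀ X {Y} → Y ⊆ X → count Y + count (X ∖ Y) ≡ count X
  count-∖ X {Y} h = trans (cong (_+ count (X ∖ Y)) (∑-cong vs λ x → cong 𝟙 (lem x))) (count-split X Y)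
    where
    lem : ∀ x → Y x ≡ X x ∧ Y x
    lem x with Y x in eq
    ... | false = sym (∧-zeroʳ (X x))
    ... | true rewrite h x eq = refl

  count≤ : ∀ X → count X ≤ length vs
  count≤ X = ≤-trans (∑-mono vs (λ x → 𝟙≤1 (X x))) (≤-reflexive (trans (∑-const vs 1) (*-identityʳ _)))

  area-mono : ∀ {W W′} → (∀ x y → W x y ≡ true → W′ x y ≡ true) → area W ≤ area W′
  area-mono h = ∑-mono vs λ x → ∑-mono vs λ y → 𝟙-mono (h x y)

  area-cong : ∀ {W W′} → (∀ x y → W x y ≡ W′ x y) → area W ≡ area W′
  area-cong h = ∑-cong vs λ x → ∑-cong vs λ y → cong 𝟙 (h x y)

  area-none : ∀ {W} → (∀ x y → W x y ≡ false) → area W ≡ 0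
  area-none h = trans (area-cong h) (trans (∑-cong vs λ _ → ∑-zero vs) (∑-zero vs))

  area-+ : ∀ {W W₁ W₂} → (∀ x y → 𝟙 (W x y) ≡ 𝟙 (W₁ x y) + 𝟙 (W₂ x y)) → area W ≡ area W₁ + area W₂
  area-+ {W} {W₁} {W₂} h =
    trans (∑-cong vs λ x → trans (∑-cong vs (h x)) (∑-+ vs _ _)) (∑-+ vs _ _)

  area-≤+ : ∀ {W W₁ W₂} → (∀ x y → W x y ≡ true → W₁ x y ≡ true ⊎ W₂ x y ≡ true) → area W ≤ area W₁ + area W₂
  area-≤+ {W} {W₁} {W₂} h = ≤-trans
    (∑-mono vs λ x → ≤-trans (∑-mono vs λ y → lem (h x y)) (≤-reflexive (∑-+ vs _ _)))
    (≤-reflexive (∑-+ vs _ _))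
    where
    lem : ∀ {b c d} → (b ≡ true → c ≡ true ⊎ d ≡ true) → 𝟙 b ≤ 𝟙 c + 𝟙 d
    lem {false} _ = z≤n
    lem {true} {c} {d} k with k refl
    ... | inj₁ refl = s≤s z≤n
    ... | inj₂ refl = m≤n+m 1 (𝟙 c)

  area-⊗ : ∀ X Y → area (X ⊗ Y) ≡ count X * count Y
  area-⊗ X Y = begin
    area (X ⊗ Y)                                  ≡⟨ ∑-cong vs (λ x → trans (∑-cong vs (λ y → 𝟙-∧ (X x) (Y y))) (∑-* vs (𝟙 (X x)) _)) ⟩
    ∑ vs (λ x → 𝟙 (X x) * count Y)                ≡⟨ ∑-cong vs (λ x → *-comm (𝟙 (X x)) (count Y)) ⟩
    ∑ vs (λ x → count Y * 𝟙 (X x))                ≡⟨ ∑-* vs (count Y) _ ⟩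
    count Y * count X                             ≡⟨ *-comm (count Y) (count X) ⟩
    count X * count Y                             ∎
    where open ≡-Reasoning

  area≤ : ∀ W → area W ≤ length vs * length vs
  area≤ W = ≤-trans (∑-mono vs λ x → count≤ (W x)) (≤-reflexive (∑-const vs (length vs)))

-- Shattering one of three pairs

module Graph {V : Set} (vs : List V) (adj : V → V → Bool) where
  open Counting vs

  edges : Relation₂ → ℕ
  edges W = area (λ x y → adj x y ∧ W x y)

  deg indeg : V → Subset → ℕ
  deg   a Y = count (λ y → adj a y ∧ Y y)
  indeg b X = count (λ x → adj x b ∧ X x)

  edges≤area : ∀ W → edges W ≤ area W
  edges≤area W = area-mono λ x y → proj₂ ∘ ∧-true

  edges-mono : ∀ {W W′} → (∀ x y → W x y ≡ true → W′ x y ≡ true) → edges W ≤ edges W′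
  edges-mono h = area-mono λ x y p → let q , r = ∧-true p in ∧-intro q (h x y r)

  edges-none : ∀ {W} → (∀ x y → W x y ≡ false) → edges W ≡ 0
  edges-none h = area-none λ x y → trans (cong (adj x y ∧_) (h x y)) (∧-zeroʳ (adj x y))

  edges-rows : ∀ X Y → edges (X ⊗ Y) ≡ ∑ vs (λ x → 𝟙 (X x) * deg x Y)
  edges-rows X Y = ∑-cong vs λ x → trans (∑-cong vs (λ y → lem (adj x y) (X x) (Y y))) (∑-* vs (𝟙 (X x)) _)
    where
    lem : ∀ a b c → 𝟙 (a ∧ (b ∧ c)) ≡ 𝟙 b * 𝟙 (a ∧ c)
    lem true  true  c = sym (+-identityʳ (𝟙 c))
    lem true  false c = refl
    lem false b     c = sym (*-zeroʳ (𝟙 b))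

  edges-columns : ∀ X Y → edges (X ⊗ Y) ≡ ∑ vs (λ y → 𝟙 (Y y) * indeg y X)
  edges-columns X Y = trans (∑-swap vs vs _)
    (∑-cong vs λ y → trans (∑-cong vs (λ x → lem (adj x y) (X x) (Y y))) (∑-* vs (𝟙 (Y y)) _))
    where
    lem : ∀ a b c → 𝟙 (a ∧ (b ∧ c)) ≡ 𝟙 c * 𝟙 (a ∧ b)
    lem true  true  true  = refl
    lem true  true  false = refl
    lem true  false c     = sym (*-zeroʳ (𝟙 c))
    lem false b     c     = sym (*-zeroʳ (𝟙 c))

  sparse-rows : ∀ X Y c d → (∀ x → X x ≡ true → c * deg x Y ≤ d) → c * edges (X ⊗ Y) ≤ count X * d
  sparse-rows X Y c d h = begin
    c * edges (X ⊗ Y)                         ≡⟨ cong (c *_) (edges-rows X Y) ⟩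
    c * ∑ vs (λ x → 𝟙 (X x) * deg x Y)        ≡⟨ ∑-* vs c _ ⟨
    ∑ vs (λ x → c * (𝟙 (X x) * deg x Y))      ≤⟨ ∑-mono vs (λ x → lem x (X x) refl) ⟩
    ∑ vs (λ x → d * 𝟙 (X x))                  ≡⟨ ∑-* vs d _ ⟩
    d * count X                               ≡⟨ *-comm d _ ⟩
    count X * d                               ∎
    where
    open ≤-Reasoning
    lem : ∀ x b → X x ≡ b → c * (𝟙 b * deg x Y) ≤ d * 𝟙 b
    lem x false eq = ≤-trans (≤-reflexive (*-zeroʳ c)) z≤n
    lem x true  eq = subst₂ _≤_ (cong (c *_) (sym (+-identityʳ _))) (sym (*-identityʳ d)) (h x eq)

  Agree : List Subset → V → V → Set
  Agree bs x x′ = ∀ b → b ∈ bs → b x ≡ b x′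

  Measurable : List Subset → Relation₂ → Set
  Measurable bs W = ∀ {x x′ y y′} → Agree bs x x′ → Agree bs y y′ → W x y ≡ W x′ y′

  -- The instances built below are disjoint unions of at most `g` rectangles, each contributing its
  -- two sides to `bits`. Only measurability is recorded: once the partition is refined by `bits`,
  -- the region becomes a union of pairs of cells.
  record Shattered (L g : ℕ) (X Y : Subset) : Set where
    field
      region     : Relation₂
      bits       : List Subset
      measurable : Measurable bits region
      few-bits   : length bits ≤ 2 * g
      inside     : ∀ x y → region x y ≡ true → X x ≡ true × Y y ≡ true
      large      : count X * count Y ≤ 8 * area region
      sparse     : L * edges region ≤ area region

  -- From few triangles to a shattered pair

  module Trichotomy (s L : ℕ) (L>0 : 0 < L)
    (few-triangles : ∀ b → edges (λ x y → adj x b ∧ adj b y) ≤ s) where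

    -- The bound on edges is absolute because it is a sum of triangle counts. It becomes a density
    -- bound only when the sides are known to be large, which is where the threshold `θ` enters.
    record Piece (X Y : Subset) (g e : ℕ) : Set where
      field
        X′ Y′ : Subset
        X′⊆   : X′ ⊆ X
        Y′⊆   : Y′ ⊆ Y
        X-large : count X ≤ g * count X′
        Y-large : count Y ≤ 2 * count Y′
        few     : edges (X′ ⊗ Y′) ≤ e

    record SparsePiece (X Y : Subset) (g : ℕ) : Set where
      field
        X′ Y′ : Subset
        X′⊆   : X′ ⊆ X
        Y′⊆   : Y′ ⊆ Y
        X-large : count X ≤ g * count X′
        Y-large : count Y ≤ 2 * count Y′
        few     : L * edges (X′ ⊗ Y′) ≤ count X′ * count Y′

    instance
      L≢0 : NonZero L
      L≢0 = >-nonZero L>0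

    -- Vertices b of `B` are chosen one after another. By `few-triangles` each has at most `s` edges
    -- from its in-neighbours to its out-neighbours. If common in-neighbours remain plentiful while
    -- the out-neighbourhoods cover half of `C`, the two sets form a `Piece`. The choice can only
    -- get stuck at a sparse rectangle between `B` and `C`.
    module Inner (A B C : Subset) (A>0 : 0 < count A) (B>0 : 0 < count B)
      (min-degree : ∀ a → A a ≡ true → count B ≤ L * deg a B) where

      Result : Set
      Result = Piece A C ((2 * L) ^ L) (L * s) ⊎ SparsePiece B C (2 * L)

      finish : ∀ r A₁ C₁ → r ≤ L → A₁ ⊆ A → C₁ ⊆ C →
               edges (A₁ ⊗ (C ∖ C₁)) ≤ r * s → count A ≤ (2 * L) ^ r * count A₁ →
               2 * count C₁ ≤ count C → Result
      finish r A₁ C₁ r≤L A₁⊆ C₁⊆ few A-large C₁-small = inj₁ record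
        { X′ = A₁ ; Y′ = C ∖ C₁ ; X′⊆ = A₁⊆ ; Y′⊆ = λ x → proj₁ ∘ ∧-true
        ; X-large = ≤-trans A-large (*-monoˡ-≤ (count A₁) (^-monoʳ-≤ (2 * L) ⦃ m*n≢0 2 L ⦄ r≤L))
        ; Y-large = linear-≤ 0 C₁-small
            (trans (cong (λ k → k + k + 0) (sym C-split)) (lem (count C₁) (count (C ∖ C₁))))
        ; few = ≤-trans few (*-monoˡ-≤ s r≤L) }
        where
        C-split : count C₁ + count (C ∖ C₁) ≡ count C
        C-split = count-∖ C C₁⊆
        lem : ∀ c d → c + d + (c + d) + 0 ≡ 2 * d + 2 * c
        lem = solve-∀

      -- After r rounds every vertex of A₁ is adjacent to all r chosen vertices b,
      -- and C₁ is the part of C not adjacent to any of them.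
      rounds : ∀ f r A₁ C₁ → r + f ≡ L → A₁ ⊆ A → C₁ ⊆ C →
               edges (A₁ ⊗ (C ∖ C₁)) ≤ r * s → count A ≤ (2 * L) ^ r * count A₁ →
               2 * L * count C₁ + r * count C ≤ 2 * L * count C → Result
      -- At r = L the invariant `C-cover` says that at most half of `C` is uncovered.
      rounds zero r A₁ C₁ r≡L A₁⊆ C₁⊆ few A-large C-cover =
        finish r A₁ C₁ (≤-reflexive r≡L′) A₁⊆ C₁⊆ few A-large
          (*-cancelˡ-≤ L (linear-≤ 0 (subst (λ k → 2 * L * count C₁ + k * count C ≤ 2 * L * count C) r≡L′ C-cover)
             (lem L (count C₁) (count C))))
        where
        r≡L′ = trans (sym (+-identityʳ r)) r≡L
        lem : ∀ l c d → l * (2 * c) + 2 * l * d + 0 ≡ l * d + (2 * l * c + l * d)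
        lem = solve-∀
      rounds (suc f) r A₁ C₁ r+f≡L A₁⊆ C₁⊆ few A-large C-cover
        with 2 * count C₁ ≤? count C
      ... | yes small = finish r A₁ C₁ (≤-trans (m≤m+n r (suc f)) (≤-reflexive r+f≡L)) A₁⊆ C₁⊆ few A-large small
      -- A vertex b of `B` is useful if it sees at least a fraction 1/L of `C₁`. The search looks
      -- for a vertex a with fewer than |B| / (2L) useful neighbours. Since a has at least |B| / L
      -- neighbours in `B`, its other neighbours number at least |B| / (2L) and form a sparse
      -- rectangle with `C₁`.
      ... | no ¬small with search vs (λ a → A₁ a ∧ (suc (2 * L * deg a useful) ≤ᵇ count B))
        where
        useful : Subset
        useful b = B b ∧ (count C₁ ≤ᵇ L * deg b C₁)
      ...   | inj₁ (a , bad) = inj₂ record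
        { X′ = B′ ; Y′ = C₁ ; X′⊆ = λ b p → proj₁ (∧-true (proj₂ (∧-true {adj a b} p))) ; Y′⊆ = C₁⊆
        ; X-large = linear-≤ 0 (+-mono-≤ (*-monoʳ-≤ 2 (min-degree a (A₁⊆ a a∈)))
                                (≤-trans (n≤1+n _) (≤ᵇ-true bad′)))
            (trans (cong (λ k → count B + (2 * (L * k) + count B) + 0) (sym deg-split))
                   (lem (count B) L (deg a useful) (count B′)))
        ; Y-large = <⇒≤ (≰⇒> ¬small)
        ; few = sparse-rows B′ C₁ L (count C₁) (λ b p → <⇒≤ (≤ᵇ-false (not-true (proj₂ (∧-true (proj₂ (∧-true {adj a b} p))))))) }
        where
        useful : Subset
        useful b = B b ∧ (count C₁ ≤ᵇ L * deg b C₁)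
        B′ : Subset
        B′ b = adj a b ∧ (B b ∧ not (count C₁ ≤ᵇ L * deg b C₁))
        a∈ : A₁ a ≡ true
        a∈ = proj₁ (∧-true bad)
        bad′ : (suc (2 * L * deg a useful) ≤ᵇ count B) ≡ true
        bad′ = proj₂ (∧-true {A₁ a} bad)
        deg-split : deg a useful + count B′ ≡ deg a B
        deg-split = trans (sym (∑-+ vs _ _)) (∑-cong vs λ b → pt (adj a b) (B b) (count C₁ ≤ᵇ L * deg b C₁))
          where
          pt : ∀ p q r → 𝟙 (p ∧ (q ∧ r)) + 𝟙 (p ∧ (q ∧ not r)) ≡ 𝟙 (p ∧ q)
          pt true  q r = 𝟙-split q r
          pt false q r = refl
        lem : ∀ b l d e → b + (2 * (l * (d + e)) + b) + 0 ≡ 2 * l * e + (2 * b + 2 * l * d)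
        lem = solve-∀
      -- A useful b with at least |A₁| / (2L) in-neighbours in `A₁` can be added: it costs a factor
      -- 2L in `A₁` and removes at least |C₁| / L, hence at least |C| / (2L), from the uncovered
      -- part.
      ...   | inj₂ all-good with search vs (λ b → useful b ∧ (count A₁ ≤ᵇ 2 * L * indeg b A₁))
        where
        useful : Subset
        useful b = B b ∧ (count C₁ ≤ᵇ L * deg b C₁)
      ...     | inj₁ (b , good) = rounds f (suc r) A₂ C₂ (trans (sym (+-suc r f)) r+f≡L)
                  (λ x p → A₁⊆ x (proj₂ (∧-true {adj x b} p))) (λ y p → C₁⊆ y (proj₁ (∧-true p)))
                  few₂ A-large₂ cover₂
        where
        A₂ C₂ : Subset
        A₂ x = adj x b ∧ A₁ x
        C₂ y = C₁ y ∧ not (adj b y)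
        b-useful : (count C₁ ≤ᵇ L * deg b C₁) ≡ true
        b-useful = proj₂ (∧-true {B b} (proj₁ (∧-true good)))
        few₂ : edges (A₂ ⊗ (C ∖ C₂)) ≤ suc r * s
        few₂ = ≤-trans (area-≤+ {W₁ = λ x y → adj x y ∧ (adj x b ∧ adj b y)} {W₂ = λ x y → adj x y ∧ (A₁ ⊗ (C ∖ C₁)) x y}
                         (λ x y → pt (adj x y) (adj x b) (A₁ x) (C y) (C₁ y) (adj b y)))
                       (+-mono-≤ (few-triangles b) few)
          where
          pt : ∀ xy xb a c c₁ by → xy ∧ ((xb ∧ a) ∧ (c ∧ not (c₁ ∧ not by))) ≡ true →
               xy ∧ (xb ∧ by) ≡ true ⊎ xy ∧ (a ∧ (c ∧ not c₁)) ≡ true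
          pt true true true true true  true  _ = inj₁ refl
          pt true true true true false by    _ = inj₂ refl
        A-large₂ : count A ≤ (2 * L) ^ suc r * count A₂
        A-large₂ = ≤-trans A-large (≤-trans (*-monoʳ-≤ ((2 * L) ^ r) (≤ᵇ-true (proj₂ (∧-true {B b ∧ _} good))))
          (≤-reflexive (lem ((2 * L) ^ r) (2 * L) (count A₂))))
          where
          lem : ∀ p q c → p * (q * c) ≡ q * p * c
          lem = solve-∀
        cover₂ : 2 * L * count C₂ + suc r * count C ≤ 2 * L * count C
        cover₂ = linear-≤ 0 (+-mono-≤ C-cover (+-mono-≤ (*-monoʳ-≤ 2 (≤ᵇ-true {count C₁} {L * deg b C₁} b-useful)) (<⇒≤ (≰⇒> ¬small))))
          (trans (cong (λ k → 2 * L * count C₂ + (count C + r * count C) + (2 * L * count C + (2 * (L * deg b C₁) + 2 * k)) + 0) (sym C₁-split))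
          (trans (lem L (count C₂) (count C) r (deg b C₁))
                 (cong (λ k → 2 * L * count C + (2 * L * k + r * count C + (2 * k + count C))) C₁-split)))
          where
          C₁-split : deg b C₁ + count C₂ ≡ count C₁
          C₁-split = trans (cong (_+ count C₂) (∑-cong vs λ y → cong 𝟙 (∧-comm (adj b y) (C₁ y)))) (count-split C₁ (adj b))
          lem : ∀ l c₂ c r d → 2 * l * c₂ + (c + r * c) + (2 * l * c + (2 * (l * d) + 2 * (d + c₂))) + 0
                 ≡ 2 * l * c + (2 * l * (d + c₂) + r * c + (2 * (d + c₂) + c))
          lem = solve-∀
      -- Edges from `A₁` to the useful vertices are counted twice: by rows there are at least |A₁|
      -- |B| / (2L). By columns there are fewer than |A₁| / (2L) per useful vertex, and there are at
      -- most |B| of these.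
      ...     | inj₂ none = ⊥-elim contradiction
        where
        useful : Subset
        useful b = B b ∧ (count C₁ ≤ᵇ L * deg b C₁)
        E : ℕ
        E = edges (A₁ ⊗ useful)
        A₁>0 : 0 < count A₁
        A₁>0 = n≢0⇒n>0 λ eq → <⇒≱ A>0 (≤-trans A-large (≤-reflexive (trans (cong ((2 * L) ^ r *_) eq) (*-zeroʳ ((2 * L) ^ r)))))
        many : count A₁ * count B ≤ 2 * L * E
        many = begin
          count A₁ * count B                          ≡⟨ *-comm (count A₁) _ ⟩
          count B * count A₁                          ≡⟨ ∑-* vs (count B) _ ⟨
          ∑ vs (λ a → count B * 𝟙 (A₁ a))             ≤⟨ ∑-mono∈ vs (λ a a∈ → pt a (A₁ a) refl (all-good a a∈)) ⟩
          ∑ vs (λ a → 2 * L * (𝟙 (A₁ a) * deg a useful)) ≡⟨ ∑-* vs (2 * L) _ ⟩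
          2 * L * ∑ vs (λ a → 𝟙 (A₁ a) * deg a useful) ≡⟨ cong (2 * L *_) (edges-rows A₁ useful) ⟨
          2 * L * E ∎
          where
          open ≤-Reasoning
          pt : ∀ a v → A₁ a ≡ v → A₁ a ∧ (suc (2 * L * deg a useful) ≤ᵇ count B) ≡ false →
               count B * 𝟙 v ≤ 2 * L * (𝟙 v * deg a useful)
          pt a false eq _ = ≤-trans (≤-reflexive (*-zeroʳ (count B))) z≤n
          pt a true eq h rewrite eq = subst₂ _≤_ (sym (*-identityʳ (count B))) (cong (2 * L *_) (sym (+-identityʳ (deg a useful))))
            (≤-pred (≤ᵇ-false h))
        few′ : 2 * L * E + count useful ≤ count useful * count A₁
        few′ = begin
          2 * L * E + count useful ≡⟨ cong (λ k → 2 * L * k + count useful) (edges-columns A₁ useful) ⟩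
          2 * L * ∑ vs (λ b → 𝟙 (useful b) * indeg b A₁) + count useful ≡⟨ cong (_+ count useful) (∑-* vs (2 * L) _) ⟨
          ∑ vs (λ b → 2 * L * (𝟙 (useful b) * indeg b A₁)) + count useful ≡⟨ ∑-+ vs _ _ ⟨
          ∑ vs (λ b → 2 * L * (𝟙 (useful b) * indeg b A₁) + 𝟙 (useful b)) ≤⟨ ∑-mono∈ vs (λ b b∈ → pt b (useful b) refl (none b b∈)) ⟩
          ∑ vs (λ b → count A₁ * 𝟙 (useful b)) ≡⟨ ∑-* vs (count A₁) _ ⟩
          count A₁ * count useful ≡⟨ *-comm (count A₁) _ ⟩
          count useful * count A₁ ∎
          where
          open ≤-Reasoning
          pt : ∀ b v → useful b ≡ v → useful b ∧ (count A₁ ≤ᵇ 2 * L * indeg b A₁) ≡ false →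
               2 * L * (𝟙 v * indeg b A₁) + 𝟙 v ≤ count A₁ * 𝟙 v
          pt b false eq _ = ≤-reflexive (trans (+-identityʳ _) (trans (*-zeroʳ (2 * L)) (sym (*-zeroʳ (count A₁)))))
          pt b true eq h rewrite eq = subst₂ _≤_
            (trans (sym (+-comm _ 1)) (cong (λ k → 2 * L * k + 1) (sym (+-identityʳ (indeg b A₁))))) (sym (*-identityʳ (count A₁)))
            (≤ᵇ-false h)
        contradiction : ⊥
        contradiction = <⇒≱ (*-mono-< A₁>0 B>0) (≤-trans many (≤-trans (m≤m+n _ (count useful)) (≤-trans few′ (≤-reflexive
           (cong (_* count A₁) none-useful)))))
          where
          none-useful : count useful ≡ 0
          none-useful = n≤0⇒n≡0 (linear-≤ 0 (+-mono-≤ (+-mono-≤ few′ many) (*-monoˡ-≤ (count A₁) (count-mono {useful} {B} (λ b → proj₁ ∘ ∧-true))))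
             (lem (count useful) (2 * L * E) (count A₁) (count B)))
            where
            lem : ∀ u e a b → u + (u * a + e + b * a) + 0 ≡ 0 + (e + u + a * b + u * a)
            lem = solve-∀

      result : Result
      result = rounds L 0 A C refl (λ _ p → p) (λ _ p → p)
        (≤-reflexive (edges-none λ x y → trans (cong (A x ∧_) (∧-inverseʳ (C y))) (∧-zeroʳ (A x))))
        (≤-reflexive (sym (+-identityʳ (count A)))) (≤-reflexive (+-identityʳ _))

    record Chunk (X Xc Y : Subset) (g : ℕ) : Set where
      field
        X′ Y′ : Subset
        X′⊆   : X′ ⊆ X
        fresh : ∀ x → X′ x ≡ true → Xc x ≡ false
        Y′⊆   : Y′ ⊆ Y
        X-large : count X ≤ g * count X′
        Y-large : count Y ≤ 2 * count Y′
        few     : L * edges (X′ ⊗ Y′) ≤ count X′ * count Y′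

    -- Every chunk brings at least |X| / g new elements of `X`, so `g` chunks suffice. The loop
    -- stops when a quarter of `X` is covered; as each chunk uses half of `Y`, this yields the
    -- factor 8 = 4 · 2 in `Shattered`. The type `Z` is an outcome that ends the loop early, which
    -- allows two loops to be nested.
    module Greedy (X Y : Subset) (g : ℕ) (g>0 : 0 < g) {Z : Set}
      (step : ∀ Xc → Xc ⊆ X → 4 * count Xc < count X → Z ⊎ Chunk X Xc Y g) where

      record Partial (r : ℕ) : Set where
        field
          covered    : Subset
          region     : Relation₂
          bits       : List Subset
          measurable : Measurable bits region
          few-bits   : length bits ≤ 2 * r
          inside     : ∀ x y → region x y ≡ true → covered x ≡ true × Y y ≡ true
          covered⊆   : covered ⊆ X
          progress   : r * count X ≤ g * count covered
          large      : count covered * count Y ≤ 2 * area region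
          sparse     : L * edges region ≤ area region

      done : ∀ {r} → r ≤ g → (P : Partial r) → count X ≤ 4 * count (Partial.covered P) → Shattered L g X Y
      done r≤g P X≤ = record
        { region = region ; bits = bits ; measurable = measurable
        ; few-bits = ≤-trans few-bits (*-monoʳ-≤ 2 r≤g)
        ; inside = λ x y p → let c , q = inside x y p in covered⊆ x c , q
        ; large = ≤-trans (*-monoˡ-≤ (count Y) X≤) (≤-trans (≤-reflexive (*-assoc 4 (count covered) (count Y)))
            (≤-trans (*-monoʳ-≤ 4 large) (≤-reflexive (sym (*-assoc 4 2 (area region))))))
        ; sparse = sparse }
        where open Partial P

      extend : ∀ {r} (P : Partial r) → Chunk X (Partial.covered P) Y g → Partial (suc r)
      extend {r} P D = record
        { covered = covered ∪ X′
        ; region = R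
        ; bits = X′ ∷ Y′ ∷ bits
        ; measurable = λ ax ay → cong₂ _∨_ (measurable (λ b b∈ → ax b (there (there b∈))) (λ b b∈ → ay b (there (there b∈))))
            (cong₂ _∧_ (ax X′ (here refl)) (ay Y′ (there (here refl))))
        ; few-bits = ≤-trans (s≤s (s≤s few-bits)) (≤-reflexive (sym (*-suc 2 r)))
        ; inside = inside′
        ; covered⊆ = λ x p → case ∨-true {covered x} p of λ { (inj₁ q) → covered⊆ x q ; (inj₂ q) → X′⊆ x q }
        ; progress = ≤-trans (+-mono-≤ X-large progress)
            (≤-reflexive (trans (+-comm (g * count X′) _) (trans (sym (*-distribˡ-+ g (count covered) (count X′))) (cong (g *_) (sym count-∪)))))
        ; large = subst₂ (λ u v → u * count Y ≤ 2 * v) (sym count-∪) (sym area-R)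
            (linear-≤ 0 (+-mono-≤ large (*-monoʳ-≤ (count X′) Y-large))
               (lem (count covered) (count X′) (count Y) (count Y′) (area region)))
        ; sparse = subst₂ (λ u v → L * u ≤ v) (sym edges-R) (sym area-R)
            (≤-trans (≤-reflexive (*-distribˡ-+ L _ _)) (+-mono-≤ sparse few)) }
        where
        open Partial P
        open Chunk D
        R : Relation₂
        R x y = region x y ∨ (X′ x ∧ Y′ y)
        inside′ : ∀ x y → R x y ≡ true → (covered ∪ X′) x ≡ true × Y y ≡ true
        inside′ x y p with ∨-true {region x y} p
        ... | inj₁ q = let c , d = inside x y q in ∨-introˡ c , d
        ... | inj₂ q = ∨-introʳ (covered x) (proj₁ (∧-true q)) , Y′⊆ y (proj₂ (∧-true {X′ x} q))
        𝟙-disjoint : ∀ {b c} → (c ≡ true → b ≡ false) → 𝟙 (b ∨ c) ≡ 𝟙 b + 𝟙 c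
        𝟙-disjoint {true}  {true}  h = case h refl of λ ()
        𝟙-disjoint {true}  {false} h = refl
        𝟙-disjoint {false} {c}     h = refl
        count-∪ : count (covered ∪ X′) ≡ count covered + count X′
        count-∪ = trans (∑-cong vs λ x → 𝟙-disjoint (fresh x)) (∑-+ vs _ _)
        apart : ∀ x y → X′ x ∧ Y′ y ≡ true → region x y ≡ false
        apart x y p with region x y in eq
        ... | false = refl
        ... | true  = ⊥-elim (true≢false (proj₁ (inside x y eq)) (fresh x (proj₁ (∧-true p))))
        area-R : area R ≡ area region + count X′ * count Y′
        area-R = trans (area-+ λ x y → 𝟙-disjoint (apart x y)) (cong (area region +_) (area-⊗ X′ Y′))
        edges-R : edges R ≡ edges region + edges (X′ ⊗ Y′)
        edges-R = area-+ λ x y → pt (adj x y) (apart x y)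
          where
          pt : ∀ a {b c} → (c ≡ true → b ≡ false) → 𝟙 (a ∧ (b ∨ c)) ≡ 𝟙 (a ∧ b) + 𝟙 (a ∧ c)
          pt true  h = 𝟙-disjoint h
          pt false h = refl
        lem : ∀ c x y y′ a → (c + x) * y + (2 * a + x * (2 * y′)) + 0 ≡ 2 * (a + x * y′) + (c * y + x * y)
        lem = solve-∀

      run : ∀ f r → r + f ≡ g → Partial r → Z ⊎ Shattered L g X Y
      run zero r r≡g P = inj₂ (done (≤-reflexive r≡g′) P
          (≤-trans (*-cancelˡ-≤ g ⦃ >-nonZero g>0 ⦄ (subst (λ k → k * count X ≤ g * count covered) r≡g′ progress)) (m≤n*m _ 4)))
        where
        open Partial P
        r≡g′ = trans (sym (+-identityʳ r)) r≡g
      run (suc f) r r+f≡g P with count X ≤? 4 * count (Partial.covered P)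
      ... | yes X≤ = inj₂ (done (≤-trans (m≤m+n r (suc f)) (≤-reflexive r+f≡g)) P X≤)
      ... | no X≰ with step (Partial.covered P) (Partial.covered⊆ P) (≰⇒> X≰)
      ...   | inj₁ z = inj₁ z
      ...   | inj₂ D = run f (suc r) (trans (sym (+-suc r f)) r+f≡g) (extend P D)

      result : Z ⊎ Shattered L g X Y
      result = run g 0 refl record
        { covered = λ _ → false ; region = λ _ _ → false ; bits = []
        ; measurable = λ _ _ → refl ; few-bits = z≤n ; inside = λ _ _ () ; covered⊆ = λ _ ()
        ; progress = z≤n
        ; large = ≤-trans (≤-reflexive (cong (_* count Y) (∑-zero vs))) z≤n
        ; sparse = ≤-trans (≤-reflexive (trans (cong (L *_) (edges-none λ _ _ → refl)) (*-zeroʳ L))) z≤n }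

    -- The factor (2L)^L is the loss of `A` over the rounds of `Inner`, and 4 is the loss from `A`
    -- to the part of it on which `Inner` is run.
    pieces : ℕ
    pieces = 4 * (2 * L) ^ L

    pieces>0 : 0 < pieces
    pieces>0 = *-mono-< {0} {4} (s≤s z≤n) (m^n>0 (2 * L) ⦃ m*n≢0 2 L ⦄ L)

    4L≤pieces : 2 * (2 * L) ≤ pieces
    4L≤pieces = *-mono-≤ {2} {4} (s≤s (s≤s z≤n)) (≤-trans (≤-reflexive (sym (^-identityʳ (2 * L)))) (^-monoʳ-≤ (2 * L) ⦃ m*n≢0 2 L ⦄ L>0))

    -- Two nested greedy loops: the outer one collects chunks for the pair (B, C), the inner one for
    -- (A, C). Each call of `Inner` produces a chunk for one of the two. The inner loop ends with a
    -- chunk for the outer one or with (A, C) shattered. `Inner` needs a minimum degree from `A`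
    -- into the uncovered part of `B`; if half of `A` fails this, one rectangle already shatters (A,
    -- B).
    trichotomy : ∀ θ A B C → 0 < θ → 8 * (2 * L) ^ L * (L * (L * s)) ≤ θ * θ →
                 θ ≤ count A → θ ≤ count B → θ ≤ count C →
                 Shattered L pieces A B ⊎ Shattered L pieces B C ⊎ Shattered L pieces A C
    trichotomy θ A B C θ>0 θ-large θ≤A θ≤B θ≤C = case Outer.result of λ
      { (inj₁ (inj₁ AB)) → inj₁ AB ; (inj₁ (inj₂ AC)) → inj₂ (inj₂ AC) ; (inj₂ BC) → inj₂ (inj₁ BC) }
      where
      G = (2 * L) ^ L
      outer : ∀ Bc → Bc ⊆ B → 4 * count Bc < count B →
              (Shattered L pieces A B ⊎ Shattered L pieces A C) ⊎ Chunk B Bc C pieces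
      outer Bc Bc⊆ Bc-small = go
        where
        B″ A₀ : Subset
        B″ = B ∖ Bc
        A₀ a = A a ∧ (count B″ ≤ᵇ L * deg a B″)
        B≤ : count B ≤ 2 * count B″
        B≤ = linear-≤ (2 * count Bc) (<⇒≤ Bc-small) (trans (cong (λ k → k + k + 2 * count Bc) (sym (count-∖ B Bc⊆))) (lem (count Bc) (count B″)))
          where
          lem : ∀ c d → c + d + (c + d) + 2 * c ≡ 2 * d + 4 * c
          lem = solve-∀
        B″>0 : 0 < count B″
        B″>0 = n≢0⇒n>0 λ eq → <⇒≱ (≤-trans θ>0 θ≤B) (≤-trans B≤ (≤-reflexive (cong (2 *_) eq)))
        go : (Shattered L pieces A B ⊎ Shattered L pieces A C) ⊎ Chunk B Bc C pieces
        go with count A ≤? 2 * count A₀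
        ... | no few-good = inj₁ (inj₁ record
          { region = N ⊗ B″ ; bits = N ∷ B″ ∷ []
          ; measurable = λ ax ay → cong₂ _∧_ (ax N (here refl)) (ay B″ (there (here refl)))
          ; few-bits = *-monoʳ-≤ 2 pieces>0
          ; inside = λ x y p → let q , r = ∧-true p in proj₁ (∧-true q) , proj₁ (∧-true r)
          ; large = subst (λ k → count A * count B ≤ 8 * k) (sym (area-⊗ N B″))
              (≤-trans (*-mono-≤ A≤ B≤) (≤-trans (≤-reflexive (lem₁ (count N) (count B″))) (*-monoˡ-≤ (count N * count B″) {4} {8} (s≤s (s≤s (s≤s (s≤s z≤n)))))))
          ; sparse = ≤-trans (sparse-rows N B″ L (count B″) (λ a p → <⇒≤ (≤ᵇ-false (low a p)))) (≤-reflexive (sym (area-⊗ N B″))) })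
          where
          N : Subset
          N = A ∖ A₀
          A≤ : count A ≤ 2 * count N
          A≤ = linear-≤ 0 (<⇒≤ (≰⇒> few-good)) (trans (cong (λ k → k + k + 0) (sym (count-∖ A {A₀} λ a → proj₁ ∘ ∧-true))) (lem₂ (count A₀) (count N)))
            where
            lem₂ : ∀ c d → c + d + (c + d) + 0 ≡ 2 * d + 2 * c
            lem₂ = solve-∀
          lem₁ : ∀ c d → 2 * c * (2 * d) ≡ 4 * (c * d)
          lem₁ = solve-∀
          low : ∀ a → N a ≡ true → (count B″ ≤ᵇ L * deg a B″) ≡ false
          low a p with A a | count B″ ≤ᵇ L * deg a B″
          low a p  | true  | false = refl
          low a () | true  | true
          low a () | false | _
        ... | yes many-good = case Middle.result of λ { (inj₁ D) → inj₂ D ; (inj₂ AC) → inj₁ (inj₂ AC) }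
          where
          middle : ∀ Ac → Ac ⊆ A → 4 * count Ac < count A → Chunk B Bc C pieces ⊎ Chunk A Ac C pieces
          middle Ac Ac⊆ Ac-small = convert (Inner.result A″ B″ C A″>0 B″>0 (λ a p → ≤ᵇ-true (proj₂ (∧-true {A a} (proj₁ (∧-true p))))))
            where
            A″ : Subset
            A″ = A₀ ∖ Ac
            -- `A₀` contains at least half of `A`, and less than a quarter of `A` has been covered.
            A≤ : count A ≤ 4 * count A″
            A≤ = linear-≤ 0 (+-mono-≤ (+-mono-≤ (<⇒≤ Ac-small) (*-monoʳ-≤ 2 many-good)) (*-monoʳ-≤ 4 A₀≤)) (lem (count A) (count A₀) (count A″) (count Ac))
              where
              A₀≤ : count A₀ ≤ count Ac + count A″
              A₀≤ = ≤-trans (≤-reflexive (sym (count-split A₀ Ac))) (+-monoˡ-≤ (count A″) (count-mono {A₀ ∩ Ac} {Ac} λ a p → proj₂ (∧-true {A₀ a} p)))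
              lem : ∀ a a₀ a₂ c → a + (a + 2 * (2 * a₀) + 4 * (c + a₂)) + 0 ≡ 4 * a₂ + (4 * c + 2 * a + 4 * a₀)
              lem = solve-∀
            A″>0 : 0 < count A″
            A″>0 = n≢0⇒n>0 λ eq → <⇒≱ (≤-trans θ>0 θ≤A) (≤-trans A≤ (≤-reflexive (cong (4 *_) eq)))
            convert : Piece A″ C G (L * s) ⊎ SparsePiece B″ C (2 * L) → Chunk B Bc C pieces ⊎ Chunk A Ac C pieces
            convert (inj₂ P) = inj₁ record
              { X′ = X′ ; Y′ = Y′ ; X′⊆ = λ x p → proj₁ (∧-true (X′⊆ x p)) ; fresh = λ x p → not-true (proj₂ (∧-true {B x} (X′⊆ x p)))
              ; Y′⊆ = Y′⊆
              ; X-large = ≤-trans B≤ (≤-trans (*-monoʳ-≤ 2 X-large) (≤-trans (≤-reflexive (sym (*-assoc 2 (2 * L) (count X′)))) (*-monoˡ-≤ (count X′) 4L≤pieces)))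
              ; Y-large = Y-large ; few = few }
              where open SparsePiece P
            convert (inj₁ P) = inj₂ record
              { X′ = X′ ; Y′ = Y′ ; X′⊆ = λ x p → proj₁ (∧-true (proj₁ (∧-true (X′⊆ x p)))) ; fresh = λ x p → not-true (proj₂ (∧-true {A₀ x} (X′⊆ x p)))
              ; Y′⊆ = Y′⊆ ; X-large = A-large ; Y-large = Y-large
              -- The piece has at most L s edges. Its sides satisfy θ² ≤ |A| |C| ≤ 8 (2L)^L |X′|
              -- |Y′|, so `θ-large` gives L · L s ≤ |X′| |Y′|.
              ; few = ≤-trans (*-monoʳ-≤ L few) (*-cancelˡ-≤ (8 * G) ⦃ m*n≢0 8 G ⦃ _ ⦄ ⦃ m^n≢0 (2 * L) L ⦃ m*n≢0 2 L ⦄ ⦄ ⦄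
                  (≤-trans θ-large (≤-trans (*-mono-≤ (≤-trans θ≤A A-large) (≤-trans θ≤C Y-large)) (≤-reflexive (lem G (count X′) (count Y′)))))) }
              where
              open Piece P
              A-large : count A ≤ pieces * count X′
              A-large = ≤-trans A≤ (≤-trans (*-monoʳ-≤ 4 X-large) (≤-reflexive (sym (*-assoc 4 G (count X′)))))
              lem : ∀ g x y → 4 * g * x * (2 * y) ≡ 8 * g * (x * y)
              lem = solve-∀
          module Middle = Greedy A C pieces pieces>0 middle
      module Outer = Greedy B C pieces pieces>0 outer

-- Refinement of a partition

_≡ᴸ_ : List Bool → List Bool → Bool
[]          ≡ᴸ []          = true
(true  ∷ u) ≡ᴸ (true  ∷ v) = u ≡ᴸ v
(false ∷ u) ≡ᴸ (false ∷ v) = u ≡ᴸ v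
_           ≡ᴸ _           = false

≡ᴸ-sound : ∀ u v → (u ≡ᴸ v) ≡ true → u ≡ v
≡ᴸ-sound []          []          _ = refl
≡ᴸ-sound (true  ∷ u) (true  ∷ v) p = cong (true ∷_) (≡ᴸ-sound u v p)
≡ᴸ-sound (false ∷ u) (false ∷ v) p = cong (false ∷_) (≡ᴸ-sound u v p)
≡ᴸ-sound []          (_ ∷ _)     ()
≡ᴸ-sound (true  ∷ _) []          ()
≡ᴸ-sound (false ∷ _) []          ()
≡ᴸ-sound (true  ∷ _) (false ∷ _) ()
≡ᴸ-sound (false ∷ _) (true  ∷ _) ()

≡ᴸ-refl : ∀ u → (u ≡ᴸ u) ≡ true
≡ᴸ-refl []          = refl
≡ᴸ-refl (true  ∷ u) = ≡ᴸ-refl u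
≡ᴸ-refl (false ∷ u) = ≡ᴸ-refl u

words : ℕ → List (List Bool)
words zero    = [] ∷ []
words (suc q) = map (true ∷_) (words q) ++ map (false ∷_) (words q)

length-words : ∀ q → length (words q) ≡ 2 ^ q
length-words zero    = refl
length-words (suc q) = trans (length-++ (map (true ∷_) (words q)))
  (trans (cong₂ _+_ (trans (length-map _ (words q)) (length-words q)) (trans (length-map _ (words q)) (length-words q)))
         (cong (2 ^ q +_) (sym (+-identityʳ (2 ^ q)))))

∑-words : ∀ u → ∑ (words (length u)) (λ v → 𝟙 (u ≡ᴸ v)) ≡ 1
∑-words []       = refl
∑-words (b ∷ u) = trans (∑-++ (map (true ∷_) (words (length u))) _ _)
  (trans (cong₂ _+_ (∑-map (words (length u)) _ _) (∑-map (words (length u)) _ _)) (lem b))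
  where
  lem : ∀ b → ∑ (words (length u)) (λ v → 𝟙 ((b ∷ u) ≡ᴸ (true ∷ v))) + ∑ (words (length u)) (λ v → 𝟙 ((b ∷ u) ≡ᴸ (false ∷ v))) ≡ 1
  lem true  = cong₂ _+_ (∑-words u) (∑-zero (words (length u)))
  lem false = cong₂ _+_ (∑-zero (words (length u))) (∑-words u)

∈-words : ∀ u → u ∈ words (length u)
∈-words []          = here refl
∈-words (true ∷ u)  = ∈-++⁺ˡ (∈-map⁺ _ (∈-words u))
∈-words (false ∷ u) = ∈-++⁺ʳ (map (true ∷_) (words (length u))) (∈-map⁺ _ (∈-words u))

firstJust : ∀ {X : Set} → List (Maybe X) → Maybe X
firstJust []             = nothing
firstJust (just x ∷ ms)  = just x
firstJust (nothing ∷ ms) = firstJust ms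

firstJust-just : ∀ {X : Set} {ms : List (Maybe X)} {m} → m ∈ ms → is-just m ≡ true → is-just (firstJust ms) ≡ true
firstJust-just {ms = just x ∷ ms}  _           _ = refl
firstJust-just {ms = nothing ∷ ms} (there m∈) j = firstJust-just m∈ j
firstJust-just {ms = nothing ∷ ms} (here refl) ()

dyadic-level : ∀ K a X → a ≤ X → X ≤ 2 ^ K * a → ∃ λ j → j ≤ K × 2 ^ j * a ≤ X × X ≤ 2 * (2 ^ j * a)
dyadic-level zero a X a≤X X≤ = 0 , z≤n , ≤-trans (≤-reflexive (+-identityʳ a)) a≤X , ≤-trans X≤ (m≤n*m _ 2)
dyadic-level (suc K) a X a≤X X≤ with X ≤? 2 ^ K * a
... | yes X≤′ = let j , j≤ , p , q = dyadic-level K a X a≤X X≤′ in j , m≤n⇒m≤1+n j≤ , p , q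
... | no X≰ = K , n≤1+n K , <⇒≤ (≰⇒> X≰) , ≤-trans X≤ (≤-reflexive (*-assoc 2 (2 ^ K) a))

-- Sums the subtraction-free form of "32 times the gain is at least f₃". It is applied over the
-- second cell, the first cell and the levels in turn.
∑-combine : ∀ {A : Set} (xs : List A) (f₁ f₂ f₃ h₁ h₂ : A → ℕ) →
            (∀ x → 32 * f₁ x + 32 * f₂ x + f₃ x ≤ 32 * h₁ x + 32 * h₂ x) →
            32 * ∑ xs f₁ + 32 * ∑ xs f₂ + ∑ xs f₃ ≤ 32 * ∑ xs h₁ + 32 * ∑ xs h₂
∑-combine []       f₁ f₂ f₃ h₁ h₂ le = z≤n
∑-combine (x ∷ xs) f₁ f₂ f₃ h₁ h₂ le = linear-≤ 0 (+-mono-≤ (le x) (∑-combine xs f₁ f₂ f₃ h₁ h₂ le))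
  (lem (f₁ x) (f₂ x) (f₃ x) (h₁ x) (h₂ x) (∑ xs f₁) (∑ xs f₂) (∑ xs f₃) (∑ xs h₁) (∑ xs h₂))
  where
  lem : ∀ a b c d e a′ b′ c′ d′ e′ →
        32 * (a + a′) + 32 * (b + b′) + (c + c′) + (32 * d + 32 * e + (32 * d′ + 32 * e′)) + 0
        ≡ 32 * (d + d′) + 32 * (e + e′) + (32 * a + 32 * b + c + (32 * a′ + 32 * b′ + c′))
  lem = solve-∀

-- Gain of the potential under one refinement

module Refinement {V : Set} (vs : List V) (complete : ∀ x → x ∈ vs) (adj : V → V → Bool) (K g : ℕ) where
  open Counting vs
  open Graph vs adj

  colour : List Subset → V → List Bool
  colour bs x = map (λ b → b x) bs

  agree⇒colour : ∀ bs {x y} → Agree bs x y → colour bs x ≡ colour bs y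
  agree⇒colour []       h = refl
  agree⇒colour (b ∷ bs) h = cong₂ _∷_ (h b (here refl)) (agree⇒colour bs (λ c c∈ → h c (there c∈)))

  colour⇒agree : ∀ bs {x y} → colour bs x ≡ colour bs y → Agree bs x y
  colour⇒agree (b ∷ bs) eq .b (here refl) = proj₁ (∷-injective eq)
  colour⇒agree (b ∷ bs) eq c  (there c∈)  = colour⇒agree bs (proj₂ (∷-injective eq)) c c∈

  -- 1 / L is half of the lowest level 2^(-K). A region of density at most 1 / L therefore
  -- contributes at least twice as much to the area term of any level as to the edge term.
  L : ℕ
  L = 2 ^ suc K

  levels : List ℕ
  levels = upTo (suc K)

  -- Refining a partition increases Φ⁺ - Φ⁻, the sum over the dyadic densities 2^(j - K) of the
  -- excess of edges over that density on the regions F j.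
  Φ⁺ Φ⁻ : (ℕ → Relation₂) → ℕ
  Φ⁺ F = ∑ levels (λ j → 2 ^ K * edges (F j))
  Φ⁻ F = ∑ levels (λ j → 2 ^ j * area (F j))

  module Cells (bs : List Subset) where

    col : V → List Bool
    col = colour bs

    cols : List (List Bool)
    cols = words (length bs)

    col∈ : ∀ x → col x ∈ cols
    col∈ x = subst (λ k → col x ∈ words k) (length-map _ bs) (∈-words (col x))

    cell : List Bool → Subset
    cell u x = col x ≡ᴸ u

    col⇒cell : ∀ {u x} → col x ≡ u → cell u x ≡ true
    col⇒cell {x = x} refl = ≡ᴸ-refl (col x)

    ∑-cell : ∀ x → ∑ cols (λ u → 𝟙 (cell u x)) ≡ 1
    ∑-cell x = subst (λ k → ∑ (words k) (λ u → 𝟙 (cell u x)) ≡ 1) (length-map _ bs) (∑-words (col x))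

    within : List Bool → List Bool → Relation₂ → Relation₂
    within u w F x y = (cell u x ∧ cell w y) ∧ F x y

    spread : ∀ (c : V → List Bool → Bool) → (∀ x → ∑ cols (λ u → 𝟙 (c x u)) ≡ 1) → ∀ x k →
             k ≡ ∑ cols (λ u → 𝟙 (c x u) * k)
    spread c one x k = sym (begin
      ∑ cols (λ u → 𝟙 (c x u) * k)   ≡⟨ ∑-cong cols (λ u → *-comm (𝟙 (c x u)) k) ⟩
      ∑ cols (λ u → k * 𝟙 (c x u))   ≡⟨ ∑-* cols k _ ⟩
      k * ∑ cols (λ u → 𝟙 (c x u))   ≡⟨ cong (k *_) (one x) ⟩
      k * 1                          ≡⟨ *-identityʳ k ⟩
      k                              ∎)
      where open ≡-Reasoning

    count-cells : ∀ X → count X ≡ ∑ cols (λ u → count (cell u ∩ X))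
    count-cells X = trans (∑-cong vs λ x → trans (spread (λ z u → cell u z) ∑-cell x (𝟙 (X x))) (∑-cong cols λ u → sym (𝟙-∧ (cell u x) (X x))))
      (∑-swap vs cols _)

    area-cells : ∀ F → area F ≡ ∑ cols (λ u → ∑ cols (λ w → area (within u w F)))
    area-cells F = begin
      ∑ vs (λ x → ∑ vs λ y → 𝟙 (F x y))
        ≡⟨ ∑-cong vs (λ x → ∑-cong vs λ y → pt x y) ⟩
      ∑ vs (λ x → ∑ vs λ y → ∑ cols λ u → ∑ cols λ w → 𝟙 (within u w F x y))
        ≡⟨ ∑-cong vs (λ x → ∑-swap vs cols _) ⟩
      ∑ vs (λ x → ∑ cols λ u → ∑ vs λ y → ∑ cols λ w → 𝟙 (within u w F x y))
        ≡⟨ ∑-swap vs cols _ ⟩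
      ∑ cols (λ u → ∑ vs λ x → ∑ vs λ y → ∑ cols λ w → 𝟙 (within u w F x y))
        ≡⟨ ∑-cong cols (λ u → ∑-cong vs λ x → ∑-swap vs cols _) ⟩
      ∑ cols (λ u → ∑ vs λ x → ∑ cols λ w → ∑ vs λ y → 𝟙 (within u w F x y))
        ≡⟨ ∑-cong cols (λ u → ∑-swap vs cols _) ⟩
      ∑ cols (λ u → ∑ cols (λ w → area (within u w F))) ∎
      where
      open ≡-Reasoning
      pt : ∀ x y → 𝟙 (F x y) ≡ ∑ cols (λ u → ∑ cols λ w → 𝟙 (within u w F x y))
      pt x y = trans (spread (λ z u → cell u z) ∑-cell x (𝟙 (F x y))) (∑-cong cols λ u →
        trans (cong (𝟙 (cell u x) *_) (spread (λ z u → cell u z) ∑-cell y (𝟙 (F x y))))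
        (trans (sym (∑-* cols (𝟙 (cell u x)) _)) (∑-cong cols λ w → lem (cell u x) (cell w y) (F x y))))
        where
        lem : ∀ a b c → 𝟙 a * (𝟙 b * 𝟙 c) ≡ 𝟙 ((a ∧ b) ∧ c)
        lem true  true  c = trans (+-identityʳ _) (+-identityʳ _)
        lem true  false c = refl
        lem false b     c = refl

    edges-cells : ∀ F → edges F ≡ ∑ cols (λ u → ∑ cols (λ w → edges (within u w F)))
    edges-cells F = trans (area-cells _) (∑-cong cols λ u → ∑-cong cols λ w → area-cong λ x y →
        lem (adj x y) (cell u x ∧ cell w y) (F x y))
      where
      lem : ∀ a b c → b ∧ (a ∧ c) ≡ a ∧ (b ∧ c)
      lem true  b     c = refl
      lem false true  c = refl
      lem false false c = refl

    within-cong : ∀ u w {F G} → (∀ x y → col x ≡ u → col y ≡ w → F x y ≡ G x y) →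
                  ∀ x y → within u w F x y ≡ within u w G x y
    within-cong u w h x y with cell u x in eq₁ | cell w y in eq₂
    ... | true  | true  = h x y (≡ᴸ-sound _ _ eq₁) (≡ᴸ-sound _ _ eq₂)
    ... | true  | false = refl
    ... | false | _     = refl

    a e : List Bool → List Bool → ℕ
    a u w = area (cell u ⊗ cell w)
    e u w = edges (cell u ⊗ cell w)

    dense : List Bool → List Bool → Bool
    dense u w = a u w ≤ᵇ 2 ^ K * e u w

    -- The density of the pair lies between 2^(j - K) and twice that value.
    active : ℕ → List Bool → List Bool → Bool
    active j u w = (2 ^ j * a u w ≤ᵇ 2 ^ K * e u w) ∧ (2 ^ K * e u w ≤ᵇ 2 * (2 ^ j * a u w))

    module Step (W : ℕ → Relation₂) (W-measurable : ∀ j → Measurable bs (W j))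
                (sh : ∀ u w → Maybe (Shattered L g (cell u) (cell w))) where

      -- At an active level a shattered pair is included in full except for its sparse region,
      -- whether or not it was included before. The sparse region lies below the level, so leaving
      -- it out is the better choice for the hinge.
      updated : ℕ → ∀ u w → Maybe (Shattered L g (cell u) (cell w)) → Relation₂
      updated j u w nothing  x y = W j x y
      updated j u w (just S) x y = if active j u w then not (Shattered.region S x y) else W j x y

      W⁺ : ℕ → Relation₂
      W⁺ j x y = updated j (col x) (col y) (sh (col x) (col y)) x y

      gain : ℕ → ∀ u w → Maybe (Shattered L g (cell u) (cell w)) → ℕ
      gain j u w nothing  = 0
      gain j u w (just _) = 𝟙 (active j u w) * (2 ^ K * e u w)

      -- A representative of each cell supplies the common value of `W j`. If one of the cells is
      -- empty the claim is vacuous and `false` serves as a default.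
      constant : ∀ j u w → ∃ λ β → ∀ x y → col x ≡ u → col y ≡ w → W j x y ≡ β
      constant j u w with search vs (cell u) | search vs (cell w)
      ... | inj₁ (x₀ , p) | inj₁ (y₀ , q) = W j x₀ y₀ , λ x y cx cy →
            W-measurable j (colour⇒agree bs (trans cx (sym (≡ᴸ-sound _ _ p)))) (colour⇒agree bs (trans cy (sym (≡ᴸ-sound _ _ q))))
      ... | inj₂ none | _ = false , λ x y cx cy → ⊥-elim (true≢false (col⇒cell cx) (none x (complete x)))
      ... | inj₁ _ | inj₂ none = false , λ x y cx cy → ⊥-elim (true≢false (col⇒cell cy) (none y (complete y)))

      Inequality : ℕ → List Bool → List Bool → Relation₂ → Relation₂ → ℕ → Set
      Inequality j u w F F⁺ γ =
        32 * (2 ^ K * edges (within u w F)) + 32 * (2 ^ j * area (within u w F⁺)) + γ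
        ≤ 32 * (2 ^ K * edges (within u w F⁺)) + 32 * (2 ^ j * area (within u w F))

      -- Leaving out the region R gains 2^j |R| - 2^K e(R), which is at least 2^j |R| / 2 by
      -- sparsity. Here |R| ≥ a / 8 as the pair is shattered, and 2^j a ≥ 2^K e / 2 as the level is
      -- active. The product of the three losses is 32.
      cell-gain : ∀ j u w m → Inequality j u w (W j) (updated j u w m) (gain j u w m)
      cell-gain j u w nothing = ≤-reflexive (+-identityʳ _)
      cell-gain j u w (just S) with active j u w in eq
      ... | false = ≤-reflexive (+-identityʳ _)
      ... | true with constant j u w
      ...   | β , const = subst (λ k → 32 * (2 ^ K * edges (within u w (W j))) + 32 * (2 ^ j * A⁺) + k ≤ 32 * (2 ^ K * E⁺) + 32 * (2 ^ j * area (within u w (W j))))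
                 (sym (+-identityʳ (2 ^ K * e u w)))
                 (subst₂ (λ k l → 32 * (2 ^ K * k) + 32 * (2 ^ j * A⁺) + 2 ^ K * e u w ≤ 32 * (2 ^ K * E⁺) + 32 * (2 ^ j * l))
                   (area-cong λ x y → cong (adj x y ∧_) (within-cong u w (λ x y cx cy → sym (const x y cx cy)) x y))
                   (area-cong (within-cong u w (λ x y cx cy → sym (const x y cx cy)))) (core β))
        where
        open Shattered S
        R : Relation₂
        R = region
        A⁺ E⁺ : ℕ
        A⁺ = area (within u w (λ x y → not (R x y)))
        E⁺ = edges (within u w (λ x y → not (R x y)))
        split : ∀ x y → 𝟙 ((cell u ⊗ cell w) x y) ≡ 𝟙 (R x y) + 𝟙 (within u w (λ x y → not (R x y)) x y)
        split x y with R x y in eq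
        ... | true rewrite proj₁ (inside x y eq) | proj₂ (inside x y eq) = refl
        ... | false with cell u x ∧ cell w y
        ...   | true  = refl
        ...   | false = refl
        split-e : ∀ x y → 𝟙 (adj x y ∧ (cell u ⊗ cell w) x y) ≡ 𝟙 (adj x y ∧ R x y) + 𝟙 (adj x y ∧ within u w (λ x y → not (R x y)) x y)
        split-e x y with adj x y
        ... | true  = split x y
        ... | false = refl
        area-split : a u w ≡ area R + A⁺
        area-split = area-+ split
        edges-split : e u w ≡ edges R + E⁺
        edges-split = area-+ split-e
        lower : 2 ^ j * a u w ≤ 2 ^ K * e u w
        lower = ≤ᵇ-true (proj₁ (∧-true eq))
        upper : 2 ^ K * e u w ≤ 2 * (2 ^ j * a u w)
        upper = ≤ᵇ-true (proj₂ (∧-true {2 ^ j * a u w ≤ᵇ 2 ^ K * e u w} eq))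
        large′ : a u w ≤ 8 * area R
        large′ = ≤-trans (≤-reflexive (area-⊗ (cell u) (cell w))) large
        sparse′ : 2 * (2 ^ K * edges R) ≤ 2 ^ j * area R
        sparse′ = ≤-trans (≤-reflexive (sym (*-assoc 2 (2 ^ K) (edges R)))) (≤-trans sparse (m≤n*m (area R) (2 ^ j) ⦃ m^n≢0 2 j ⦄))
        core : ∀ β → 32 * (2 ^ K * edges (within u w (λ _ _ → β))) + 32 * (2 ^ j * A⁺) + 2 ^ K * e u w
                       ≤ 32 * (2 ^ K * E⁺) + 32 * (2 ^ j * area (within u w (λ _ _ → β)))
        core true = subst₂ (λ k l → 32 * (2 ^ K * k) + 32 * (2 ^ j * A⁺) + 2 ^ K * e u w ≤ 32 * (2 ^ K * E⁺) + 32 * (2 ^ j * l))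
            (area-cong λ x y → cong (adj x y ∧_) (sym (∧-identityʳ ((cell u ⊗ cell w) x y)))) (area-cong λ x y → sym (∧-identityʳ ((cell u ⊗ cell w) x y)))
            (linear-≤ 0 (+-mono-≤ (+-mono-≤ upper (*-monoʳ-≤ 2 (*-monoʳ-≤ (2 ^ j) large′))) (*-monoʳ-≤ 16 sparse′)) (begin
              32 * (2 ^ K * e u w) + 32 * (2 ^ j * A⁺) + 2 ^ K * e u w + (2 * (2 ^ j * a u w) + 2 * (2 ^ j * (8 * area R)) + 16 * (2 ^ j * area R)) + 0
                ≡⟨ cong₂ (λ k l → 32 * (2 ^ K * k) + 32 * (2 ^ j * A⁺) + 2 ^ K * e u w + (2 * (2 ^ j * l) + 2 * (2 ^ j * (8 * area R)) + 16 * (2 ^ j * area R)) + 0) edges-split area-split ⟩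
              32 * (2 ^ K * (edges R + E⁺)) + 32 * (2 ^ j * A⁺) + 2 ^ K * e u w + (2 * (2 ^ j * (area R + A⁺)) + 2 * (2 ^ j * (8 * area R)) + 16 * (2 ^ j * area R)) + 0
                ≡⟨ lem (2 ^ K) (2 ^ j) (edges R) E⁺ (area R) A⁺ (e u w) ⟩
              32 * (2 ^ K * E⁺) + 32 * (2 ^ j * (area R + A⁺)) + (2 ^ K * e u w + 2 * (2 ^ j * (area R + A⁺)) + 16 * (2 * (2 ^ K * edges R)))
                ≡⟨ cong (λ l → 32 * (2 ^ K * E⁺) + 32 * (2 ^ j * l) + (2 ^ K * e u w + 2 * (2 ^ j * l) + 16 * (2 * (2 ^ K * edges R)))) (sym area-split) ⟩
              32 * (2 ^ K * E⁺) + 32 * (2 ^ j * a u w) + (2 ^ K * e u w + 2 * (2 ^ j * a u w) + 16 * (2 * (2 ^ K * edges R))) ∎))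
          where
          open ≡-Reasoning
          lem : ∀ p q r r⁺ s s⁺ ε → 32 * (p * (r + r⁺)) + 32 * (q * s⁺) + p * ε + (2 * (q * (s + s⁺)) + 2 * (q * (8 * s)) + 16 * (q * s)) + 0
                ≡ 32 * (p * r⁺) + 32 * (q * (s + s⁺)) + (p * ε + 2 * (q * (s + s⁺)) + 16 * (2 * (p * r)))
          lem = solve-∀
        -- The pair was not included before. By `lower`, including all of it does not decrease the
        -- potential, and leaving out the region then gains as much as in the other case.
        core false = subst₂ (λ k l → 32 * (2 ^ K * k) + 32 * (2 ^ j * A⁺) + 2 ^ K * e u w ≤ 32 * (2 ^ K * E⁺) + 32 * (2 ^ j * l))
            (sym (edges-none λ x y → ∧-zeroʳ ((cell u ⊗ cell w) x y))) (sym (area-none λ x y → ∧-zeroʳ ((cell u ⊗ cell w) x y)))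
            (linear-≤ 0 (+-mono-≤ (*-monoʳ-≤ 32 lower) (+-mono-≤ (+-mono-≤ upper (*-monoʳ-≤ 2 (*-monoʳ-≤ (2 ^ j) large′))) (*-monoʳ-≤ 16 sparse′))) (begin
              32 * (2 ^ K * 0) + 32 * (2 ^ j * A⁺) + 2 ^ K * e u w + (32 * (2 ^ K * e u w) + (2 * (2 ^ j * a u w) + 2 * (2 ^ j * (8 * area R)) + 16 * (2 ^ j * area R))) + 0
                ≡⟨ cong₂ (λ k l → 32 * (2 ^ K * 0) + 32 * (2 ^ j * A⁺) + 2 ^ K * e u w + (32 * (2 ^ K * k) + (2 * (2 ^ j * l) + 2 * (2 ^ j * (8 * area R)) + 16 * (2 ^ j * area R))) + 0) edges-split area-split ⟩
              32 * (2 ^ K * 0) + 32 * (2 ^ j * A⁺) + 2 ^ K * e u w + (32 * (2 ^ K * (edges R + E⁺)) + (2 * (2 ^ j * (area R + A⁺)) + 2 * (2 ^ j * (8 * area R)) + 16 * (2 ^ j * area R))) + 0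
                ≡⟨ lem (2 ^ K) (2 ^ j) (edges R) E⁺ (area R) A⁺ (e u w) ⟩
              32 * (2 ^ K * E⁺) + 32 * (2 ^ j * 0) + (32 * (2 ^ j * (area R + A⁺)) + (2 ^ K * e u w + 2 * (2 ^ j * (area R + A⁺)) + 16 * (2 * (2 ^ K * edges R))))
                ≡⟨ cong (λ l → 32 * (2 ^ K * E⁺) + 32 * (2 ^ j * 0) + (32 * (2 ^ j * l) + (2 ^ K * e u w + 2 * (2 ^ j * l) + 16 * (2 * (2 ^ K * edges R))))) (sym area-split) ⟩
              32 * (2 ^ K * E⁺) + 32 * (2 ^ j * 0) + (32 * (2 ^ j * a u w) + (2 ^ K * e u w + 2 * (2 ^ j * a u w) + 16 * (2 * (2 ^ K * edges R)))) ∎))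
          where
          open ≡-Reasoning
          lem : ∀ p q r r⁺ s s⁺ ε → 32 * (p * 0) + 32 * (q * s⁺) + p * ε + (32 * (p * (r + r⁺)) + (2 * (q * (s + s⁺)) + 2 * (q * (8 * s)) + 16 * (q * s))) + 0
                ≡ 32 * (p * r⁺) + 32 * (q * 0) + (32 * (q * (s + s⁺)) + (p * ε + 2 * (q * (s + s⁺)) + 16 * (2 * (p * r))))
          lem = solve-∀

      ∑∑ : (List Bool → List Bool → ℕ) → ℕ
      ∑∑ f = ∑ cols (λ u → ∑ cols (f u))

      ∑∑-mono : ∀ {f h} → (∀ u w → f u w ≤ h u w) → ∑∑ f ≤ ∑∑ h
      ∑∑-mono k = ∑-mono cols λ u → ∑-mono cols (k u)

      ∑∑-cong : ∀ {f h} → (∀ u w → f u w ≡ h u w) → ∑∑ f ≡ ∑∑ h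
      ∑∑-cong k = ∑-cong cols λ u → ∑-cong cols (k u)

      ∑∑-* : ∀ c f → ∑∑ (λ u w → c * f u w) ≡ c * ∑∑ f
      ∑∑-* c f = trans (∑-cong cols λ u → ∑-* cols c (f u)) (∑-* cols c _)

      Γ : ℕ → ℕ
      Γ j = ∑∑ (λ u w → gain j u w (sh u w))

      level-gain : ∀ j → 32 * (2 ^ K * edges (W j)) + 32 * (2 ^ j * area (W⁺ j)) + Γ j
                         ≤ 32 * (2 ^ K * edges (W⁺ j)) + 32 * (2 ^ j * area (W j))
      level-gain j = subst₂ _≤_
        (cong₂ (λ k l → 32 * k + 32 * l + Γ j)
          (pull (2 ^ K) (edges (W j)) E (edges-cells (W j)))
          (pull (2 ^ j) (area (W⁺ j)) A⁺ (trans (area-cells (W⁺ j)) (∑∑-cong area⁺))))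
        (cong₂ (λ k l → 32 * k + 32 * l)
          (pull (2 ^ K) (edges (W⁺ j)) E⁺ (trans (edges-cells (W⁺ j)) (∑∑-cong edges⁺)))
          (pull (2 ^ j) (area (W j)) A (area-cells (W j))))
        (∑-combine cols (λ u → ∑ cols (λ w → 2 ^ K * E u w)) (λ u → ∑ cols (λ w → 2 ^ j * A⁺ u w)) (λ u → ∑ cols (λ w → gain j u w (sh u w)))
                        (λ u → ∑ cols (λ w → 2 ^ K * E⁺ u w)) (λ u → ∑ cols (λ w → 2 ^ j * A u w)) λ u →
          ∑-combine cols (λ w → 2 ^ K * E u w) (λ w → 2 ^ j * A⁺ u w) (λ w → gain j u w (sh u w))
                         (λ w → 2 ^ K * E⁺ u w) (λ w → 2 ^ j * A u w) λ w → cell-gain j u w (sh u w))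
        where
        E A E⁺ A⁺ : List Bool → List Bool → ℕ
        E  u w = edges (within u w (W j))
        A  u w = area  (within u w (W j))
        E⁺ u w = edges (within u w (updated j u w (sh u w)))
        A⁺ u w = area  (within u w (updated j u w (sh u w)))
        same : ∀ u w x y → col x ≡ u → col y ≡ w → W⁺ j x y ≡ updated j u w (sh u w) x y
        same .(col x) .(col y) x y refl refl = refl
        area⁺ : ∀ u w → area (within u w (W⁺ j)) ≡ A⁺ u w
        area⁺ u w = area-cong (within-cong u w (same u w))
        edges⁺ : ∀ u w → edges (within u w (W⁺ j)) ≡ E⁺ u w
        edges⁺ u w = area-cong λ x y → cong (adj x y ∧_) (within-cong u w (same u w) x y)
        pull : ∀ c t f → t ≡ ∑∑ f → ∑∑ (λ u w → c * f u w) ≡ c * t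
        pull c t f dec = trans (∑∑-* c f) (cong (c *_) (sym dec))

      Good : Relation₂
      Good x y = is-just (sh (col x) (col y)) ∧ dense (col x) (col y)

      -- A dense pair has density between 2^(-K) and 1, so some level j ≤ K is active for it. The
      -- gain at that single level already accounts for all its edges.
      Good-gain : 2 ^ K * edges Good ≤ ∑ levels Γ
      Good-gain = begin
        2 ^ K * edges Good ≡⟨ cong (2 ^ K *_) (edges-cells Good) ⟩
        2 ^ K * ∑∑ (λ u w → edges (within u w Good)) ≡⟨ ∑∑-* (2 ^ K) _ ⟨
        ∑∑ (λ u w → 2 ^ K * edges (within u w Good)) ≤⟨ ∑∑-mono per-cell ⟩
        ∑∑ (λ u w → ∑ levels (λ j → gain j u w (sh u w))) ≡⟨ ∑-cong cols (λ u → ∑-swap cols levels _) ⟩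
        ∑ cols (λ u → ∑ levels (λ j → ∑ cols (λ w → gain j u w (sh u w)))) ≡⟨ ∑-swap cols levels _ ⟩
        ∑ levels Γ ∎
        where
        open ≤-Reasoning
        none : ∀ u w → (∀ x y → col x ≡ u → col y ≡ w → Good x y ≡ false) → edges (within u w Good) ≡ 0
        none u w h = edges-none λ x y → trans (within-cong u w {Good} {λ _ _ → false} h x y) (∧-zeroʳ ((cell u ⊗ cell w) x y))
        per-cell : ∀ u w → 2 ^ K * edges (within u w Good) ≤ ∑ levels (λ j → gain j u w (sh u w))
        per-cell u w with sh u w in eq
        ... | nothing = ≤-trans (≤-reflexive (trans (cong (2 ^ K *_) (none u w λ { x y refl refl → cong (λ m → is-just m ∧ dense (col x) (col y)) eq })) (*-zeroʳ (2 ^ K)))) z≤n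
        ... | just S with dense u w in den
        ...   | false = ≤-trans (≤-reflexive (trans (cong (2 ^ K *_) (none u w λ { x y refl refl →
                  trans (cong (λ m → is-just m ∧ dense (col x) (col y)) eq) den })) (*-zeroʳ (2 ^ K)))) z≤n
        ...   | true with dyadic-level K (a u w) (2 ^ K * e u w) (≤ᵇ-true den) (*-monoʳ-≤ (2 ^ K) (edges≤area _))
        ...     | j , j≤K , lower , upper = ≤-trans (*-monoʳ-≤ (2 ^ K) (edges-mono λ x y p → proj₁ (∧-true p)))
                  (≤-trans (≤-reflexive (trans (sym (+-identityʳ (2 ^ K * e u w))) (cong (λ b → 𝟙 b * (2 ^ K * e u w)) (sym (∧-intro {2 ^ j * a u w ≤ᵇ 2 ^ K * e u w} (true-≤ᵇ lower) (true-≤ᵇ upper))))))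
                    (term≤∑ (λ j → gain j u w (just S)) (∈-upTo⁺ (s≤s j≤K))))

      total-gain : 32 * Φ⁺ W + 32 * Φ⁻ W⁺ + 2 ^ K * edges Good ≤ 32 * Φ⁺ W⁺ + 32 * Φ⁻ W
      total-gain = ≤-trans (+-monoʳ-≤ (32 * Φ⁺ W + 32 * Φ⁻ W⁺) Good-gain)
        (∑-combine levels (λ j → 2 ^ K * edges (W j)) (λ j → 2 ^ j * area (W⁺ j)) Γ
                          (λ j → 2 ^ K * edges (W⁺ j)) (λ j → 2 ^ j * area (W j)) level-gain)

      bitsOf : ∀ {u w} → Maybe (Shattered L g (cell u) (cell w)) → List Subset
      bitsOf nothing  = []
      bitsOf (just S) = Shattered.bits S

      bs⁺ : List Subset
      bs⁺ = bs ++ concatMap (λ u → concatMap (λ w → bitsOf (sh u w)) cols) cols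

      length-bs⁺ : length bs⁺ ≤ length bs + 2 ^ length bs * (2 ^ length bs * (2 * g))
      length-bs⁺ = begin
        length bs⁺ ≡⟨ length-++ bs ⟩
        length bs + length (concatMap (λ u → concatMap (λ w → bitsOf (sh u w)) cols) cols)
          ≡⟨ cong (length bs +_) (trans (length-concatMap cols _) (∑-cong cols λ u → length-concatMap cols _)) ⟩
        length bs + ∑∑ (λ u w → length (bitsOf (sh u w))) ≤⟨ +-monoʳ-≤ (length bs) (∑∑-mono λ u w → few (sh u w)) ⟩
        length bs + ∑∑ (λ u w → 2 * g) ≡⟨ cong (length bs +_) (trans (∑-cong cols λ u → ∑-const cols (2 * g)) (∑-const cols _)) ⟩
        length bs + length cols * (length cols * (2 * g)) ≡⟨ cong (λ k → length bs + k * (k * (2 * g))) (length-words (length bs)) ⟩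
        length bs + 2 ^ length bs * (2 ^ length bs * (2 * g)) ∎
        where
        open ≤-Reasoning
        few : ∀ {u w} (m : Maybe (Shattered L g (cell u) (cell w))) → length (bitsOf m) ≤ 2 * g
        few nothing  = z≤n
        few (just S) = Shattered.few-bits S

      W⁺-measurable : ∀ j → Measurable bs⁺ (W⁺ j)
      W⁺-measurable j {x} {x′} {y} {y′} ax ay = trans (body (sh u w) refl)
          (cong₂ (λ u w → updated j u w (sh u w) x′ y′) (agree⇒colour bs ax₀) (agree⇒colour bs ay₀))
        where
        u = col x
        w = col y
        ax₀ : Agree bs x x′
        ax₀ b b∈ = ax b (∈-++⁺ˡ b∈)
        ay₀ : Agree bs y y′
        ay₀ b b∈ = ay b (∈-++⁺ˡ b∈)
        new : ∀ {b} → b ∈ bitsOf (sh u w) → b ∈ bs⁺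
        new {b} b∈ = ∈-++⁺ʳ bs (∈-concatMap⁺ (λ u → concatMap (λ w → bitsOf (sh u w)) cols)
          (Any.map (λ {u} eq → subst (λ u → b ∈ concatMap (λ w → bitsOf (sh u w)) cols) eq
            (∈-concatMap⁺ (λ w → bitsOf (sh (col x) w)) (Any.map (λ {w} eq → subst (λ w → b ∈ bitsOf (sh (col x) w)) eq b∈) (col∈ y)))) (col∈ x)))
        body : ∀ m → sh u w ≡ m → updated j u w m x y ≡ updated j u w m x′ y′
        body nothing  _  = W-measurable j ax₀ ay₀
        body (just S) eq with active j u w
        ... | false = W-measurable j ax₀ ay₀
        ... | true  = cong not (Shattered.measurable S (λ b b∈ → ax b (new (subst (λ m → b ∈ bitsOf m) (sym eq) b∈)))
                                                      (λ b b∈ → ay b (new (subst (λ m → b ∈ bitsOf m) (sym eq) b∈))))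

-- The removal lemma

parts : ℕ → ℕ
parts K = 4 * (2 * 2 ^ suc K) ^ (2 ^ suc K)

-- Bounds the number of predicates generating the partition after r refinements.
bitBound : ℕ → ℕ → ℕ
bitBound K zero    = 0
bitBound K (suc r) = bitBound K r + 2 ^ bitBound K r * (2 ^ bitBound K r * (2 * parts K))

bitBound-mono : ∀ K {r R} → r ≤ R → bitBound K r ≤ bitBound K R
bitBound-mono K r≤R = go (≤⇒≤′ r≤R)
  where
  go : ∀ {r R} → r ≤′ R → bitBound K r ≤ bitBound K R
  go ≤′-refl       = ≤-refl
  go (≤′-step r≤R) = ≤-trans (go r≤R) (m≤m+n _ _)

-- `triples≤edges` expresses that the triangles given by `triples` are edge-disjoint, and
-- `edges≤triples` that they account for all edges. `θ-large` makes the trichotomy applicable to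
-- cells of size at least `θ`; `θ-small` ensures that all smaller cells together contain at most a
-- fraction 2^(-K) of the vertices, as long as at most `R` refinements were made.
module Removal {V : Set} (vs : List V) (complete : ∀ x → x ∈ vs) (adj : V → V → Bool) (K R s θ : ℕ)
  (triples : List (V × V × V))
  (triples≤edges : ∀ P → ∑ triples (λ (x , y , z) → 𝟙 (P x y) + (𝟙 (P y z) + 𝟙 (P x z))) ≤ Graph.edges vs adj P)
  (edges≤triples : Graph.edges vs adj (λ _ _ → true) ≤ 3 * length triples)
  (few-triangles : ∀ b → Graph.edges vs adj (λ x y → adj x b ∧ adj b y) ≤ s)
  (R-large : 192 * suc K < R)
  (θ>0 : 0 < θ)
  (θ-large : 2 * parts K * (2 ^ suc K * (2 ^ suc K * s)) ≤ θ * θ)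
  (θ-small : 2 ^ K * (2 ^ bitBound K (R) * θ) ≤ length vs) where

  open Counting vs
  open Graph vs adj
  open Refinement vs complete adj K (parts K)
  open Trichotomy s L (m^n>0 2 (suc K)) few-triangles using (trichotomy)

  N M : ℕ
  N = length triples
  M = length vs

  module Dense (dense-triples : 6 * (M * M) < N * 2 ^ K) where

    N>0 : 0 < N
    N>0 = n≢0⇒n>0 λ eq → n≮0 (subst (λ k → 6 * (M * M) < k * 2 ^ K) eq dense-triples)

    module Round (bs : List Subset) (bs-bound : length bs ≤ bitBound K (R))
                 (W : ℕ → Relation₂) (W-measurable : ∀ j → Measurable bs (W j)) where
      open Cells bs

      big : List Bool → Bool
      big u = θ ≤ᵇ count (cell u)

      Sh : List Bool → List Bool → Set
      Sh u w = Shattered L (parts K) (cell u) (cell w)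

      tri : ∀ u v w → Maybe (Sh u v ⊎ Sh v w ⊎ Sh u w)
      tri u v w = go (big u) refl (big v) refl (big w) refl
        module Tri where
        go : ∀ b₁ → big u ≡ b₁ → ∀ b₂ → big v ≡ b₂ → ∀ b₃ → big w ≡ b₃ → Maybe (Sh u v ⊎ Sh v w ⊎ Sh u w)
        go true p true q true r = just (trichotomy θ (cell u) (cell v) (cell w) θ>0
              (≤-trans (≤-reflexive (cong (_* (L * (L * s))) (*-assoc 2 4 ((2 * L) ^ L)))) θ-large) (≤ᵇ-true p) (≤ᵇ-true q) (≤ᵇ-true r))
        go _ _ _ _ _ _ = nothing

        go-just : ∀ b₁ p b₂ q b₃ r → b₁ ≡ true → b₂ ≡ true → b₃ ≡ true → is-just (go b₁ p b₂ q b₃ r) ≡ true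
        go-just true p true q true r _ _ _ = refl

      getAB : ∀ {X Y Z : Set} → Maybe (X ⊎ Y ⊎ Z) → Maybe X
      getAB (just (inj₁ x)) = just x
      getAB _               = nothing

      getBC : ∀ {X Y Z : Set} → Maybe (X ⊎ Y ⊎ Z) → Maybe Y
      getBC (just (inj₂ (inj₁ y))) = just y
      getBC _                      = nothing

      getAC : ∀ {X Y Z : Set} → Maybe (X ⊎ Y ⊎ Z) → Maybe Z
      getAC (just (inj₂ (inj₂ z))) = just z
      getAC _                      = nothing

      -- The pair (u, w) can come out shattered in each of the three roles of the trichotomy, with
      -- any cell as the third one.
      candidates : ∀ u w → List (Maybe (Sh u w))
      candidates u w = map (λ v → getAB (tri u w v)) cols ++ map (λ v → getBC (tri v u w)) cols ++ map (λ v → getAC (tri u v w)) cols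

      sh : ∀ u w → Maybe (Sh u w)
      sh u w = firstJust (candidates u w)

      some-shattered : ∀ {u v w} → u ∈ cols → v ∈ cols → w ∈ cols → big u ≡ true → big v ≡ true → big w ≡ true →
                       is-just (sh u v) ≡ true ⊎ is-just (sh v w) ≡ true ⊎ is-just (sh u w) ≡ true
      some-shattered {u} {v} {w} u∈ v∈ w∈ p q r = go (tri u v w) refl (Tri.go-just u v w (big u) refl (big v) refl (big w) refl p q r)
        where
        go : ∀ m → tri u v w ≡ m → is-just m ≡ true →
             is-just (sh u v) ≡ true ⊎ is-just (sh v w) ≡ true ⊎ is-just (sh u w) ≡ true
        go (just (inj₁ x)) eq _ = inj₁ (firstJust-just (∈-++⁺ˡ (∈-map⁺ (λ z → getAB (tri u v z)) w∈)) (cong (λ m → is-just (getAB m)) eq))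
        go (just (inj₂ (inj₁ x))) eq _ = inj₂ (inj₁ (firstJust-just
          (∈-++⁺ʳ (map (λ z → getAB (tri v w z)) cols) (∈-++⁺ˡ (∈-map⁺ (λ z → getBC (tri z v w)) u∈))) (cong (λ m → is-just (getBC m)) eq)))
        go (just (inj₂ (inj₂ x))) eq _ = inj₂ (inj₂ (firstJust-just
          (∈-++⁺ʳ (map (λ z → getAB (tri u w z)) cols) (∈-++⁺ʳ (map (λ z → getBC (tri z u w)) cols) (∈-map⁺ (λ z → getAC (tri u z w)) v∈))) (cong (λ m → is-just (getAC m)) eq)))

      open Step W W-measurable sh public

      sparsePair smallLeft smallRight Bad : Relation₂
      sparsePair x y = not (dense (col x) (col y))
      smallLeft  x y = not (big (col x))
      smallRight x y = not (big (col y))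
      Bad x y = sparsePair x y ∨ (smallLeft x y ∨ smallRight x y)

      -- If no edge of a triangle is bad, its three cells are big and its three pairs dense. The
      -- trichotomy then shatters one of these pairs, and the edge in it is good. Edge-disjointness
      -- turns the count of triangles into a count of edges.
      N≤ : N ≤ edges Good + edges Bad
      N≤ = begin
        N                                ≡⟨ trans (∑-const triples 1) (*-identityʳ N) ⟨
        ∑ triples (λ _ → 1)              ≤⟨ ∑-mono triples (λ (x , y , z) → per-triple x y z) ⟩
        ∑ triples (λ t → φ Good t + φ Bad t) ≡⟨ ∑-+ triples (φ Good) (φ Bad) ⟩
        ∑ triples (φ Good) + ∑ triples (φ Bad) ≤⟨ +-mono-≤ (triples≤edges Good) (triples≤edges Bad) ⟩
        edges Good + edges Bad           ∎
        where
        open ≤-Reasoning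
        φ : Relation₂ → V × V × V → ℕ
        φ P (x , y , z) = 𝟙 (P x y) + (𝟙 (P y z) + 𝟙 (P x z))
        not-bad : ∀ x y → Bad x y ≡ false → dense (col x) (col y) ≡ true × big (col x) ≡ true × big (col y) ≡ true
        not-bad x y p with dense (col x) (col y) | big (col x) | big (col y)
        ... | true | true | true = refl , refl , refl
        some-true : ∀ g₁ g₂ g₃ b₁ b₂ b₃ → (b₁ ≡ false → b₂ ≡ false → b₃ ≡ false → g₁ ≡ true ⊎ g₂ ≡ true ⊎ g₃ ≡ true) →
                    1 ≤ 𝟙 g₁ + (𝟙 g₂ + 𝟙 g₃) + (𝟙 b₁ + (𝟙 b₂ + 𝟙 b₃))
        some-true true  _     _     _     _     _     _ = s≤s z≤n
        some-true false true  _     _     _     _     _ = s≤s z≤n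
        some-true false false true  _     _     _     _ = s≤s z≤n
        some-true false false false true  _     _     _ = s≤s z≤n
        some-true false false false false true  _     _ = s≤s z≤n
        some-true false false false false false true  _ = s≤s z≤n
        some-true false false false false false false h = case h refl refl refl of λ { (inj₁ ()) ; (inj₂ (inj₁ ())) ; (inj₂ (inj₂ ())) }
        per-triple : ∀ x y z → 1 ≤ φ Good (x , y , z) + φ Bad (x , y , z)
        per-triple x y z = some-true (Good x y) (Good y z) (Good x z) (Bad x y) (Bad y z) (Bad x z) λ p q r →
          let dxy , bx , by = not-bad x y p
              dyz , _  , bz = not-bad y z q
              dxz , _       = not-bad x z r
          in case some-shattered (col∈ x) (col∈ y) (col∈ z) bx by bz of λ
            { (inj₁ j) → inj₁ (∧-intro j dxy) ; (inj₂ (inj₁ j)) → inj₂ (inj₁ (∧-intro j dyz)) ; (inj₂ (inj₂ j)) → inj₂ (inj₂ (∧-intro j dxz)) }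

      sparse-bound : 2 ^ K * edges sparsePair ≤ M * M
      sparse-bound = begin
        2 ^ K * edges sparsePair ≡⟨ cong (2 ^ K *_) (edges-cells sparsePair) ⟩
        2 ^ K * ∑∑ (λ u w → edges (within u w sparsePair)) ≡⟨ ∑∑-* (2 ^ K) (λ u w → edges (within u w sparsePair)) ⟨
        ∑∑ (λ u w → 2 ^ K * edges (within u w sparsePair)) ≤⟨ ∑∑-mono per-cell ⟩
        ∑∑ (λ u w → area (within u w (λ _ _ → true))) ≡⟨ area-cells (λ _ _ → true) ⟨
        area (λ _ _ → true) ≤⟨ area≤ _ ⟩
        M * M ∎
        where
        open ≤-Reasoning
        per-cell : ∀ u w → 2 ^ K * edges (within u w sparsePair) ≤ area (within u w (λ _ _ → true))
        per-cell u w with dense u w in eq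
        ... | true = ≤-trans (≤-reflexive (trans (cong (2 ^ K *_) none) (*-zeroʳ (2 ^ K)))) z≤n
          where
          none : edges (within u w sparsePair) ≡ 0
          none = edges-none λ x y → trans (within-cong u w {sparsePair} {λ _ _ → false} (λ { x y refl refl → cong not eq }) x y)
                   (∧-zeroʳ ((cell u ⊗ cell w) x y))
        ... | false = ≤-trans (*-monoʳ-≤ (2 ^ K) (edges-mono {W′ = cell u ⊗ cell w} λ x y → proj₁ ∘ ∧-true))
            (≤-trans (<⇒≤ (≤ᵇ-false eq)) (area-mono λ x y p → ∧-intro p refl))

      -- There are 2^(length bs) cells, and each small one has fewer than `θ` vertices.
      small-bound : ∀ (P : Relation₂) S → area P ≡ count S * M → (∀ x → S x ≡ not (big (col x))) → 2 ^ K * edges P ≤ M * M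
      small-bound P S area-P S-small = begin
        2 ^ K * edges P                ≤⟨ *-monoʳ-≤ (2 ^ K) (edges≤area P) ⟩
        2 ^ K * area P                 ≡⟨ trans (cong (2 ^ K *_) area-P) (sym (*-assoc (2 ^ K) (count S) M)) ⟩
        2 ^ K * count S * M            ≤⟨ *-monoˡ-≤ M (≤-trans (*-monoʳ-≤ (2 ^ K) count-S)
                                            (≤-trans (*-monoʳ-≤ (2 ^ K) (*-monoˡ-≤ θ (^-monoʳ-≤ 2 bs-bound))) θ-small)) ⟩
        M * M                          ∎
        where
        open ≤-Reasoning
        count-S : count S ≤ 2 ^ length bs * θ
        count-S = begin
          count S                            ≡⟨ count-cells S ⟩
          ∑ cols (λ u → count (cell u ∩ S))  ≤⟨ ∑-mono cols per-cell ⟩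
          ∑ cols (λ u → θ)                   ≡⟨ trans (∑-const cols θ) (cong (_* θ) (length-words (length bs))) ⟩
          2 ^ length bs * θ                  ∎
          where
          per-cell : ∀ u → count (cell u ∩ S) ≤ θ
          per-cell u with big u in eq
          ... | false = ≤-trans (count-mono {cell u ∩ S} {cell u} λ x → proj₁ ∘ ∧-true) (<⇒≤ (≤ᵇ-false eq))
          ... | true = ≤-trans (≤-reflexive (trans (∑-cong vs λ x → cong 𝟙 (pt x)) (∑-zero vs))) z≤n
            where
            pt : ∀ x → cell u x ∧ S x ≡ false
            pt x with cell u x in c
            ... | false = refl
            ... | true  = trans (S-small x) (cong not (trans (cong big (≡ᴸ-sound _ _ c)) eq))

      bad-bound : 2 ^ K * edges Bad ≤ 3 * (M * M)
      bad-bound = begin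
        2 ^ K * edges Bad ≤⟨ *-monoʳ-≤ (2 ^ K) bad≤ ⟩
        2 ^ K * (edges sparsePair + (edges smallLeft + edges smallRight)) ≡⟨ trans (*-distribˡ-+ (2 ^ K) _ _) (cong (2 ^ K * edges sparsePair +_) (*-distribˡ-+ (2 ^ K) _ _)) ⟩
        2 ^ K * edges sparsePair + (2 ^ K * edges smallLeft + 2 ^ K * edges smallRight)
          ≤⟨ +-mono-≤ sparse-bound (+-mono-≤ (small-bound smallLeft S left (λ _ → refl)) (small-bound smallRight S right (λ _ → refl))) ⟩
        M * M + (M * M + M * M) ≡⟨ lem (M * M) ⟩
        3 * (M * M) ∎
        where
        open ≤-Reasoning
        lem : ∀ a → a + (a + a) ≡ 3 * a
        lem = solve-∀
        S : Subset
        S x = not (big (col x))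
        count-all : count (λ _ → true) ≡ M
        count-all = trans (∑-const vs 1) (*-identityʳ M)
        left : area smallLeft ≡ count S * M
        left = trans (area-cong λ x y → sym (∧-identityʳ (S x))) (trans (area-⊗ S (λ _ → true)) (cong (count S *_) count-all))
        right : area smallRight ≡ count S * M
        right = trans (area-⊗ (λ _ → true) S) (trans (*-comm _ (count S)) (cong (count S *_) count-all))
        ∧-∨ : ∀ p {b c} → p ∧ (b ∨ c) ≡ true → p ∧ b ≡ true ⊎ p ∧ c ≡ true
        ∧-∨ true = ∨-true
        bad≤ : edges Bad ≤ edges sparsePair + (edges smallLeft + edges smallRight)
        bad≤ = ≤-trans (area-≤+ {W₁ = λ x y → adj x y ∧ sparsePair x y} {W₂ = λ x y → adj x y ∧ (smallLeft x y ∨ smallRight x y)} λ x y → ∧-∨ (adj x y))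
          (+-monoʳ-≤ (edges sparsePair) (area-≤+ {W₁ = λ x y → adj x y ∧ smallLeft x y} {W₂ = λ x y → adj x y ∧ smallRight x y} λ x y → ∧-∨ (adj x y)))

      -- By `dense-triples` the bad edges number less than N / 2, so more than N / 2 edges are good.
      -- This doubles the factor 32 of `total-gain`.
      round-gain : 64 * Φ⁺ W + 64 * Φ⁻ W⁺ + 2 ^ K * N ≤ 64 * Φ⁺ W⁺ + 64 * Φ⁻ W
      round-gain = linear-≤ 0 (+-mono-≤ (+-mono-≤ (+-mono-≤ (*-monoʳ-≤ 2 total-gain) (*-monoʳ-≤ 2 (*-monoʳ-≤ (2 ^ K) N≤))) (*-monoʳ-≤ 2 bad-bound)) (<⇒≤ dense-triples))
        (lem (Φ⁺ W) (Φ⁻ W⁺) (Φ⁺ W⁺) (Φ⁻ W) (2 ^ K) N (edges Good) (edges Bad) (M * M))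
        where
        lem : ∀ p n⁺ p⁺ n k t g b m →
          64 * p + 64 * n⁺ + k * t + (2 * (32 * p⁺ + 32 * n) + 2 * (k * (g + b)) + 2 * (3 * m) + t * k) + 0
          ≡ 64 * p⁺ + 64 * n + (2 * (32 * p + 32 * n⁺ + k * g) + 2 * (k * t) + 2 * (k * b) + 6 * m)
        lem = solve-∀

    record State (r : ℕ) : Set where
      field
        bs           : List Subset
        bs-bound     : length bs ≤ bitBound K r
        W            : ℕ → Relation₂
        W-measurable : ∀ j → Measurable bs (W j)
        potential    : r * (2 ^ K * N) + 64 * Φ⁻ W ≤ 64 * Φ⁺ W

    initial : State 0
    initial = record
      { bs = [] ; bs-bound = z≤n ; W = λ _ _ _ → false ; W-measurable = λ _ _ _ → refl
      ; potential = ≤-trans (≤-reflexive (cong (64 *_) (trans (∑-cong levels λ j → trans (cong (2 ^ j *_) (area-none λ _ _ → refl)) (*-zeroʳ (2 ^ j)))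
                                                               (∑-zero levels)))) z≤n }

    next : ∀ {r} → r < R → State r → State (suc r)
    next {r} r< S = record
      { bs = bs⁺ ; bs-bound = ≤-trans length-bs⁺ (+-mono-≤ bs-bound (*-mono-≤ pow (*-monoˡ-≤ (2 * parts K) pow)))
      ; W = W⁺ ; W-measurable = W⁺-measurable
      ; potential = linear-≤ 0 (+-mono-≤ potential round-gain) (lem (r * (2 ^ K * N)) (2 ^ K * N) (Φ⁺ W) (Φ⁻ W) (Φ⁺ W⁺) (Φ⁻ W⁺)) }
      where
      open State S
      open Round bs (≤-trans bs-bound (bitBound-mono K (<⇒≤ r<))) W W-measurable
      pow : 2 ^ length bs ≤ 2 ^ bitBound K r
      pow = ^-monoʳ-≤ 2 bs-bound
      lem : ∀ rc c p n p⁺ n⁺ → c + rc + 64 * n⁺ + (64 * p + (64 * p⁺ + 64 * n)) + 0 ≡ 64 * p⁺ + (rc + 64 * n + (64 * p + 64 * n⁺ + c))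
      lem = solve-∀

    iterate : ∀ r → r ≤ R → State r
    iterate zero    _  = initial
    iterate (suc r) r< = next r< (iterate r (<⇒≤ r<))

    -- Each of the K + 1 levels contributes at most 2^K · 3N to `Φ⁺`, while every round adds 2^K N
    -- to 64 times the potential. This is the origin of 192 = 64 · 3.
    impossible : ⊥
    impossible = <⇒≱ (*-monoˡ-< (2 ^ K * N) ⦃ m*n≢0 (2 ^ K) N ⦃ m^n≢0 2 K ⦄ ⦃ >-nonZero N>0 ⦄ ⦄ R-large) bound
      where
      open State (iterate R ≤-refl)
      open ≤-Reasoning
      bound : R * (2 ^ K * N) ≤ 192 * suc K * (2 ^ K * N)
      bound = begin
        R * (2 ^ K * N)                                   ≤⟨ m≤m+n _ _ ⟩
        _                                                 ≤⟨ potential ⟩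
        64 * Φ⁺ W                                         ≤⟨ *-monoʳ-≤ 64 (∑-mono levels λ j → *-monoʳ-≤ (2 ^ K)
                                                             (≤-trans (edges-mono {W j} {λ _ _ → true} λ _ _ _ → refl) edges≤triples)) ⟩
        64 * ∑ levels (λ _ → 2 ^ K * (3 * N))            ≡⟨ cong (64 *_) (trans (∑-const levels (2 ^ K * (3 * N))) (cong (_* (2 ^ K * (3 * N))) (length-upTo (suc K)))) ⟩
        64 * (suc K * (2 ^ K * (3 * N)))                  ≡⟨ lem (suc K) (2 ^ K) N ⟩
        192 * suc K * (2 ^ K * N)                         ∎
        where
        lem : ∀ k p n → 64 * (k * (p * (3 * n))) ≡ 192 * k * (p * n)
        lem = solve-∀

  theorem : N * 2 ^ K ≤ 6 * (M * M)
  theorem = ≮⇒≥ Dense.impossible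

-- Towers and the iterated logarithm

n<2^n : ∀ n → n < 2 ^ n
n<2^n zero    = s≤s z≤n
n<2^n (suc n) = ≤-trans (s≤s (n<2^n n)) (≤-trans (+-monoˡ-≤ (2 ^ n) (m^n>0 2 n)) (≤-reflexive (cong (2 ^ n +_) (sym (+-identityʳ (2 ^ n))))))

-- The recursion starts from 0 rather than 1, so that `tower≤` holds for p = 0 too.
tower : ℕ → ℕ
tower zero    = 0
tower (suc m) = 2 ^ tower m

n≤tower : ∀ n → n ≤ tower n
n≤tower zero    = z≤n
n≤tower (suc n) = ≤-trans (n<2^n n) (^-monoʳ-≤ 2 (n≤tower n))

tower-mono : ∀ {m n} → m ≤ n → tower m ≤ tower n
tower-mono z≤n       = z≤n
tower-mono (s≤s m≤n) = ^-monoʳ-≤ 2 (tower-mono m≤n)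

2^⌊log₂n⌋≤n : ∀ n → 0 < n → 2 ^ ⌊log₂ n ⌋ ≤ n
2^⌊log₂n⌋≤n = <-rec (λ n → 0 < n → 2 ^ ⌊log₂ n ⌋ ≤ n) go
  where
  go : ∀ n → (∀ {m} → m < n → 0 < m → 2 ^ ⌊log₂ m ⌋ ≤ m) → 0 < n → 2 ^ ⌊log₂ n ⌋ ≤ n
  go (suc zero)      rec _ = ≤-refl
  go n@(suc (suc k)) rec _ = begin
    2 ^ ⌊log₂ n ⌋                    ≤⟨ ^-monoʳ-≤ 2 (m≤n+m∸n ⌊log₂ n ⌋ 1) ⟩
    2 ^ (1 + (⌊log₂ n ⌋ ∸ 1))        ≡⟨ cong (λ e → 2 ^ suc e) (sym (⌊log₂⌊n/2⌋⌋≡⌊log₂n⌋∸1 n)) ⟩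
    2 * 2 ^ ⌊log₂ ⌊ n /2⌋ ⌋          ≤⟨ *-monoʳ-≤ 2 (rec (⌊n/2⌋<n (suc k)) (s≤s z≤n)) ⟩
    2 * ⌊ n /2⌋                      ≡⟨ cong (⌊ n /2⌋ +_) (+-identityʳ ⌊ n /2⌋) ⟩
    ⌊ n /2⌋ + ⌊ n /2⌋                ≤⟨ +-monoʳ-≤ ⌊ n /2⌋ (⌊n/2⌋≤⌈n/2⌉ n) ⟩
    ⌊ n /2⌋ + ⌈ n /2⌉                ≡⟨ ⌊n/2⌋+⌈n/2⌉≡n n ⟩
    n                                ∎
    where open ≤-Reasoning

tower≤ : ∀ m p → m ≤ log* p → tower m ≤ p
tower≤ m p = fuel m p p
  where
  fuel : ∀ m f x → m ≤ log*-fuel f x → tower m ≤ x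
  fuel zero    f       x               _ = z≤n
  fuel (suc m) (suc f) (suc (suc x)) (s≤s h) =
    ≤-trans (^-monoʳ-≤ 2 (fuel m f ⌊log₂ suc (suc x) ⌋ h)) (2^⌊log₂n⌋≤n (suc (suc x)) (s≤s z≤n))

-- Growth of the partition and choice of the threshold

module Size (K : ℕ) where

  E : ℕ
  E = (K + 2) * 2 ^ suc K

  parts≡ : parts K ≡ 2 ^ (2 + E)
  parts≡ = begin
    4 * (2 * 2 ^ suc K) ^ (2 ^ suc K)        ≡⟨ cong (4 *_) (^-*-assoc 2 (2 + K) (2 ^ suc K)) ⟩
    4 * 2 ^ ((2 + K) * 2 ^ suc K)            ≡⟨ cong (λ k → 4 * 2 ^ (k * 2 ^ suc K)) (+-comm 2 K) ⟩
    4 * 2 ^ E                                ≡⟨ ^-distribˡ-+-* 2 2 E ⟨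
    2 ^ (2 + E)                              ∎
    where open ≡-Reasoning

  E≤ : ∀ b → E ≤ 2 ^ (b + (2 * K + 2))
  E≤ b = begin
    (K + 2) * 2 ^ suc K           ≤⟨ *-monoˡ-≤ (2 ^ suc K) (≤-trans (≤-reflexive (+-comm K 2)) (n<2^n (suc K))) ⟩
    2 ^ suc K * 2 ^ suc K         ≡⟨ ^-distribˡ-+-* 2 (suc K) (suc K) ⟨
    2 ^ (suc K + suc K)           ≡⟨ cong (2 ^_) (lem K) ⟩
    2 ^ (2 * K + 2)               ≤⟨ ^-monoʳ-≤ 2 (m≤n+m _ b) ⟩
    2 ^ (b + (2 * K + 2))         ∎
    where
    open ≤-Reasoning
    lem : ∀ k → suc k + suc k ≡ 2 * k + 2
    lem = solve-∀

  -- The offset makes one refinement cost just two exponentials in `y`. In it, 2K + 2 absorbs the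
  -- exponent `E` of the number of pieces and 8 absorbs the constant 7 below.
  y : ℕ → ℕ
  y b = b + (2 * K + 10)

  -- The exponents of all quantities of interest are at most 7 · 2^(b + 2K + 2) ≤ 2^(y b).
  7u≤ : ∀ b → 7 * 2 ^ (b + (2 * K + 2)) ≤ 2 ^ y b
  7u≤ b = begin
    7 * 2 ^ (b + (2 * K + 2))     ≤⟨ *-monoˡ-≤ (2 ^ (b + (2 * K + 2))) (≤ᵇ-true {7} {256} refl) ⟩
    2 ^ 8 * 2 ^ (b + (2 * K + 2)) ≡⟨ ^-distribˡ-+-* 2 8 (b + (2 * K + 2)) ⟨
    2 ^ (8 + (b + (2 * K + 2)))   ≡⟨ cong (2 ^_) (lem b K) ⟩
    2 ^ y b                       ∎
    where
    open ≤-Reasoning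
    lem : ∀ b k → 8 + (b + (2 * k + 2)) ≡ b + (2 * k + 10)
    lem = solve-∀

  exponent≤ : ∀ b → 10 + 4 * K + 2 * b + E ≤ 2 ^ y b
  exponent≤ b = ≤-trans (linear-≤ 0 (+-mono-≤ (+-mono-≤ (*-monoʳ-≤ 2 (n<2^n (b + (2 * K + 2)))) (*-monoʳ-≤ 4 (m^n>0 2 (b + (2 * K + 2))))) (E≤ b))
      (lem K b E (2 ^ (b + (2 * K + 2))))) (7u≤ b)
    where
    lem : ∀ k b e u → 10 + 4 * k + 2 * b + e + (2 * u + 4 * u + u) + 0 ≡ 7 * u + (2 * suc (b + (2 * k + 2)) + 4 * 1 + e)
    lem = solve-∀

  step : ℕ → ℕ
  step b = b + 2 ^ b * (2 ^ b * (2 * parts K))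

  step≡ : ∀ b → step b ≡ b + 2 ^ (2 * b + 3 + E)
  step≡ b = cong (b +_) (begin
    2 ^ b * (2 ^ b * (2 * parts K))          ≡⟨ cong (λ k → 2 ^ b * (2 ^ b * (2 * k))) parts≡ ⟩
    2 ^ b * (2 ^ b * 2 ^ (3 + E))            ≡⟨ cong (2 ^ b *_) (^-distribˡ-+-* 2 b (3 + E)) ⟨
    2 ^ b * 2 ^ (b + (3 + E))                ≡⟨ ^-distribˡ-+-* 2 b (b + (3 + E)) ⟨
    2 ^ (b + (b + (3 + E)))                  ≡⟨ cong (2 ^_) (lem b E) ⟩
    2 ^ (2 * b + 3 + E)                      ∎)
    where
    open ≡-Reasoning
    lem : ∀ b e → b + (b + (3 + e)) ≡ 2 * b + 3 + e
    lem = solve-∀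

  y-step : ∀ b → y (step b) ≤ 2 ^ (2 ^ y b)
  y-step b = begin
    step b + (2 * K + 10)                       ≡⟨ cong (_+ (2 * K + 10)) (step≡ b) ⟩
    b + 2 ^ c + (2 * K + 10)                    ≡⟨ lem b (2 ^ c) (2 * K + 10) ⟩
    -- With w + 1 = 2 ^ y b, both summands are at most 2 ^ w, so the sum fits under 2 ^ (w + 1).
    y b + 2 ^ c                                 ≤⟨ +-mono-≤ (≤-trans (≤-pred (≤-trans (n<2^n (y b)) (≤-reflexive (sym 1+w)))) (<⇒≤ (n<2^n w)))
                                                            (^-monoʳ-≤ 2 (≤-pred (≤-trans c<  (≤-reflexive (sym 1+w))))) ⟩
    2 ^ w + 2 ^ w                               ≡⟨ cong (2 ^ w +_) (+-identityʳ (2 ^ w)) ⟨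
    2 ^ suc w                                   ≡⟨ cong (2 ^_) 1+w ⟩
    2 ^ (2 ^ y b)                               ∎
    where
    open ≤-Reasoning
    c w : ℕ
    c = 2 * b + 3 + E
    w = pred (2 ^ y b)
    1+w : suc w ≡ 2 ^ y b
    1+w = suc-pred (2 ^ y b) ⦃ m^n≢0 2 (y b) ⦄
    lem : ∀ b p k → b + p + k ≡ b + k + p
    lem = solve-∀
    c< : suc c ≤ 2 ^ y b
    c< = ≤-trans (≤-trans (m≤m+n (suc c) (6 + 4 * K)) (≤-reflexive (lem₂ b E K))) (exponent≤ b)
      where
      lem₂ : ∀ b e k → suc (2 * b + 3 + e) + (6 + 4 * k) ≡ 10 + 4 * k + 2 * b + e
      lem₂ = solve-∀

  y-bitBound : ∀ r → y (bitBound K r) ≤ tower (r * 2 + (2 * K + 10))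
  y-bitBound zero    = n≤tower (2 * K + 10)
  y-bitBound (suc r) = ≤-trans (y-step (bitBound K r)) (^-monoʳ-≤ 2 (^-monoʳ-≤ 2 (y-bitBound r)))

  rounds : ℕ
  rounds = suc (192 * suc K)

  B : ℕ
  B = bitBound K rounds

  -- `θ` is the largest value that the smallness condition allows, the quotient of M by D = 2^K ·
  -- 2^B. Since M < 2 D θ, the lower bound on θ² follows when 4 D² times its left side is at most
  -- M². The factor 20 is this 4 times the 5 of 5M, the bound on the triangles at a vertex.
  exists-θ : ∀ M → tower (400 * suc K) ≤ M → ∃ λ θ → 0 < θ ×
             2 * parts K * (2 ^ suc K * (2 ^ suc K * (5 * M))) ≤ θ * θ × 2 ^ K * (2 ^ B * θ) ≤ M
  exists-θ M M-large = θ , θ>0 , *-cancelˡ-≤ (2 * D * (2 * D)) ⦃ m*n≢0 (2 * D) (2 * D) ⦃ 2D≢0 ⦄ ⦃ 2D≢0 ⦄ ⦄ (begin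
      2 * D * (2 * D) * (2 * parts K * (2 ^ suc K * (2 ^ suc K * (5 * M)))) ≡⟨ lem₁ D (parts K) (2 ^ suc K) M ⟩
      20 * (D * D * (2 * parts K * (2 ^ suc K * 2 ^ suc K))) * M          ≤⟨ *-mono-≤ (≤-trans M-enough M-large) (<⇒≤ M<) ⟩
      M * (2 * D * θ)                                                      ≤⟨ *-monoˡ-≤ (2 * D * θ) (<⇒≤ M<) ⟩
      2 * D * θ * (2 * D * θ)                                              ≡⟨ lem₂ D θ ⟩
      2 * D * (2 * D) * (θ * θ)                                            ∎)
    , ≤-trans (≤-reflexive (trans (sym (*-assoc (2 ^ K) (2 ^ B) θ)) (*-comm D θ))) (m/n*n≤m M D)
    where
    open ≤-Reasoning
    D : ℕ
    D = 2 ^ K * 2 ^ B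
    instance
      D≢0 : NonZero D
      D≢0 = m*n≢0 (2 ^ K) (2 ^ B) ⦃ m^n≢0 2 K ⦄ ⦃ m^n≢0 2 B ⦄
      2D≢0 : NonZero (2 * D)
      2D≢0 = m*n≢0 2 D
    θ : ℕ
    θ = M / D
    lem₁ : ∀ d q l m → 2 * d * (2 * d) * (2 * q * (l * (l * (5 * m)))) ≡ 20 * (d * d * (2 * q * (l * l))) * m
    lem₁ = solve-∀
    lem₂ : ∀ d t → 2 * d * t * (2 * d * t) ≡ 2 * d * (2 * d) * (t * t)
    lem₂ = solve-∀
    powers : D * D * (2 * parts K * (2 ^ suc K * 2 ^ suc K)) ≡ 2 ^ (5 + 4 * K + 2 * B + E)
    powers = trans (cong (λ q → D * D * (2 * q * (2 ^ suc K * 2 ^ suc K))) parts≡)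
      (trans (cong₂ (λ d l → d * d * (2 ^ (3 + E) * l)) (sym (^-distribˡ-+-* 2 K B)) (sym (^-distribˡ-+-* 2 (suc K) (suc K))))
      (trans (cong₂ _*_ (sym (^-distribˡ-+-* 2 (K + B) (K + B))) (sym (^-distribˡ-+-* 2 (3 + E) (suc K + suc K))))
      (trans (sym (^-distribˡ-+-* 2 (K + B + (K + B)) (3 + E + (suc K + suc K)))) (cong (2 ^_) (lem K B E)))))
      where
      lem : ∀ k b e → k + b + (k + b) + (3 + e + (suc k + suc k)) ≡ 5 + 4 * k + 2 * b + e
      lem = solve-∀
    M-enough : 20 * (D * D * (2 * parts K * (2 ^ suc K * 2 ^ suc K))) ≤ tower (400 * suc K)
    M-enough = begin
      20 * (D * D * (2 * parts K * (2 ^ suc K * 2 ^ suc K)))  ≡⟨ cong (20 *_) powers ⟩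
      20 * 2 ^ (5 + 4 * K + 2 * B + E)                        ≤⟨ *-monoˡ-≤ (2 ^ (5 + 4 * K + 2 * B + E)) (≤ᵇ-true {20} {32} refl) ⟩
      2 ^ 5 * 2 ^ (5 + 4 * K + 2 * B + E)                     ≡⟨ ^-distribˡ-+-* 2 5 (5 + 4 * K + 2 * B + E) ⟨
      2 ^ (5 + (5 + 4 * K + 2 * B + E))                       ≤⟨ ^-monoʳ-≤ 2 (exponent≤ B) ⟩
      2 ^ (2 ^ y B)                                           ≤⟨ ^-monoʳ-≤ 2 (^-monoʳ-≤ 2 (y-bitBound rounds)) ⟩
      -- Two levels per refinement with 192 (K + 1) + 1 refinements, the starting offset 2K + 10 and
      -- two final exponentials add up to 386K + 398.
      tower (2 + (rounds * 2 + (2 * K + 10)))                 ≤⟨ tower-mono (≤-trans (m≤m+n (2 + (rounds * 2 + (2 * K + 10))) (14 * K + 2)) (≤-reflexive (lem K))) ⟩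
      tower (400 * suc K)                                     ∎
      where
      lem : ∀ k → 2 + (suc (192 * suc k) * 2 + (2 * k + 10)) + (14 * k + 2) ≡ 400 * suc k
      lem = solve-∀
    D≤M : D ≤ M
    D≤M = begin
      D                                                       ≡⟨ ^-distribˡ-+-* 2 K B ⟨
      2 ^ (K + B)                                             ≤⟨ ^-monoʳ-≤ 2 (≤-trans (m≤m+n (K + B) (5 + 3 * K + B + E)) (≤-reflexive (lem K B E))) ⟩
      2 ^ (5 + 4 * K + 2 * B + E)                             ≡⟨ powers ⟨
      D * D * (2 * parts K * (2 ^ suc K * 2 ^ suc K))         ≤⟨ m≤n*m _ 20 ⟩
      20 * (D * D * (2 * parts K * (2 ^ suc K * 2 ^ suc K)))  ≤⟨ ≤-trans M-enough M-large ⟩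
      M                                                       ∎
      where
      lem : ∀ k b e → k + b + (5 + 3 * k + b + e) ≡ 5 + 4 * k + 2 * b + e
      lem = solve-∀
    θ>0 : 0 < θ
    θ>0 = m≥n⇒m/n>0 D≤M
    M< : M < 2 * D * θ
    M< = begin-strict
      M                ≡⟨ m≡m%n+[m/n]*n M D ⟩
      M % D + θ * D    <⟨ +-monoˡ-< (θ * D) (m%n<n M D) ⟩
      D + θ * D        ≤⟨ +-monoˡ-≤ (θ * D) (m≤n*m D θ ⦃ >-nonZero θ>0 ⦄) ⟩
      θ * D + θ * D    ≡⟨ lem D θ ⟩
      2 * D * θ        ∎
      where
      lem : ∀ d t → t * d + t * d ≡ 2 * d * t
      lem = solve-∀

-- Bridges

lookup-injective : ∀ {A : Set} {xs : List A} → Unique xs → ∀ {i j} → lookup xs i ≡ lookup xs j → i ≡ j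
lookup-injective {xs = x ∷ xs} (x≢ ∷ u) {fzero}  {fzero}  _  = refl
lookup-injective {xs = x ∷ xs} (x≢ ∷ u) {fzero}  {fsuc j} eq = ⊥-elim (All.lookup x≢ (∈-lookup j) eq)
lookup-injective {xs = x ∷ xs} (x≢ ∷ u) {fsuc i} {fzero}  eq = ⊥-elim (All.lookup x≢ (∈-lookup i) (sym eq))
lookup-injective {xs = x ∷ xs} (x≢ ∷ u) {fsuc i} {fsuc j} eq = cong fsuc (lookup-injective u eq)

module Geometry {n : ℕ} (S : PathSystem n) (free : BridgeFree S) where

  Node Path : Set
  Node = Fin n
  Path = Fin (numPaths S)

  _∈ₚ_ : Node → Path → Set
  v ∈ₚ π = v ∈ path S π

  _∈ₚ?_ : ∀ v π → Dec (v ∈ₚ π)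
  v ∈ₚ? π = member? _≟ᶠ_ v (path S π)

  unique : ∀ π → Unique (path S π)
  unique π = All.lookup (distinct S) (∈-lookup π)

  _≺[_]_ : Node → Path → Node → Set
  v ≺[ π ] w = Precedes (path S π) v w

  ≺-∈ˡ : ∀ {π v w} → v ≺[ π ] w → v ∈ₚ π
  ≺-∈ˡ {π} (i , _ , _ , eq , _) = subst (_∈ path S π) eq (∈-lookup i)

  ≺-∈ʳ : ∀ {π v w} → v ≺[ π ] w → w ∈ₚ π
  ≺-∈ʳ {π} (_ , j , _ , _ , eq) = subst (_∈ path S π) eq (∈-lookup j)

  ≺⇒≢ : ∀ {π v w} → v ≺[ π ] w → v ≢ w
  ≺⇒≢ {π} (i , j , i<j , p , q) v≡w =
    <⇒≢ i<j (cong toℕ (lookup-injective (unique π) (trans p (trans v≡w (sym q)))))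

  ≺-trans : ∀ {π u v w} → u ≺[ π ] v → v ≺[ π ] w → u ≺[ π ] w
  ≺-trans {π} (i , j , i<j , p , q) (j′ , k , j′<k , q′ , r) =
    i , k , <-trans i<j (subst (λ j → toℕ j < toℕ k) (lookup-injective (unique π) (trans q′ (sym q))) j′<k) , p , r

  ≺-total : ∀ {π v w} → v ∈ₚ π → w ∈ₚ π → v ≢ w → v ≺[ π ] w ⊎ w ≺[ π ] v
  ≺-total {π} v∈ w∈ v≢w with <-cmp (toℕ (index v∈)) (toℕ (index w∈))
  ... | tri< i<j _ _ = inj₁ (index v∈ , index w∈ , i<j , sym (lookup-index v∈) , sym (lookup-index w∈))
  ... | tri> _ _ j<i = inj₂ (index w∈ , index v∈ , j<i , sym (lookup-index w∈) , sym (lookup-index v∈))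
  ... | tri≈ _ i≡j _ = ⊥-elim (v≢w (trans (lookup-index v∈) (trans (cong (lookup (path S π)) (toℕ-injective i≡j)) (sym (lookup-index w∈)))))

  no-2-bridge : ∀ {f₁ f₂ v₁ v₂} → f₁ ≢ f₂ → v₁ ≺[ f₁ ] v₂ → v₁ ≺[ f₂ ] v₂ → ⊥
  no-2-bridge {f₁} {f₂} {v₁} {v₂} f≢ p c = free 0
    ( lookup (v₁ ∷ v₂ ∷ []) , lookup (f₁ ∷ f₂ ∷ [])
    , lookup-injective ((≺⇒≢ p ∷ []) ∷ [] ∷ []) , lookup-injective ((f≢ ∷ []) ∷ [] ∷ [])
    , (λ { fzero → p }) , c )

  no-3-bridge : ∀ {f₁ f₂ f₃ v₁ v₂ v₃} → Unique (f₁ ∷ f₂ ∷ f₃ ∷ []) →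
                v₁ ≺[ f₁ ] v₂ → v₂ ≺[ f₂ ] v₃ → v₁ ≺[ f₃ ] v₃ → ⊥
  no-3-bridge {f₁} {f₂} {f₃} {v₁} {v₂} {v₃} fs p q c = free 1
    ( lookup (v₁ ∷ v₂ ∷ v₃ ∷ []) , lookup (f₁ ∷ f₂ ∷ f₃ ∷ [])
    , lookup-injective ((≺⇒≢ p ∷ ≺⇒≢ c ∷ []) ∷ (≺⇒≢ q ∷ []) ∷ [] ∷ []) , lookup-injective fs
    , (λ { fzero → p ; (fsuc fzero) → q }) , c )

  no-4-bridge : ∀ {f₁ f₂ f₃ f₄ v₁ v₂ v₃ v₄} → Unique (f₁ ∷ f₂ ∷ f₃ ∷ f₄ ∷ []) → v₁ ≢ v₃ → v₂ ≢ v₄ →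
                v₁ ≺[ f₁ ] v₂ → v₂ ≺[ f₂ ] v₃ → v₃ ≺[ f₃ ] v₄ → v₁ ≺[ f₄ ] v₄ → ⊥
  no-4-bridge {f₁} {f₂} {f₃} {f₄} {v₁} {v₂} {v₃} {v₄} fs n₁₃ n₂₄ p q r c = free 2
    ( lookup (v₁ ∷ v₂ ∷ v₃ ∷ v₄ ∷ []) , lookup (f₁ ∷ f₂ ∷ f₃ ∷ f₄ ∷ [])
    , lookup-injective ((≺⇒≢ p ∷ n₁₃ ∷ ≺⇒≢ c ∷ []) ∷ (≺⇒≢ q ∷ n₂₄ ∷ []) ∷ (≺⇒≢ r ∷ []) ∷ [] ∷ []) , lookup-injective fs
    , (λ { fzero → p ; (fsuc fzero) → q ; (fsuc (fsuc fzero)) → r }) , c )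

  no-5-bridge : ∀ {f₁ f₂ f₃ f₄ f₅ v₁ v₂ v₃ v₄ v₅} → Unique (f₁ ∷ f₂ ∷ f₃ ∷ f₄ ∷ f₅ ∷ []) →
                v₁ ≢ v₃ → v₁ ≢ v₄ → v₂ ≢ v₄ → v₂ ≢ v₅ → v₃ ≢ v₅ →
                v₁ ≺[ f₁ ] v₂ → v₂ ≺[ f₂ ] v₃ → v₃ ≺[ f₃ ] v₄ → v₄ ≺[ f₄ ] v₅ → v₁ ≺[ f₅ ] v₅ → ⊥
  no-5-bridge {f₁} {f₂} {f₃} {f₄} {f₅} {v₁} {v₂} {v₃} {v₄} {v₅} fs n₁₃ n₁₄ n₂₄ n₂₅ n₃₅ p q r s c = free 3
    ( lookup (v₁ ∷ v₂ ∷ v₃ ∷ v₄ ∷ v₅ ∷ []) , lookup (f₁ ∷ f₂ ∷ f₃ ∷ f₄ ∷ f₅ ∷ [])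
    , lookup-injective ((≺⇒≢ p ∷ n₁₃ ∷ n₁₄ ∷ ≺⇒≢ c ∷ []) ∷ (≺⇒≢ q ∷ n₂₄ ∷ n₂₅ ∷ []) ∷ (≺⇒≢ r ∷ n₃₅ ∷ []) ∷ (≺⇒≢ s ∷ []) ∷ [] ∷ [])
    , lookup-injective fs
    , (λ { fzero → p ; (fsuc fzero) → q ; (fsuc (fsuc fzero)) → r ; (fsuc (fsuc (fsuc fzero))) → s }) , c )

  MeetAgain : Node → Path → Path → Set
  MeetAgain v π σ = ∃ λ u → u ≢ v × u ∈ₚ π × u ∈ₚ σ

  MeetAgain? : ∀ v π σ → Dec (MeetAgain v π σ)
  MeetAgain? v π σ = any? λ u → ¬? (u ≟ᶠ v) ×-dec (u ∈ₚ? π) ×-dec (u ∈ₚ? σ)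

  opposite : ∀ {π σ u v} → π ≢ σ → u ≺[ π ] v → u ∈ₚ σ → v ∈ₚ σ → v ≺[ σ ] u
  opposite π≢σ p u∈ v∈ = case ≺-total u∈ v∈ (≺⇒≢ p) of λ
    { (inj₁ q) → ⊥-elim (no-2-bridge π≢σ p q) ; (inj₂ q) → q }

  -- Both σ and τ must run backwards, from v to u and from v to w. The piece of π between u and w
  -- then completes a 3-bridge, closed by the companion through the later of the two nodes.
  one-before : ∀ {v π σ τ u w} → π ≢ σ → π ≢ τ → σ ≢ τ → v ∈ₚ σ → v ∈ₚ τ →
               u ≺[ π ] v → w ≺[ π ] v → u ∈ₚ σ → w ∈ₚ τ → ⊥
  one-before {u = u} {w} π≢σ π≢τ σ≢τ vσ vτ u≺v w≺v uσ wτ with u ≟ᶠ w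
  ... | yes refl = no-2-bridge σ≢τ (opposite π≢σ u≺v uσ vσ) (opposite π≢τ w≺v wτ vτ)
  ... | no u≢w with ≺-total (≺-∈ˡ u≺v) (≺-∈ˡ w≺v) u≢w
  ...   | inj₁ u≺w = no-3-bridge ((≢-sym π≢σ ∷ σ≢τ ∷ []) ∷ (π≢τ ∷ []) ∷ [] ∷ []) (opposite π≢σ u≺v uσ vσ) u≺w (opposite π≢τ w≺v wτ vτ)
  ...   | inj₂ w≺u = no-3-bridge ((≢-sym π≢τ ∷ ≢-sym σ≢τ ∷ []) ∷ (π≢σ ∷ []) ∷ [] ∷ []) (opposite π≢τ w≺v wτ vτ) w≺u (opposite π≢σ u≺v uσ vσ)

  one-after : ∀ {v π σ τ u w} → π ≢ σ → π ≢ τ → σ ≢ τ → v ∈ₚ σ → v ∈ₚ τ →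
              v ≺[ π ] u → v ≺[ π ] w → u ∈ₚ σ → w ∈ₚ τ → ⊥
  one-after {u = u} {w} π≢σ π≢τ σ≢τ vσ vτ v≺u v≺w uσ wτ with u ≟ᶠ w
  ... | yes refl = no-2-bridge σ≢τ (opposite π≢σ v≺u vσ uσ) (opposite π≢τ v≺w vτ wτ)
  ... | no u≢w with ≺-total (≺-∈ʳ v≺u) (≺-∈ʳ v≺w) u≢w
  ...   | inj₁ u≺w = no-3-bridge ((π≢τ ∷ π≢σ ∷ []) ∷ (≢-sym σ≢τ ∷ []) ∷ [] ∷ []) u≺w (opposite π≢τ v≺w vτ wτ) (opposite π≢σ v≺u vσ uσ)
  ...   | inj₂ w≺u = no-3-bridge ((π≢σ ∷ π≢τ ∷ []) ∷ (σ≢τ ∷ []) ∷ [] ∷ []) w≺u (opposite π≢σ v≺u vσ uσ) (opposite π≢τ v≺w vτ wτ)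

  -- Of three further meeting nodes on π, two lie on the same side of v.
  two-partners : ∀ {v π} → v ∈ₚ π → ∀ {σ₁ σ₂ σ₃} → π ≢ σ₁ → π ≢ σ₂ → π ≢ σ₃ → Unique (σ₁ ∷ σ₂ ∷ σ₃ ∷ []) →
                 v ∈ₚ σ₁ → v ∈ₚ σ₂ → v ∈ₚ σ₃ → MeetAgain v π σ₁ → MeetAgain v π σ₂ → MeetAgain v π σ₃ → ⊥
  two-partners vπ d₁ d₂ d₃ ((d₁₂ ∷ d₁₃ ∷ []) ∷ (d₂₃ ∷ []) ∷ [] ∷ []) v₁ v₂ v₃ (u₁ , n₁ , p₁ , q₁) (u₂ , n₂ , p₂ , q₂) (u₃ , n₃ , p₃ , q₃)
    with ≺-total p₁ vπ n₁ | ≺-total p₂ vπ n₂ | ≺-total p₃ vπ n₃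
  ... | inj₁ a | inj₁ b | _      = one-before d₁ d₂ d₁₂ v₁ v₂ a b q₁ q₂
  ... | inj₂ a | inj₂ b | _      = one-after d₁ d₂ d₁₂ v₁ v₂ a b q₁ q₂
  ... | inj₁ a | inj₂ b | inj₁ c = one-before d₁ d₃ d₁₃ v₁ v₃ a c q₁ q₃
  ... | inj₁ a | inj₂ b | inj₂ c = one-after d₂ d₃ d₂₃ v₂ v₃ b c q₂ q₃
  ... | inj₂ a | inj₁ b | inj₁ c = one-before d₂ d₃ d₂₃ v₂ v₃ b c q₂ q₃
  ... | inj₂ a | inj₁ b | inj₂ c = one-after d₁ d₃ d₁₃ v₁ v₃ a c q₁ q₃

  -- Paths with exactly one common node

  record Crossing (π σ : Path) : Set where
    field
      node  : Node
      left  : node ∈ₚ π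
      right : node ∈ₚ σ
      only  : ∀ u → u ∈ₚ π → u ∈ₚ σ → u ≡ node
      π≢σ   : π ≢ σ

  open Crossing

  flip-crossing : ∀ {π σ} → Crossing π σ → Crossing σ π
  flip-crossing c = record { node = node c ; left = right c ; right = left c ; only = λ u p q → only c u q p ; π≢σ = ≢-sym (π≢σ c) }

  -- In any other order the three nodes form a 3-bridge.
  triangle-cyclic : ∀ {a b c} (ab : Crossing a b) (bc : Crossing b c) (ac : Crossing a c) →
                    node ab ≺[ b ] node bc → node bc ≺[ c ] node ac × node ac ≺[ a ] node ab
  triangle-cyclic {a} {b} {c} ab bc ac p = bc≺ac , ac≺ab
    where
    ac≢ab : node ac ≢ node ab
    ac≢ab eq = ≺⇒≢ p (trans (sym eq) (only bc (node ac) (subst (_∈ₚ b) (sym eq) (right ab)) (right ac)))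
    ac≢bc : node ac ≢ node bc
    ac≢bc eq = ≺⇒≢ p (sym (trans (sym eq) (only ab (node ac) (left ac) (subst (_∈ₚ b) (sym eq) (left bc)))))
    bc≺ac : node bc ≺[ c ] node ac
    bc≺ac with ≺-total (right bc) (right ac) (≢-sym ac≢bc)
    ... | inj₁ q = q
    ... | inj₂ q with ≺-total (left ac) (left ab) ac≢ab
    ...   | inj₁ r = ⊥-elim (no-3-bridge ((π≢σ ab ∷ π≢σ ac ∷ []) ∷ (π≢σ bc ∷ []) ∷ [] ∷ []) r p q)
    ...   | inj₂ r = ⊥-elim (no-3-bridge ((π≢σ ac ∷ π≢σ ab ∷ []) ∷ (≢-sym (π≢σ bc) ∷ []) ∷ [] ∷ []) r q p)
    ac≺ab : node ac ≺[ a ] node ab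
    ac≺ab with ≺-total (left ac) (left ab) ac≢ab
    ... | inj₁ q = q
    ... | inj₂ q = ⊥-elim (no-3-bridge ((π≢σ bc ∷ ≢-sym (π≢σ ab) ∷ []) ∷ (≢-sym (π≢σ ac) ∷ []) ∷ [] ∷ []) p bc≺ac q)

  -- The contradiction is the 5-bridge ac → a′c → a′b → bc′ → ac′ closed up along a.
  no-zigzag : ∀ {a a′ b c c′} (ab : Crossing a b) (a′b : Crossing a′ b) (bc : Crossing b c) (bc′ : Crossing b c′)
              (ac : Crossing a c) (a′c : Crossing a′ c) (ac′ : Crossing a c′) →
              node ab ≺[ b ] node a′b → node a′b ≺[ b ] node bc → node bc ≺[ b ] node bc′ → ⊥
  no-zigzag {a} {a′} {b} {c} {c′} ab a′b bc bc′ ac a′c ac′ p₁ p₂ p₃ =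
    no-5-bridge ((≢-sym (π≢σ a′c) ∷ ≢-sym (π≢σ bc) ∷ c≢c′ ∷ ≢-sym (π≢σ ac) ∷ []) ∷ (π≢σ a′b ∷ a′≢c′ ∷ ≢-sym a≢a′ ∷ [])
                 ∷ (π≢σ bc′ ∷ ≢-sym (π≢σ ab) ∷ []) ∷ (≢-sym (π≢σ ac′) ∷ []) ∷ [] ∷ [])
      ac≢a′b ac≢bc′ a′c≢bc′ a′c≢ac′ a′b≢ac′ ac≺a′c a′c≺a′b (≺-trans p₂ p₃) bc′≺ac′ ac≺ac′
    where
    at : ∀ {u v : Node} {π} → u ≡ v → v ∈ₚ π → u ∈ₚ π
    at eq v∈ = subst (_∈ₚ _) (sym eq) v∈
    bc≺ac : node bc ≺[ c ] node ac
    bc≺ac = proj₁ (triangle-cyclic ab bc ac (≺-trans p₁ p₂))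
    ac≺ab : node ac ≺[ a ] node ab
    ac≺ab = proj₂ (triangle-cyclic ab bc ac (≺-trans p₁ p₂))
    a′c≺a′b : node a′c ≺[ a′ ] node a′b
    a′c≺a′b = proj₂ (triangle-cyclic a′b bc a′c p₂)
    bc′≺ac′ : node bc′ ≺[ c′ ] node ac′
    bc′≺ac′ = proj₁ (triangle-cyclic ab bc′ ac′ (≺-trans (≺-trans p₁ p₂) p₃))
    node≡ : ∀ {π σ ρ} (x : Crossing π ρ) (y : Crossing σ ρ) → π ≡ σ → node x ≡ node y
    node≡ x y refl = only y (node x) (left x) (right x)
    a≢a′ : a ≢ a′
    a≢a′ eq = ≺⇒≢ p₁ (node≡ ab a′b eq)
    c≢c′ : c ≢ c′
    c≢c′ eq = ≺⇒≢ p₃ (node≡ (flip-crossing bc) (flip-crossing bc′) eq)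
    a′≢c′ : a′ ≢ c′
    a′≢c′ eq = ≺⇒≢ (≺-trans p₂ p₃) (node≡ a′b (flip-crossing bc′) eq)
    on-bc : ∀ {u} → u ∈ₚ b → u ∈ₚ c → u ≡ node bc
    on-bc = only bc _
    on-ab : ∀ {u} → u ∈ₚ a → u ∈ₚ b → u ≡ node ab
    on-ab = only ab _
    ac≢a′b : node ac ≢ node a′b
    ac≢a′b eq = ≺⇒≢ p₂ (trans (sym eq) (on-bc (at eq (right a′b)) (right ac)))
    ac≢bc′ : node ac ≢ node bc′
    ac≢bc′ eq = ≺⇒≢ (≺-trans (≺-trans p₁ p₂) p₃) (trans (sym (on-ab (left ac) (at eq (left bc′)))) eq)
    a′c≢bc′ : node a′c ≢ node bc′
    a′c≢bc′ eq = ≺⇒≢ p₃ (trans (sym (on-bc (at eq (left bc′)) (right a′c))) eq)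
    a′b≢ac′ : node a′b ≢ node ac′
    a′b≢ac′ eq = ≺⇒≢ p₁ (sym (on-ab (at eq (left ac′)) (right a′b)))
    ac≢a′c : node ac ≢ node a′c
    ac≢a′c eq = no-3-bridge ((π≢σ ab ∷ a≢a′ ∷ []) ∷ (≢-sym (π≢σ a′b) ∷ []) ∷ [] ∷ []) ac≺ab p₁
      (subst (λ u → u ≺[ a′ ] node a′b) (sym eq) a′c≺a′b)
    ac≢ac′ : node ac ≢ node ac′
    ac≢ac′ eq = no-3-bridge ((π≢σ bc′ ∷ π≢σ bc ∷ []) ∷ (≢-sym c≢c′ ∷ []) ∷ [] ∷ []) p₃
      (subst (λ u → node bc′ ≺[ c′ ] u) (sym eq) bc′≺ac′) bc≺ac
    a′c≢ac′ : node a′c ≢ node ac′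
    a′c≢ac′ eq = ac≢a′c (sym (only ac (node a′c) (at eq (left ac′)) (right a′c)))
    -- The opposite order gives the 4-bridge a′c → ac → ab → a′b closed up along a′.
    ac≺a′c : node ac ≺[ c ] node a′c
    ac≺a′c with ≺-total (right ac) (right a′c) ac≢a′c
    ... | inj₁ q = q
    ... | inj₂ q = ⊥-elim (no-4-bridge
            ((≢-sym (π≢σ ac) ∷ ≢-sym (π≢σ bc) ∷ ≢-sym (π≢σ a′c) ∷ []) ∷ (π≢σ ab ∷ a≢a′ ∷ []) ∷ (≢-sym (π≢σ a′b) ∷ []) ∷ [] ∷ [])
            (λ eq → ≺⇒≢ (≺-trans p₁ p₂) (trans (sym eq) (on-bc (at eq (right ab)) (right a′c))))
            ac≢a′b q ac≺ab p₁ a′c≺a′b)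
    -- The opposite order gives the 4-bridge bc → bc′ → ac′ → ac closed up along c.
    ac≺ac′ : node ac ≺[ a ] node ac′
    ac≺ac′ with ≺-total (left ac) (left ac′) ac≢ac′
    ... | inj₁ q = q
    ... | inj₂ q = ⊥-elim (no-4-bridge
            ((π≢σ bc′ ∷ ≢-sym (π≢σ ab) ∷ π≢σ bc ∷ []) ∷ (≢-sym (π≢σ ac′) ∷ ≢-sym c≢c′ ∷ []) ∷ (π≢σ ac ∷ []) ∷ [] ∷ [])
            (λ eq → ≺⇒≢ (≺-trans p₁ p₂) (sym (on-ab (at eq (left ac′)) (left bc))))
            (≢-sym ac≢bc′) p₃ bc′≺ac′ q bc≺ac)

  -- Positions of crossings along a path

  firstIndex : (Node → Bool) → List Node → ℕ
  firstIndex P []       = 0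
  firstIndex P (v ∷ vs) = if P v then 0 else suc (firstIndex P vs)

  firstIndex-only : ∀ P {vs v} → Unique vs → (p : v ∈ vs) → P v ≡ true → (∀ u → u ∈ vs → P u ≡ true → u ≡ v) →
                    firstIndex P vs ≡ toℕ (index p)
  firstIndex-only P un (here refl) Pv only′ rewrite Pv = refl
  firstIndex-only P {u ∷ vs} un@(_ ∷ un′) (there p) Pv only′ with P u in eq
  ... | true  = ⊥-elim (Unique[x∷xs]⇒x∉xs un (subst (_∈ vs) (sym (only′ u (here refl) eq)) p))
  ... | false = cong suc (firstIndex-only P un′ p Pv (λ w w∈ → only′ w (there w∈)))

  -- Defined for all pairs of paths, so that it is a function of the vertex alone by which the
  -- neighbours of a vertex can be ordered. For paths that cross it is the position of their
  -- crossing.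
  rank : Path → Path → ℕ
  rank π σ = firstIndex (λ v → does (v ∈ₚ? σ)) (path S π)

  rank-crossing : ∀ {π σ} (x : Crossing σ π) → rank π σ ≡ toℕ (index (right x))
  rank-crossing {π} {σ} x = firstIndex-only _ (unique π) (right x) (member-true (left x)) (λ u u∈ p → only x u (true-member p) u∈)
    where
    member-true : ∀ {v} → v ∈ₚ σ → does (v ∈ₚ? σ) ≡ true
    member-true {v} v∈ with v ∈ₚ? σ
    ... | yes _ = refl
    ... | no v∉ = ⊥-elim (v∉ v∈)
    true-member : ∀ {v} → does (v ∈ₚ? σ) ≡ true → v ∈ₚ σ
    true-member {v} p with v ∈ₚ? σ
    ... | yes v∈ = v∈
    true-member {v} () | no _

  rank-< : ∀ {π σ τ} (x : Crossing σ π) (y : Crossing τ π) → rank π σ < rank π τ → node x ≺[ π ] node y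
  rank-< x y lt = index (right x) , index (right y) , subst₂ _<_ (rank-crossing x) (rank-crossing y) lt ,
                  sym (lookup-index (right x)) , sym (lookup-index (right y))

  rank-≡ : ∀ {π σ τ} (x : Crossing σ π) (y : Crossing τ π) → rank π σ ≡ rank π τ → node x ≡ node y
  rank-≡ {π} x y eq = trans (lookup-index (right x)) (trans
    (cong (lookup (path S π)) (toℕ-injective (trans (sym (rank-crossing x)) (trans eq (rank-crossing y))))) (sym (lookup-index (right y))))

-- Disjoint independent triples

length-filter-split : ∀ {A : Set} {P : A → Set} (P? : U.Decidable P) xs →
                      length xs ≡ length (filter P? xs) + length (filter (¬? ∘ P?) xs)
length-filter-split P? [] = refl
length-filter-split P? (x ∷ xs) with P? x
... | yes _ = cong suc (length-filter-split P? xs)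
... | no  _ = trans (cong suc (length-filter-split P? xs)) (sym (+-suc _ _))

filter-loses≤2 : ∀ {A : Set} {P : A → Set} (P? : U.Decidable P) {xs} → Unique xs →
                 (∀ {x y z} → Unique (x ∷ y ∷ z ∷ []) → x ∈ xs → y ∈ xs → z ∈ xs → ¬ P x → ¬ P y → ¬ P z → ⊥) →
                 length xs ≤ length (filter P? xs) + 2
filter-loses≤2 {P = P} P? {xs} un h = ≤-trans (≤-reflexive (length-filter-split P? xs))
    (+-monoʳ-≤ (length (filter P? xs)) (short (filter (¬? ∘ P?) xs) (filter⁺ (¬? ∘ P?) un) (λ m → ∈-filter⁻ (¬? ∘ P?) m)))
  where
  short : ∀ ys → Unique ys → (∀ {y} → y ∈ ys → y ∈ xs × ¬ P y) → length ys ≤ 2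
  short []            _  _ = z≤n
  short (_ ∷ [])      _  _ = s≤s z≤n
  short (_ ∷ _ ∷ [])  _  _ = s≤s (s≤s z≤n)
  short (x ∷ y ∷ z ∷ ys) ((d₁ ∷ d₂ ∷ _) ∷ (d₃ ∷ _) ∷ _) k =
    let p , p′ = k (here refl) ; q , q′ = k (there (here refl)) ; r , r′ = k (there (there (here refl)))
    in ⊥-elim (h ((d₁ ∷ d₂ ∷ []) ∷ (d₃ ∷ []) ∷ [] ∷ []) p q r p′ q′ r′)

_∈ₜ_ : ∀ {A : Set} → A → A × A × A → Set
x ∈ₜ (a , b , c) = x ≡ a ⊎ x ≡ b ⊎ x ≡ c

module Extraction {A : Set} (_≟_ : DecidableEquality A) (Bad : A → A → Set) (Bad? : Decidable Bad) where

  Independent : A × A × A → Set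
  Independent (a , b , c) = (a ≢ b × ¬ Bad a b) × (a ≢ c × ¬ Bad a c) × (b ≢ c × ¬ Bad b c)

  AtMostTwoBad : List A → Set
  AtMostTwoBad xs = ∀ {x y₁ y₂ y₃} → x ∈ xs → x ≢ y₁ → x ≢ y₂ → x ≢ y₃ → Unique (y₁ ∷ y₂ ∷ y₃ ∷ []) →
                    y₁ ∈ xs → y₂ ∈ xs → y₃ ∈ xs → Bad x y₁ → Bad x y₂ → Bad x y₃ → ⊥

  record Packing (xs : List A) : Set where
    field
      triples     : List (A × A × A)
      many        : length xs ≤ 3 * length triples + 6
      members     : ∀ {t x} → t ∈ triples → x ∈ₜ t → x ∈ xs
      independent : ∀ {t} → t ∈ triples → Independent t
      disjoint    : ∀ {t t′ x} → t ∈ triples → t′ ∈ triples → x ∈ₜ t → x ∈ₜ t′ → t ≡ t′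
      unique      : Unique triples

  double-negation : ∀ {x y} → ¬ ¬ Bad x y → Bad x y
  double-negation {x} {y} nn with Bad? x y
  ... | yes b = b
  ... | no ¬b = ⊥-elim (nn ¬b)

  -- From seven elements a triple can always be split off: after x at least 6 remain, of which at
  -- least 4 are compatible with it. Taking y leaves 3, of which at least one is compatible with y
  -- as well. Hence at most 6 are left over.
  pack : ∀ f xs → length xs ≤ f → Unique xs → AtMostTwoBad xs → Packing xs
  pack f xs len un two with length xs ≤? 6
  ... | yes small = record { triples = [] ; many = small ; members = λ () ; independent = λ () ; disjoint = λ () ; unique = [] }
  pack f [] len un two | no large = ⊥-elim (large z≤n)
  pack (suc f) (x ∷ rest) (s≤s len) (x≢ ∷ un) two | no large
    with filter (λ y → ¬? (Bad? x y)) rest in eq₁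
       | filter-loses≤2 (λ y → ¬? (Bad? x y)) un (λ d p q r bp bq br → two (here refl) (All.lookup x≢ p) (All.lookup x≢ q) (All.lookup x≢ r) d
           (there p) (there q) (there r) (double-negation bp) (double-negation bq) (double-negation br))
       | filter⁺ (λ y → ¬? (Bad? x y)) un
       | (λ {y} → ∈-filter⁻ (λ y → ¬? (Bad? x y)) {y} {rest})
  ... | [] | few | _ | _ = ⊥-elim (large (s≤s (≤-trans few (s≤s (s≤s z≤n)))))
  ... | y ∷ good | few | y≢ ∷ un₁ | mem
    with filter (λ z → ¬? (Bad? y z)) good in eq₂
       | filter-loses≤2 (λ z → ¬? (Bad? y z)) un₁ (λ d p q r bp bq br → two (there (proj₁ (mem (here refl))))
           (All.lookup y≢ p) (All.lookup y≢ q) (All.lookup y≢ r) d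
           (there (proj₁ (mem (there p)))) (there (proj₁ (mem (there q)))) (there (proj₁ (mem (there r))))
           (double-negation bp) (double-negation bq) (double-negation br))
       | (λ {z} → ∈-filter⁻ (λ z → ¬? (Bad? y z)) {z} {good})
  ...   | [] | few₂ | _ = ⊥-elim (large (s≤s (≤-trans few (s≤s (≤-trans (+-monoˡ-≤ 2 few₂) (s≤s (s≤s (s≤s (s≤s z≤n)))))))))
  ...   | z ∷ _ | few₂ | mem₂ = record
    { triples = (x , y , z) ∷ triples
    ; many = ≤-trans (s≤s (≤-trans lost (+-monoˡ-≤ 2 many))) (≤-reflexive (lem (length triples)))
    ; members = λ { (here refl) p → new p ; (there t∈) p → there (proj₁ (left′ (members t∈ p))) }
    ; independent = λ { (here refl) → (All.lookup x≢ y∈ , proj₂ (mem (here refl))) , (All.lookup x≢ z∈ , proj₂ (mem (there z∈good))) , (All.lookup y≢ z∈good , proj₂ (mem₂ (here refl)))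
                      ; (there t∈) → independent t∈ }
    ; disjoint = λ { (here refl) (here refl) _ _ → refl
                   ; (here refl) (there t∈) p q → ⊥-elim (old p (members t∈ q))
                   ; (there t∈) (here refl) p q → ⊥-elim (old q (members t∈ p))
                   ; (there t∈) (there t∈′) p q → disjoint t∈ t∈′ p q }
    ; unique = All.tabulate (λ {t} t∈ eq → old (inj₁ refl) (members t∈ (subst (x ∈ₜ_) eq (inj₁ refl)))) ∷ unique }
    where
    z∈good : z ∈ good
    z∈good = proj₁ (mem₂ (here refl))
    y∈ : y ∈ rest
    y∈ = proj₁ (mem (here refl))
    z∈ : z ∈ rest
    z∈ = proj₁ (mem (there z∈good))
    keep? : U.Decidable (λ w → w ≢ y × w ≢ z)
    keep? w = ¬? (w ≟ y) ×-dec ¬? (w ≟ z)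
    left : List A
    left = filter keep? rest
    left′ : ∀ {w} → w ∈ left → w ∈ rest × (w ≢ y × w ≢ z)
    left′ = ∈-filter⁻ keep?
    lost : length rest ≤ length left + 2
    lost = filter-loses≤2 keep? un λ { ((d₁ ∷ d₂ ∷ []) ∷ (d₃ ∷ []) ∷ [] ∷ []) _ _ _ p q r → three d₁ d₂ d₃ (is p) (is q) (is r) }
      where
      is : ∀ {w} → ¬ (w ≢ y × w ≢ z) → w ≡ y ⊎ w ≡ z
      is {w} n with w ≟ y | w ≟ z
      ... | yes p | _     = inj₁ p
      ... | no _  | yes q = inj₂ q
      ... | no p  | no q  = ⊥-elim (n (p , q))
      three : ∀ {u v w} → u ≢ v → u ≢ w → v ≢ w → u ≡ y ⊎ u ≡ z → v ≡ y ⊎ v ≡ z → w ≡ y ⊎ w ≡ z → ⊥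
      three d₁ d₂ d₃ (inj₁ refl) (inj₁ refl) _           = d₁ refl
      three d₁ d₂ d₃ (inj₂ refl) (inj₂ refl) _           = d₁ refl
      three d₁ d₂ d₃ (inj₁ refl) (inj₂ refl) (inj₁ refl) = d₂ refl
      three d₁ d₂ d₃ (inj₁ refl) (inj₂ refl) (inj₂ refl) = d₃ refl
      three d₁ d₂ d₃ (inj₂ refl) (inj₁ refl) (inj₁ refl) = d₃ refl
      three d₁ d₂ d₃ (inj₂ refl) (inj₁ refl) (inj₂ refl) = d₂ refl
    open Packing (pack f left (≤-trans (length-filter keep? rest) len) (filter⁺ keep? un)
                    (λ p d₁ d₂ d₃ d q r s → two (there (proj₁ (left′ p))) d₁ d₂ d₃ d (there (proj₁ (left′ q))) (there (proj₁ (left′ r))) (there (proj₁ (left′ s)))))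
    new : ∀ {w} → w ∈ₜ (x , y , z) → w ∈ x ∷ rest
    new (inj₁ refl)        = here refl
    new (inj₂ (inj₁ refl)) = there y∈
    new (inj₂ (inj₂ refl)) = there z∈
    old : ∀ {w} → w ∈ₜ (x , y , z) → w ∈ left → ⊥
    old (inj₁ refl)        w∈ = All.lookup x≢ (proj₁ (left′ w∈)) refl
    old (inj₂ (inj₁ refl)) w∈ = proj₁ (proj₂ (left′ w∈)) refl
    old (inj₂ (inj₂ refl)) w∈ = proj₂ (proj₂ (left′ w∈)) refl
    lem : ∀ t → suc (3 * t + 6 + 2) ≡ 3 * suc t + 6
    lem = solve-∀

  packing : ∀ xs → Unique xs → AtMostTwoBad xs → Packing xs
  packing xs = pack (length xs) xs ≤-refl

-- Relations with few pairs

<ᵇ-true : ∀ {m n} → (m <ᵇ n) ≡ true → m < n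
<ᵇ-true {m} {n} eq = <ᵇ⇒< m n (subst T (sym eq) _)

<ᵇ-false : ∀ {m n} → (m <ᵇ n) ≡ false → n ≤ m
<ᵇ-false {m} {n} eq = ≮⇒≥ λ m<n → subst T eq (<⇒<ᵇ m<n)

∑-atMostOne : ∀ {A : Set} {xs : List A} (P : A → Bool) → Unique xs →
              (∀ {x y} → P x ≡ true → P y ≡ true → x ≡ y) → ∑ xs (𝟙 ∘ P) ≤ 1
∑-atMostOne {xs = []}     P un h = z≤n
∑-atMostOne {xs = x ∷ xs} P (x≢ ∷ un) h with P x in eq
... | false = ∑-atMostOne P un h
... | true  = s≤s (≤-trans (∑-mono∈ xs λ y y∈ → ≤-reflexive (cong 𝟙 (none y y∈))) (≤-reflexive (∑-zero xs)))
  where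
  none : ∀ y → y ∈ xs → P y ≡ false
  none y y∈ with P y in eq′
  ... | false = refl
  ... | true  = ⊥-elim (All.lookup x≢ y∈ (h eq eq′))

module Sections {V : Set} (vs : List V) (complete : ∀ x → x ∈ vs) (vs-unique : Unique vs) where
  open Counting vs

  area-functional : ∀ F → (∀ {x y y′} → F x y ≡ true → F x y′ ≡ true → y ≡ y′) → area F ≤ length vs
  area-functional F h = ≤-trans (∑-mono vs λ x → ∑-atMostOne (F x) vs-unique h) (≤-reflexive (trans (∑-const vs 1) (*-identityʳ _)))

  area-cofunctional : ∀ F → (∀ {x x′ y} → F x y ≡ true → F x′ y ≡ true → x ≡ x′) → area F ≤ length vs
  area-cofunctional F h = ≤-trans (≤-reflexive (∑-swap vs vs _))
    (≤-trans (∑-mono vs λ y → ∑-atMostOne (λ x → F x y) vs-unique h) (≤-reflexive (trans (∑-const vs 1) (*-identityʳ _))))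

  -- Every pair (x , y) is last in its column or last in its row with respect to f.
  area-no-zigzag : ∀ F (f : V → ℕ) →
    (∀ {x x′ y} → F x y ≡ true → F x′ y ≡ true → f x ≡ f x′ → x ≡ x′) →
    (∀ {x y y′} → F x y ≡ true → F x y′ ≡ true → f y ≡ f y′ → y ≡ y′) →
    (∀ {x x′ y y′} → F x y ≡ true → F x′ y ≡ true → F x y′ ≡ true → f x < f x′ → f y < f y′ → ⊥) →
    area F ≤ length vs + length vs
  area-no-zigzag F f inj-x inj-y no-zigzag = ≤-trans
    (area-≤+ {W₁ = λ x y → F x y ∧ not (later x y)} {W₂ = λ x y → F x y ∧ later x y} (λ x y → split (F x y) (later x y)))
    (+-mono-≤ (area-cofunctional _ λ p q → last-unique (∧-true p) (∧-true q)) (area-functional _ λ p q → not-last-unique (∧-true p) (∧-true q)))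
    where
    Later : V → V → V → Bool
    Later x y x′ = F x′ y ∧ (f x <ᵇ f x′)
    found : ∀ {A B : Set} → A ⊎ B → Bool
    found (inj₁ _) = true
    found (inj₂ _) = false
    later : V → V → Bool
    later x y = found (search vs (Later x y))
    split : ∀ b c → b ≡ true → b ∧ not c ≡ true ⊎ b ∧ c ≡ true
    split true true  _ = inj₂ refl
    split true false _ = inj₁ refl
    later-witness : ∀ x y → later x y ≡ true → ∃ λ x′ → F x′ y ≡ true × f x < f x′
    later-witness x y p with search vs (Later x y)
    ... | inj₁ (x′ , q) = x′ , proj₁ (∧-true q) , <ᵇ-true (proj₂ (∧-true {F x′ y} q))
    later-witness x y () | inj₂ _
    later-none : ∀ x y → not (later x y) ≡ true → ∀ x′ → F x′ y ≡ true → f x′ ≤ f x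
    later-none x y p x′ Fx′ with search vs (Later x y)
    later-none x y () x′ Fx′ | inj₁ _
    ... | inj₂ h = <ᵇ-false (case-∧ (h x′ (complete x′)))
      where
      case-∧ : ∀ {c} → F x′ y ∧ c ≡ false → c ≡ false
      case-∧ q rewrite Fx′ = q
    last-unique : ∀ {x x′ y} → F x y ≡ true × not (later x y) ≡ true → F x′ y ≡ true × not (later x′ y) ≡ true → x ≡ x′
    last-unique {x} {x′} {y} (p , l) (p′ , l′) = inj-x p p′ (≤-antisym (later-none x′ y l′ x p) (later-none x y l x′ p′))
    not-last-unique : ∀ {x y y′} → F x y ≡ true × later x y ≡ true → F x y′ ≡ true × later x y′ ≡ true → y ≡ y′
    not-last-unique {x} {y} {y′} (p , l) (p′ , l′) with <-cmp (f y) (f y′)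
    ... | tri≈ _ eq _ = inj-y p p′ eq
    ... | tri< lt _ _ = let x″ , q , x< = later-witness x y l in ⊥-elim (no-zigzag p q p′ x< lt)
    ... | tri> _ _ gt = let x″ , q , x< = later-witness x y′ l′ in ⊥-elim (no-zigzag p′ q p x< gt)

-- Graphs given by a list of edges

module EdgeList {V : Set} (_≟_ : DecidableEquality V) (vs : List V) (complete : ∀ x → x ∈ vs) (vs-unique : Unique vs)
                (E : List (V × V)) where
  open Counting vs

  is : V × V → V → V → Bool
  is (a , b) x y = does (a ≟ x) ∧ does (b ≟ y)

  adj : V → V → Bool
  adj x y = go E
    module Adj where
    go : List (V × V) → Bool
    go []       = false
    go (e ∷ es) = is e x y ∨ go es

  open Graph vs adj

  is-sound : ∀ {e x y} → is e x y ≡ true → e ≡ (x , y)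
  is-sound {a , b} {x} {y} p with a ≟ x | b ≟ y
  ... | yes refl | yes refl = refl
  is-sound () | yes _ | no _
  is-sound () | no _  | _

  is-refl : ∀ x y → is (x , y) x y ≡ true
  is-refl x y with x ≟ x | y ≟ y
  ... | yes _ | yes _ = refl
  ... | no n  | _     = ⊥-elim (n refl)
  ... | yes _ | no n  = ⊥-elim (n refl)

  adj-sound : ∀ {x y} → adj x y ≡ true → (x , y) ∈ E
  adj-sound {x} {y} = go E
    where
    go : ∀ es → Adj.go x y es ≡ true → (x , y) ∈ es
    go (e ∷ es) p with ∨-true {is e x y} p
    ... | inj₁ q = here (sym (is-sound q))
    ... | inj₂ q = there (go es q)

  adj-complete : ∀ {x y} → (x , y) ∈ E → adj x y ≡ true
  adj-complete {x} {y} = go E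
    where
    go : ∀ es → (x , y) ∈ es → Adj.go x y es ≡ true
    go (e ∷ es) (here refl) rewrite is-refl x y = refl
    go (e ∷ es) (there p) with is e x y
    ... | true  = refl
    ... | false = go es p

  adj≤∑ : ∀ x y → 𝟙 (adj x y) ≤ ∑ E (λ e → 𝟙 (is e x y))
  adj≤∑ x y = go E
    where
    go : ∀ es → 𝟙 (Adj.go x y es) ≤ ∑ es (λ e → 𝟙 (is e x y))
    go []       = z≤n
    go (e ∷ es) with is e x y
    ... | true  = s≤s z≤n
    ... | false = go es

  edges≤length : edges (λ _ _ → true) ≤ length E
  edges≤length = begin
    edges (λ _ _ → true)                                   ≤⟨ area-mono {W′ = adj} (λ x y → proj₁ ∘ ∧-true) ⟩
    ∑ vs (λ x → ∑ vs λ y → 𝟙 (adj x y))                    ≤⟨ ∑-mono vs (λ x → ∑-mono vs λ y → adj≤∑ x y) ⟩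
    ∑ vs (λ x → ∑ vs λ y → ∑ E λ e → 𝟙 (is e x y))         ≡⟨ ∑-cong vs (λ x → ∑-swap vs E _) ⟩
    ∑ vs (λ x → ∑ E λ e → ∑ vs λ y → 𝟙 (is e x y))         ≡⟨ ∑-swap vs E _ ⟩
    ∑ E (λ e → area (is e))                                ≤⟨ ∑-mono E at-most-one ⟩
    ∑ E (λ _ → 1)                                          ≡⟨ trans (∑-const E 1) (*-identityʳ _) ⟩
    length E                                               ∎
    where
    open ≤-Reasoning
    at-most-one : ∀ e → area (is e) ≤ 1
    at-most-one (a , b) = ≤-trans (≤-reflexive (area-⊗ (λ x → does (a ≟ x)) (λ y → does (b ≟ y))))
      (*-mono-≤ (∑-atMostOne _ vs-unique (λ p q → trans (sym (sound p)) (sound q))) (∑-atMostOne _ vs-unique (λ p q → trans (sym (sound p)) (sound q))))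
      where
      sound : ∀ {a x} → does (a ≟ x) ≡ true → a ≡ x
      sound {a} {x} p with a ≟ x
      ... | yes eq = eq
      sound () | no _

  -- At a fixed pair of vertices, uniqueness allows at most one entry of `E` to contribute.
  ∑≤edges : Unique E → ∀ P → ∑ E (λ (x , y) → 𝟙 (P x y)) ≤ edges P
  ∑≤edges un P = begin
    ∑ E (λ (x , y) → 𝟙 (P x y))                                     ≤⟨ ∑-mono E (λ (x , y) → at-least x y) ⟩
    ∑ E (λ e → ∑ vs λ x → ∑ vs λ y → 𝟙 (is e x y ∧ P x y))          ≡⟨ ∑-swap E vs _ ⟩
    ∑ vs (λ x → ∑ E λ e → ∑ vs λ y → 𝟙 (is e x y ∧ P x y))          ≡⟨ ∑-cong vs (λ x → ∑-swap E vs _) ⟩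
    ∑ vs (λ x → ∑ vs λ y → ∑ E λ e → 𝟙 (is e x y ∧ P x y))          ≤⟨ ∑-mono vs (λ x → ∑-mono vs λ y → collapse x y) ⟩
    edges P                                                         ∎
    where
    open ≤-Reasoning
    at-least : ∀ x y → 𝟙 (P x y) ≤ ∑ vs (λ x′ → ∑ vs λ y′ → 𝟙 (is (x , y) x′ y′ ∧ P x′ y′))
    at-least x y = ≤-trans (≤-reflexive (cong (λ b → 𝟙 (b ∧ P x y)) (sym (is-refl x y))))
      (≤-trans (term≤∑ (λ y′ → 𝟙 (is (x , y) x y′ ∧ P x y′)) (complete y))
               (term≤∑ (λ x′ → ∑ vs λ y′ → 𝟙 (is (x , y) x′ y′ ∧ P x′ y′)) (complete x)))
    collapse : ∀ x y → ∑ E (λ e → 𝟙 (is e x y ∧ P x y)) ≤ 𝟙 (adj x y ∧ P x y)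
    collapse x y with adj x y ∧ P x y in eq
    ... | true  = ∑-atMostOne (λ e → is e x y ∧ P x y) un λ p q → trans (is-sound (proj₁ (∧-true p))) (sym (is-sound (proj₁ (∧-true q))))
    ... | false = ≤-trans (∑-mono∈ E λ e e∈ → ≤-reflexive (cong 𝟙 (none e e∈))) (≤-reflexive (∑-zero E))
      where
      none : ∀ e → e ∈ E → is e x y ∧ P x y ≡ false
      none e e∈ with is e x y in eq′
      ... | false = refl
      ... | true  = trans (sym (cong (_∧ P x y) (adj-complete (subst (_∈ E) (is-sound eq′) e∈)))) eq

-- The triangle graph of a path system

∑-lookup : ∀ {A : Set} (xs : List A) (f : A → ℕ) → ∑ xs f ≡ ∑ (allFin (length xs)) (f ∘ lookup xs)
∑-lookup xs f = trans (cong (λ ys → ∑ ys f) (sym (trans (map-tabulate id (lookup xs)) (tabulate-lookup xs))))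
                      (∑-map (allFin (length xs)) (lookup xs) f)

sum-map : ∀ {A : Set} (xs : List A) (f : A → ℕ) → sum (map f xs) ≡ ∑ xs f
sum-map []       f = refl
sum-map (x ∷ xs) f = cong (f x +_) (sum-map xs f)

length-filter-∑ : ∀ {A : Set} {P : A → Set} (P? : U.Decidable P) xs → length (filter P? xs) ≡ ∑ xs (λ x → 𝟙 (does (P? x)))
length-filter-∑ P? []       = refl
length-filter-∑ P? (x ∷ xs) with P? x
... | yes _ = cong suc (length-filter-∑ P? xs)
... | no  _ = length-filter-∑ P? xs

length-cartesianProduct : ∀ {A B : Set} (xs : List A) (ys : List B) → length (cartesianProduct xs ys) ≡ length xs * length ys
length-cartesianProduct []       ys = refl
length-cartesianProduct (x ∷ xs) ys = trans (length-++ (map (x ,_) ys)) (cong₂ _+_ (length-map _ ys) (length-cartesianProduct xs ys))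

-- Injectivity is required on the members of the list only; the edge maps below are injective on
-- `quads` but not in general.
unique-map : ∀ {A B : Set} {xs : List A} (f : A → B) → Unique xs → (∀ {x y} → x ∈ xs → y ∈ xs → f x ≡ f y → x ≡ y) → Unique (map f xs)
unique-map {xs = []}     f un h = []
unique-map {xs = x ∷ xs} f (x≢ ∷ un) h =
  All.tabulate (λ m eq → let y , y∈ , p = ∈-map⁻ f m in All.lookup x≢ y∈ (h (here refl) (there y∈) (trans eq p)))
  ∷ unique-map f un (λ p q → h (there p) (there q))

tagged : ∀ {A B : Set} → List A → (A → List B) → List (A × B)
tagged xs f = concatMap (λ x → map (x ,_) (f x)) xs

∈-tagged : ∀ {A B : Set} (xs : List A) (f : A → List B) {x y} → (x , y) ∈ tagged xs f → x ∈ xs × y ∈ f x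
∈-tagged (z ∷ xs) f m with ∈-++⁻ (map (z ,_) (f z)) m
... | inj₁ p with ∈-map⁻ (z ,_) p
...   | y , y∈ , refl = here refl , y∈
∈-tagged (z ∷ xs) f m | inj₂ p = let q , r = ∈-tagged xs f p in there q , r

unique-tagged : ∀ {A B : Set} {xs : List A} (f : A → List B) → Unique xs → (∀ x → Unique (f x)) → Unique (tagged xs f)
unique-tagged {xs = []}     f un h = []
unique-tagged {xs = x ∷ xs} f (x≢ ∷ un) h = ++⁺ (map⁺ (λ { refl → refl }) (h x)) (unique-tagged f un h)
  λ (p , q) → case ∈-map⁻ (x ,_) p of λ { (y , _ , refl) → All.lookup x≢ (proj₁ (∈-tagged xs f q)) refl }

length-tagged : ∀ {A B : Set} (xs : List A) (f : A → List B) → length (tagged xs f) ≡ ∑ xs (length ∘ f)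
length-tagged xs f = trans (length-concatMap xs _) (∑-cong xs λ x → length-map _ (f x))

-- Packing all nodes and counting triangles

module Assembly {n : ℕ} (S : PathSystem n) (free : BridgeFree S) where
  open Geometry S free

  p : ℕ
  p = numPaths S

  through : Node → List Path
  through v = filter (v ∈ₚ?_) (allFin p)

  through⇒∈ : ∀ {v π} → π ∈ through v → v ∈ₚ π
  through⇒∈ {v} m = proj₂ (∈-filter⁻ (v ∈ₚ?_) {xs = allFin p} m)

  module Pack v = Extraction {Path} _≟ᶠ_ (MeetAgain v) (MeetAgain? v)

  packing-at : ∀ v → Pack.Packing v (through v)
  packing-at v = Pack.packing v (through v) (filter⁺ (v ∈ₚ?_) (allFin⁺ p))
    λ x∈ d₁ d₂ d₃ d m₁ m₂ m₃ → two-partners (through⇒∈ x∈) d₁ d₂ d₃ d (through⇒∈ m₁) (through⇒∈ m₂) (through⇒∈ m₃)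

  Triple : Set
  Triple = Path × Path × Path

  quads : List (Node × Triple)
  quads = tagged (allFin n) (λ v → Pack.Packing.triples (packing-at v))

  N : ℕ
  N = length quads

  -- The size counts incidences; regrouped by nodes, each node contributes three per triple packed
  -- there and at most six unpacked ones.
  size≤ : size S ≤ 3 * N + 6 * n
  size≤ = begin
    size S                                                                   ≡⟨ trans (sum-map (paths S) length) (∑-lookup (paths S) length) ⟩
    ∑ (allFin p) (λ π → length (path S π))                                   ≤⟨ ∑-mono (allFin p) length≤ ⟩
    ∑ (allFin p) (λ π → ∑ (allFin n) λ v → 𝟙 (does (v ∈ₚ? π)))               ≡⟨ ∑-swap (allFin p) (allFin n) _ ⟩
    ∑ (allFin n) (λ v → ∑ (allFin p) λ π → 𝟙 (does (v ∈ₚ? π)))               ≡⟨ ∑-cong (allFin n) (λ v → sym (length-filter-∑ (v ∈ₚ?_) (allFin p))) ⟩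
    ∑ (allFin n) (λ v → length (through v))                                  ≤⟨ ∑-mono (allFin n) (λ v → Pack.Packing.many (packing-at v)) ⟩
    ∑ (allFin n) (λ v → 3 * length (Pack.Packing.triples (packing-at v)) + 6) ≡⟨ ∑-+ (allFin n) (λ v → 3 * length (Pack.Packing.triples (packing-at v))) (λ _ → 6) ⟩
    ∑ (allFin n) (λ v → 3 * length (Pack.Packing.triples (packing-at v))) + ∑ (allFin n) (λ _ → 6)
      ≡⟨ cong₂ _+_ (trans (∑-* (allFin n) 3 _) (cong (3 *_) (sym (length-tagged (allFin n) _))))
                   (trans (∑-const (allFin n) 6) (trans (cong (_* 6) (length-tabulate {n = n} id)) (*-comm n 6))) ⟩
    3 * N + 6 * n ∎
    where
    open ≤-Reasoning
    length≤ : ∀ π → length (path S π) ≤ ∑ (allFin n) (λ v → 𝟙 (does (v ∈ₚ? π)))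
    length≤ π = begin
      length (path S π)                                                       ≡⟨ trans (∑-const (path S π) 1) (*-identityʳ _) ⟨
      ∑ (path S π) (λ _ → 1)                                                  ≤⟨ ∑-mono (path S π) (λ u → ≤-trans (≤-reflexive (sym (cong 𝟙 (same u)))) (term≤∑ (λ v → 𝟙 (does (u ≟ᶠ v))) (∈-allFin u))) ⟩
      ∑ (path S π) (λ u → ∑ (allFin n) λ v → 𝟙 (does (u ≟ᶠ v)))               ≡⟨ ∑-swap (path S π) (allFin n) _ ⟩
      ∑ (allFin n) (λ v → ∑ (path S π) λ u → 𝟙 (does (u ≟ᶠ v)))               ≤⟨ ∑-mono (allFin n) at-most ⟩
      ∑ (allFin n) (λ v → 𝟙 (does (v ∈ₚ? π)))                                 ∎
      where
      same : ∀ u → does (u ≟ᶠ u) ≡ true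
      same u with u ≟ᶠ u
      ... | yes _ = refl
      ... | no  d = ⊥-elim (d refl)
      sound : ∀ {u v : Node} → does (u ≟ᶠ v) ≡ true → u ≡ v
      sound {u} {v} q with u ≟ᶠ v
      ... | yes eq = eq
      sound () | no _
      at-most : ∀ v → ∑ (path S π) (λ u → 𝟙 (does (u ≟ᶠ v))) ≤ 𝟙 (does (v ∈ₚ? π))
      at-most v with v ∈ₚ? π
      ... | yes _ = ∑-atMostOne (λ u → does (u ≟ᶠ v)) (unique π) (λ q r → trans (sound q) (sym (sound r)))
      ... | no v∉ = ≤-trans (∑-mono∈ (path S π) λ u u∈ → ≤-reflexive (cong 𝟙 (absent u u∈))) (≤-reflexive (∑-zero (path S π)))
        where
        absent : ∀ u → u ∈ path S π → does (u ≟ᶠ v) ≡ false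
        absent u u∈ with u ≟ᶠ v
        ... | yes refl = ⊥-elim (v∉ u∈)
        ... | no _     = refl

  quad∈ : ∀ {v t} → (v , t) ∈ quads → t ∈ Pack.Packing.triples (packing-at v)
  quad∈ = proj₂ ∘ ∈-tagged (allFin n) _

  same-triple : ∀ {v t t′ x} → (v , t) ∈ quads → (v , t′) ∈ quads → x ∈ₜ t → x ∈ₜ t′ → t ≡ t′
  same-triple {v} m m′ = Pack.Packing.disjoint (packing-at v) (quad∈ m) (quad∈ m′)

  crossing : ∀ {v t x y} → (v , t) ∈ quads → x ∈ₜ t → y ∈ₜ t → x ≢ y × ¬ MeetAgain v x y → Crossing x y
  crossing {v} m x∈ y∈ (x≢y , once) = record
    { node = v ; left = through⇒∈ (Pack.Packing.members (packing-at v) (quad∈ m) x∈)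
    ; right = through⇒∈ (Pack.Packing.members (packing-at v) (quad∈ m) y∈)
    ; only = λ u p q → case u ≟ᶠ v of λ { (yes eq) → eq ; (no u≢v) → ⊥-elim (once (u , u≢v , p , q)) }
    ; π≢σ = x≢y }

  module _ {v a b c} (m : (v , a , b , c) ∈ quads) where
    private independent = Pack.Packing.independent (packing-at v) (quad∈ m)

    crossing₁₂ : Crossing a b
    crossing₁₂ = crossing m (inj₁ refl) (inj₂ (inj₁ refl)) (proj₁ independent)

    crossing₁₃ : Crossing a c
    crossing₁₃ = crossing m (inj₁ refl) (inj₂ (inj₂ refl)) (proj₁ (proj₂ independent))

    crossing₂₃ : Crossing b c
    crossing₂₃ = crossing m (inj₂ (inj₁ refl)) (inj₂ (inj₂ refl)) (proj₂ (proj₂ independent))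

  V : Set
  V = Fin 3 × Path

  pattern 0F = fzero
  pattern 1F = fsuc fzero
  pattern 2F = fsuc (fsuc fzero)

  vs : List V
  vs = cartesianProduct (allFin 3) (allFin p)

  complete : ∀ x → x ∈ vs
  complete (i , π) = ∈-cartesianProduct⁺ (∈-allFin i) (∈-allFin π)

  vs-unique : Unique vs
  vs-unique = cartesianProduct⁺ (allFin⁺ 3) (allFin⁺ p)

  length-vs : length vs ≡ 3 * p
  length-vs = trans (length-cartesianProduct (allFin 3) (allFin p)) (cong (3 *_) (length-tabulate {n = p} id))

  edge₁₂ edge₂₃ edge₁₃ : Node × Triple → V × V
  edge₁₂ (_ , a , b , c) = (0F , a) , (1F , b)
  edge₂₃ (_ , a , b , c) = (1F , b) , (2F , c)
  edge₁₃ (_ , a , b , c) = (0F , a) , (2F , c)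

  E : List (V × V)
  E = map edge₁₂ quads ++ map edge₂₃ quads ++ map edge₁₃ quads

  quads-unique : Unique quads
  quads-unique = unique-tagged _ (allFin⁺ n) (λ v → Pack.Packing.unique (packing-at v))

  -- Two paths of a triple cross only at its node, so an edge determines the node. The triples
  -- packed at one node are disjoint, so a single path of the triple then determines all of it.
  E-unique : Unique E
  E-unique = ++⁺ (unique-map edge₁₂ quads-unique inj₁₂) (++⁺ (unique-map edge₂₃ quads-unique inj₂₃) (unique-map edge₁₃ quads-unique inj₁₃) disjoint₂₃) disjoint₁₂
    where
    finish : ∀ {v t v′ t′ x} → (v , t) ∈ quads → (v′ , t′) ∈ quads → v ≡ v′ → x ∈ₜ t → x ∈ₜ t′ → (v , t) ≡ (v′ , t′)
    finish m m′ refl x∈ x∈′ = cong (_ ,_) (same-triple m m′ x∈ x∈′)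
    open Crossing
    inj₁₂ : ∀ {q q′} → q ∈ quads → q′ ∈ quads → edge₁₂ q ≡ edge₁₂ q′ → q ≡ q′
    inj₁₂ m m′ refl = finish m m′ (only (crossing₁₂ m′) _ (left (crossing₁₂ m)) (right (crossing₁₂ m))) (inj₁ refl) (inj₁ refl)
    inj₂₃ : ∀ {q q′} → q ∈ quads → q′ ∈ quads → edge₂₃ q ≡ edge₂₃ q′ → q ≡ q′
    inj₂₃ m m′ refl = finish m m′ (only (crossing₂₃ m′) _ (left (crossing₂₃ m)) (right (crossing₂₃ m))) (inj₂ (inj₁ refl)) (inj₂ (inj₁ refl))
    inj₁₃ : ∀ {q q′} → q ∈ quads → q′ ∈ quads → edge₁₃ q ≡ edge₁₃ q′ → q ≡ q′
    inj₁₃ m m′ refl = finish m m′ (only (crossing₁₃ m′) _ (left (crossing₁₃ m)) (right (crossing₁₃ m))) (inj₁ refl) (inj₁ refl)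
    disjoint₂₃ : Disjoint (map edge₂₃ quads) (map edge₁₃ quads)
    disjoint₂₃ (p , q) with ∈-map⁻ edge₂₃ p | ∈-map⁻ edge₁₃ q
    ... | _ , _ , refl | _ , _ , ()
    disjoint₁₂ : Disjoint (map edge₁₂ quads) (map edge₂₃ quads ++ map edge₁₃ quads)
    disjoint₁₂ (p , q) with ∈-map⁻ edge₁₂ p | ∈-++⁻ (map edge₂₃ quads) q
    ... | _ , _ , refl | inj₁ r with ∈-map⁻ edge₂₃ r
    ...   | _ , _ , ()
    disjoint₁₂ (p , q) | _ , _ , refl | inj₂ r with ∈-map⁻ edge₁₃ r
    ...   | _ , _ , ()

  open EdgeList (≡-dec _≟ᶠ_ _≟ᶠ_) vs complete vs-unique E
  open Counting vs
  open Graph vs adj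
  open Sections vs complete vs-unique

  data Edge : V → V → Set where
    e₁₂ : ∀ {v a b c} → (v , a , b , c) ∈ quads → Edge (0F , a) (1F , b)
    e₂₃ : ∀ {v a b c} → (v , a , b , c) ∈ quads → Edge (1F , b) (2F , c)
    e₁₃ : ∀ {v a b c} → (v , a , b , c) ∈ quads → Edge (0F , a) (2F , c)

  decode : ∀ {x y} → adj x y ≡ true → Edge x y
  decode {x} {y} h with ∈-++⁻ (map edge₁₂ quads) (adj-sound {x} {y} h)
  ... | inj₁ m with ∈-map⁻ edge₁₂ m
  ...   | _ , q∈ , refl = e₁₂ q∈
  decode h | inj₂ m with ∈-++⁻ (map edge₂₃ quads) m
  ...   | inj₁ m′ with ∈-map⁻ edge₂₃ m′
  ...     | _ , q∈ , refl = e₂₃ q∈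
  decode h | inj₂ m | inj₂ m′ with ∈-map⁻ edge₁₃ m′
  ...     | _ , q∈ , refl = e₁₃ q∈

  -- The three edges of a triangle may come from three different quads, so each edge keeps its own.
  data Middle (b : V) : V → V → Set where
    middle : ∀ {v₁ v₂ v₃ a β c b′ a′ c′} → b ≡ (1F , β) → (v₁ , a , β , c′) ∈ quads → (v₂ , a′ , β , c) ∈ quads → (v₃ , a , b′ , c) ∈ quads →
             Middle b (0F , a) (2F , c)

  module FewTriangles (b : V) where

    G : Relation₂
    G x y = adj x y ∧ (adj x b ∧ adj b y)

    f : V → ℕ
    f (_ , π) = rank (proj₂ b) π

    decodeG : ∀ {x y} → G x y ≡ true → Middle b x y
    decodeG {x} {y} h with decode (proj₁ (∧-true {adj x y} h)) | decode (proj₁ (∧-true {adj x b} (proj₂ (∧-true {adj x y} h)))) | decode (proj₂ (∧-true {adj x b} (proj₂ (∧-true {adj x y} h))))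
    -- Edges always go to a later copy of the set of paths, which forces x, b, y into copies 0, 1,
    -- 2.
    ... | e₁₃ m₃ | e₁₂ m₁ | e₂₃ m₂ = middle refl m₁ m₂ m₃

    -- Equal ranks mean the same crossing node on the path of b, and only one triple packed at that
    -- node contains this path.
    same-left : ∀ {x x′ y y′} → Middle b x y → Middle b x′ y′ → f x ≡ f x′ → x ≡ x′
    same-left (middle refl m₁ _ _) (middle refl m₁′ _ _) eq with rank-≡ (crossing₁₂ m₁) (crossing₁₂ m₁′) eq
    ... | refl with same-triple m₁ m₁′ (inj₂ (inj₁ refl)) (inj₂ (inj₁ refl))
    ...   | refl = refl

    same-right : ∀ {x x′ y y′} → Middle b x y → Middle b x′ y′ → f y ≡ f y′ → y ≡ y′
    same-right (middle refl _ m₂ _) (middle refl _ m₂′ _) eq with rank-≡ (flip-crossing (crossing₂₃ m₂)) (flip-crossing (crossing₂₃ m₂′)) eq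
    ... | refl with same-triple m₂ m₂′ (inj₂ (inj₁ refl)) (inj₂ (inj₁ refl))
    ...   | refl = refl

    zigzag₊ : ∀ {x x′ y y′} → Middle b x y → Middle b x′ y → Middle b x y′ → f x < f x′ → f y < f y′ → f x′ < f y → ⊥
    zigzag₊ (middle refl ab bc ac) (middle refl a′b _ a′c) (middle refl _ bc′ ac′) p₁ p₃ p₂ =
      no-zigzag (crossing₁₂ ab) (crossing₁₂ a′b) (crossing₂₃ bc) (crossing₂₃ bc′) (crossing₁₃ ac) (crossing₁₃ a′c) (crossing₁₃ ac′)
        (rank-< (crossing₁₂ ab) (crossing₁₂ a′b) p₁) (rank-< (crossing₁₂ a′b) (flip-crossing (crossing₂₃ bc)) p₂)
        (rank-< (flip-crossing (crossing₂₃ bc)) (flip-crossing (crossing₂₃ bc′)) p₃)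

    -- `no-zigzag` with the roles of the first and the third path exchanged, since the crossings
    -- with y now come first on the path of b.
    zigzag₋ : ∀ {x x′ y y′} → Middle b x y → Middle b x′ y → Middle b x y′ → f x < f x′ → f y < f y′ → f y′ < f x → ⊥
    zigzag₋ (middle refl ab bc ac) (middle refl a′b _ a′c) (middle refl _ bc′ ac′) p₁ p₃ p₂ =
      no-zigzag (flip-crossing (crossing₂₃ bc)) (flip-crossing (crossing₂₃ bc′)) (flip-crossing (crossing₁₂ ab)) (flip-crossing (crossing₁₂ a′b))
        (flip-crossing (crossing₁₃ ac)) (flip-crossing (crossing₁₃ ac′)) (flip-crossing (crossing₁₃ a′c))
        (rank-< (flip-crossing (crossing₂₃ bc)) (flip-crossing (crossing₂₃ bc′)) p₃) (rank-< (flip-crossing (crossing₂₃ bc′)) (crossing₁₂ ab) p₂)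
        (rank-< (crossing₁₂ ab) (crossing₁₂ a′b) p₁)

    G₌ G₊ G₋ : Relation₂
    G₌ x y = G x y ∧ (f x ≡ᵇ f y)
    G₊ x y = G x y ∧ (f x <ᵇ f y)
    G₋ x y = G x y ∧ (f y <ᵇ f x)

    G⇒ : ∀ {x y c} → G x y ∧ c ≡ true → Middle b x y
    G⇒ h = decodeG (proj₁ (∧-true h))

    G₊⇒ : ∀ {x y} → G₊ x y ≡ true → f x < f y
    G₊⇒ {x} {y} h = <ᵇ-true (proj₂ (∧-true {G x y} h))

    G₋⇒ : ∀ {x y} → G₋ x y ≡ true → f y < f x
    G₋⇒ {x} {y} h = <ᵇ-true (proj₂ (∧-true {G x y} h))

    G₌⇒ : ∀ {x y} → G₌ x y ≡ true → f x ≡ f y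
    G₌⇒ {x} {y} h = ≡ᵇ⇒≡ (f x) (f y) (subst T (sym (proj₂ (∧-true {G x y} h))) _)

    -- In `G₌` the three paths pass through one node, and this node fixes y once x is given, which
    -- leaves at most M pairs. In `G₊` and `G₋` the comparison of x with y supplies the middle
    -- inequality that `no-zigzag` asks for, which leaves at most 2M pairs each.
    bound : edges (λ x y → adj x b ∧ adj b y) ≤ 5 * length vs
    bound = begin
      area G                                    ≤⟨ area-≤+ {W₁ = G₌} {W₂ = λ x y → G₊ x y ∨ G₋ x y} split ⟩
      area G₌ + area (λ x y → G₊ x y ∨ G₋ x y)  ≤⟨ +-monoʳ-≤ (area G₌) (area-≤+ {W₁ = G₊} {W₂ = G₋} (λ x y → ∨-true)) ⟩
      area G₌ + (area G₊ + area G₋)             ≤⟨ +-mono-≤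
         (area-functional G₌ (λ {x} p q → same-right (G⇒ p) (G⇒ q) (trans (sym (G₌⇒ {x} p)) (G₌⇒ {x} q))))
         (+-mono-≤ (area-no-zigzag G₊ f (λ p q → same-left (G⇒ p) (G⇒ q)) (λ p q → same-right (G⇒ p) (G⇒ q))
                     (λ {x} {x′} p q r x< y< → zigzag₊ (G⇒ p) (G⇒ q) (G⇒ r) x< y< (G₊⇒ {x′} q)))
                   (area-no-zigzag G₋ f (λ p q → same-left (G⇒ p) (G⇒ q)) (λ p q → same-right (G⇒ p) (G⇒ q))
                     (λ {x} p q r x< y< → zigzag₋ (G⇒ p) (G⇒ q) (G⇒ r) x< y< (G₋⇒ {x} r)))) ⟩
      M + ((M + M) + (M + M))                   ≡⟨ lem M ⟩
      5 * M                                     ∎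
      where
      open ≤-Reasoning
      M = length vs
      lem : ∀ m → m + ((m + m) + (m + m)) ≡ 5 * m
      lem = solve-∀
      split : ∀ x y → G x y ≡ true → G₌ x y ≡ true ⊎ G₊ x y ∨ G₋ x y ≡ true
      split x y h with <-cmp (f x) (f y)
      ... | tri≈ _ eq _ = inj₁ (∧-intro h (Equivalence.to T-≡ (≡⇒≡ᵇ (f x) (f y) eq)))
      ... | tri< lt _ _ = inj₂ (cong (_∨ G₋ x y) (∧-intro h (Equivalence.to T-≡ (<⇒<ᵇ lt))))
      ... | tri> _ _ gt = inj₂ (∨-introʳ (G₊ x y) (∧-intro h (Equivalence.to T-≡ (<⇒<ᵇ gt))))

  triples : List (V × V × V)
  triples = map (λ (_ , a , b , c) → (0F , a) , (1F , b) , (2F , c)) quads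

  length-triples : length triples ≡ N
  length-triples = length-map _ quads

  triples≤edges : ∀ P → ∑ triples (λ (x , y , z) → 𝟙 (P x y) + (𝟙 (P y z) + 𝟙 (P x z))) ≤ edges P
  triples≤edges P = ≤-trans (≤-reflexive (begin
    ∑ triples (λ (x , y , z) → 𝟙 (P x y) + (𝟙 (P y z) + 𝟙 (P x z)))                      ≡⟨ ∑-map quads _ _ ⟩
    ∑ quads (λ q → φ (edge₁₂ q) + (φ (edge₂₃ q) + φ (edge₁₃ q)))                         ≡⟨ ∑-+ quads (φ ∘ edge₁₂) (λ q → φ (edge₂₃ q) + φ (edge₁₃ q)) ⟩
    ∑ quads (φ ∘ edge₁₂) + ∑ quads (λ q → φ (edge₂₃ q) + φ (edge₁₃ q))                   ≡⟨ cong (∑ quads (φ ∘ edge₁₂) +_) (∑-+ quads (φ ∘ edge₂₃) (φ ∘ edge₁₃)) ⟩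
    ∑ quads (φ ∘ edge₁₂) + (∑ quads (φ ∘ edge₂₃) + ∑ quads (φ ∘ edge₁₃))                 ≡⟨ cong₂ _+_ (∑-map quads edge₁₂ φ) (cong₂ _+_ (∑-map quads edge₂₃ φ) (∑-map quads edge₁₃ φ)) ⟨
    ∑ (map edge₁₂ quads) φ + (∑ (map edge₂₃ quads) φ + ∑ (map edge₁₃ quads) φ)           ≡⟨ cong (∑ (map edge₁₂ quads) φ +_) (∑-++ (map edge₂₃ quads) (map edge₁₃ quads) φ) ⟨
    ∑ (map edge₁₂ quads) φ + ∑ (map edge₂₃ quads ++ map edge₁₃ quads) φ                  ≡⟨ ∑-++ (map edge₁₂ quads) _ φ ⟨
    ∑ E φ                                                                                ∎)) (∑≤edges E-unique P)
    where
    open ≡-Reasoning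
    φ : V × V → ℕ
    φ (x , y) = 𝟙 (P x y)

  edges≤triples : edges (λ _ _ → true) ≤ 3 * length triples
  edges≤triples = ≤-trans edges≤length (≤-reflexive (begin
    length E                                                                             ≡⟨ length-++ (map edge₁₂ quads) ⟩
    length (map edge₁₂ quads) + length (map edge₂₃ quads ++ map edge₁₃ quads)            ≡⟨ cong₂ _+_ (length-map edge₁₂ quads) (trans (length-++ (map edge₂₃ quads)) (cong₂ _+_ (length-map edge₂₃ quads) (length-map edge₁₃ quads))) ⟩
    N + (N + N)                                                                          ≡⟨ lem N ⟩
    3 * N                                                                                ≡⟨ cong (3 *_) length-triples ⟨
    3 * length triples                                                                   ∎))
    where
    open ≡-Reasoning
    lem : ∀ m → m + (m + m) ≡ 3 * m
    lem = solve-∀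

  -- For K ≥ 1 the required height 400 (K + 1) is at most 800 K. For K = 0 it suffices that
  -- edge-disjoint triangles are no more numerous than pairs of vertices.
  triples-bound : ∀ K → 800 * K ≤ log* p → N * 2 ^ K ≤ 6 * (length vs * length vs)
  triples-bound zero _ = begin
    N * 1                                                          ≡⟨ trans (*-identityʳ N) (sym length-triples) ⟩
    length triples                                                 ≡⟨ trans (∑-const triples 1) (*-identityʳ (length triples)) ⟨
    ∑ triples (λ _ → 1)                                            ≤⟨ ∑-mono triples (λ _ → s≤s z≤n) ⟩
    ∑ triples (λ _ → 3)                                            ≤⟨ triples≤edges (λ _ _ → true) ⟩
    edges (λ _ _ → true)                                           ≤⟨ ≤-trans (edges≤area _) (area≤ _) ⟩
    length vs * length vs                                          ≤⟨ m≤n*m _ 6 ⟩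
    6 * (length vs * length vs)                                    ∎
    where open ≤-Reasoning
  triples-bound K@(suc k) large = subst (λ m → m * 2 ^ K ≤ 6 * (length vs * length vs)) length-triples
    (let θ , θ>0 , θ-large , θ-small = Size.exists-θ K (length vs) (begin
           tower (400 * suc K)      ≤⟨ tower-mono (≤-trans (m≤m+n (400 * suc K) (400 * k)) (≤-reflexive (lem k))) ⟩
           tower (800 * K)          ≤⟨ tower≤ (800 * K) p large ⟩
           p                        ≤⟨ m≤n*m p 3 ⟩
           3 * p                    ≡⟨ length-vs ⟨
           length vs                ∎)
     in Removal.theorem vs complete adj K (Size.rounds K) (5 * length vs) θ triples triples≤edges edges≤triples
          FewTriangles.bound ≤-refl θ>0 θ-large θ-small)
    where
    open ≤-Reasoning
    lem : ∀ k → 400 * suc (suc k) + 400 * k ≡ 800 * suc k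
    lem = solve-∀

  -- 162 = 3 · 6 · 3²: three incidences per triple, the constant of the removal lemma, and 3p
  -- vertices.
  size-bound : ∀ K → 800 * K ≤ log* p → size S * 2 ^ K ≤ 162 * (p * p + n * 2 ^ K)
  size-bound K large = begin
    size S * 2 ^ K                                 ≤⟨ *-monoˡ-≤ (2 ^ K) size≤ ⟩
    (3 * N + 6 * n) * 2 ^ K                        ≡⟨ lem₁ N n (2 ^ K) ⟩
    3 * (N * 2 ^ K) + 6 * (n * 2 ^ K)              ≤⟨ +-mono-≤ (*-monoʳ-≤ 3 (triples-bound K large)) (*-monoˡ-≤ (n * 2 ^ K) (≤ᵇ-true {6} {162} refl)) ⟩
    3 * (6 * (length vs * length vs)) + 162 * (n * 2 ^ K) ≡⟨ cong (λ m → 3 * (6 * (m * m)) + 162 * (n * 2 ^ K)) length-vs ⟩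
    3 * (6 * (3 * p * (3 * p))) + 162 * (n * 2 ^ K) ≡⟨ lem₂ p (n * 2 ^ K) ⟩
    162 * (p * p + n * 2 ^ K)                      ∎
    where
    open ≤-Reasoning
    lem₁ : ∀ m n k → (3 * m + 6 * n) * k ≡ 3 * (m * k) + 6 * (n * k)
    lem₁ = solve-∀
    lem₂ : ∀ p m → 3 * (6 * (3 * p * (3 * p))) + 162 * m ≡ 162 * (p * p + m)
    lem₂ = solve-∀

mainTheorem13 : Σ ℕ λ k → Σ ℕ λ C →
    ∀ (n p : ℕ) → 0 < n → 0 < p →
    (S : PathSystem n) → numPaths S ≡ p → BridgeFree S →
    size S * 2 ^ ((log* p) / suc k) ≤ C * (p * p + n * 2 ^ ((log* p) / suc k))
-- Here `suc k` is 800, and K is the largest integer with 800 K ≤ log* p.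
mainTheorem13 = 799 , 162 , λ { n .(numPaths S) _ _ S refl free →
  Assembly.size-bound S free (log* (numPaths S) / 800)
    (≤-trans (≤-reflexive (*-comm 800 (log* (numPaths S) / 800))) (m/n*n≤m (log* (numPaths S)) 800)) }
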